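{- If the elements arrive in an independently (uniformly) random order in each pass, then for every constant $\varepsilon>0$, there is a multi-pass semi-streaming algorithm for the problem of maximizing a non-negative monotone submodular function $f\colon 2^{\mathcal N}\to\mathbb{R}_{\ge 0}$ subject to a matroid constraint of rank $k$ (any solution has cardinality at most $k$) that stores $O(k/\varepsilon)$ elements, makes $O(\varepsilon^{ -2}\log\varepsilon^{ -1})$ many passes, and achieves an approximation guarantee of $1-1/e-\varepsilon$.
   Context: Problem: given a non-negative monotone submodular function $f\colon 2^{\mathcal N}\to\mathbb{R}_{\ge 0}$ on a finite ground set $\mathcal N$ and a matroid $M=(\mathcal N,\mathcal I)$ of rank $k$, find $S\in\mathcal I$ maximizing $f(S)$. Let $\mathrm{OPT}$ be an optimal solution. In the random order model, an algorithm has approximation guarantee $r$ if on every instance it outputs $S\in\mathcal I$ with $\mathbb{E}[f(S)]\ge r\cdot f(\mathrm{OPT})$, the expectation being over the random arrival orders and the randomness of the algorithm. Data stream model with random order: in each pass the elements of $\mathcal N$ appear one by one in a uniformly random order, chosen independently for each pass, and the algorithm may read them only sequentially. The algorithm has a value oracle and an independence oracle which, given a set $S$ of elements explicitly stored in the memory of the algorithm, return $f(S)$ and whether $S\in\mathcal I$, respectively. A semi-streaming algorithm is a data stream algorithm that uses $O(k\log^{O(1)}|\mathcal N|)$ space. -}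

module Defs where

open import Algebra.Bundles using (CommutativeRing; Semiring)
open import Algebra.Structures using (IsCommutativeRing)
import Algebra.Definitions.RawSemiring as RawSemiringDefinitions
import Algebra.Properties.Ring as RingProperties
import Algebra.Properties.Semiring.Mult as MultProperties
open import Data.Bool.Base using (Bool; true; false; if_then_else_)
open import Data.Fin.Base using (Fin; punchIn; remQuot)
import Data.Fin.Properties as Fin
open import Data.Fin.Subset using (Subset; _∈_; _∉_; _⊆_; _∪_; _∩_; ⁅_⁆; ∣_∣; ⊥)
open import Data.List.Base using (List; []; _∷_)
open import Data.Maybe.Base using (Maybe; just; nothing)
import Data.Maybe.Properties as Maybe
open import Data.Nat.Base as ℕ using (ℕ; zero; suc; NonZero; _!)
open import Data.Nat.Logarithm using (⌈log₂_⌉)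
open import Data.Nat.Properties using (_!≢0)
open import Data.Product.Base using (∃; ∃-syntax; _×_; _,_; proj₁; proj₂)
open import Data.Sum.Base using (_⊎_; inj₁; inj₂)
open import Data.Vec.Base using (Vec; []; _∷_; map; lookup; replicate; toList; _[_]≔_)
open import Function.Bundles using (_↣_)
open import Level using (0ℓ)
open import Relation.Binary.Core using (Rel)
open import Relation.Binary.Structures using (IsDecTotalOrder)
open import Relation.Binary.PropositionalEquality
open import Relation.Nullary using (contradiction)
open import Relation.Nullary.Decidable using (⌊_⌋)
open import Relation.Unary using (Pred; Decidable)

------------------------------------------------------------------------
-- Real numbers

-- The field of real numbers is, up to unique isomorphism, the only
-- complete ordered field.  The order is decidable and the Archimedean
-- property is a field of the record because neither can be extracted
-- constructively from the remaining axioms.  The value of 0# ⁻¹ is left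
-- unspecified.
record CompleteOrderedField : Set₁ where
  infixl 6 _+_
  infixl 7 _*_
  infix  8 -_
  infix  8 _⁻¹
  infix  4 _≤_
  field
    ℝ                 : Set
    _≤_               : Rel ℝ 0ℓ
    _+_ _*_           : ℝ → ℝ → ℝ
    -_ _⁻¹            : ℝ → ℝ
    0# 1#             : ℝ
    isCommutativeRing : IsCommutativeRing _≡_ _+_ _*_ -_ 0# 1#
    0≢1               : 0# ≢ 1#
    ⁻¹-inverseʳ       : ∀ x → x ≢ 0# → x * x ⁻¹ ≡ 1#
    isDecTotalOrder   : IsDecTotalOrder _≡_ _≤_
    +-monoʳ-≤         : ∀ x {y z} → y ≤ z → x + y ≤ x + z
    *-nonneg          : ∀ {x y} → 0# ≤ x → 0# ≤ y → 0# ≤ x * y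

  commutativeRing : CommutativeRing 0ℓ 0ℓ
  commutativeRing = record { isCommutativeRing = isCommutativeRing }

  open CommutativeRing commutativeRing public using
    ( _-_; ring; semiring
    ; +-identityˡ; +-identityʳ; +-assoc; +-comm; -‿inverseˡ; -‿inverseʳ
    ; *-identityˡ; *-identityʳ; *-assoc; *-comm; distribˡ; distribʳ; zeroˡ; zeroʳ
    )
  open RawSemiringDefinitions (Semiring.rawSemiring semiring) public using (_^_; sum)
  open IsDecTotalOrder isDecTotalOrder public using (_≟_; _≤?_; total; antisym)
    renaming (refl to ≤-refl; reflexive to ≤-reflexive; trans to ≤-trans)

  infix 4 _<_
  _<_ : Rel ℝ 0ℓ
  x < y = x ≤ y × x ≢ y

  fromℕ : ℕ → ℝ
  fromℕ n = RawSemiringDefinitions._×_ (Semiring.rawSemiring semiring) n 1#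

  IsUpperBound : Pred ℝ 0ℓ → ℝ → Set
  IsUpperBound P b = ∀ x → P x → x ≤ b

  IsSupremum : Pred ℝ 0ℓ → ℝ → Set
  IsSupremum P s = IsUpperBound P s × (∀ b → IsUpperBound P b → s ≤ b)

  field
    archimedean : ∀ x → ∃[ n ] x ≤ fromℕ n
    complete    : (P : Pred ℝ 0ℓ) → ∃ P → ∃ (IsUpperBound P) → ∃ (IsSupremum P)

module ExpLog (ℛ : CompleteOrderedField) where
  open CompleteOrderedField ℛ
  open RingProperties ring using (-‿distribʳ-*; -‿involutive)

  expSum : ℝ → ℕ → ℝ
  expSum x zero    = 0#
  expSum x (suc n) = expSum x n + x ^ n * fromℕ (n !) ⁻¹

  +-monoˡ-≤ : ∀ x {y z} → y ≤ z → y + x ≤ z + x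
  +-monoˡ-≤ x {y} {z} p = subst₂ _≤_ (+-comm x y) (+-comm x z) (+-monoʳ-≤ x p)

  x≤0⇒0≤-x : ∀ {x} → x ≤ 0# → 0# ≤ - x
  x≤0⇒0≤-x {x} p = subst₂ _≤_ (-‿inverseˡ x) (+-identityʳ (- x)) (+-monoʳ-≤ (- x) p)

  0≤1 : 0# ≤ 1#
  0≤1 with total 0# 1#
  ... | inj₁ p = p
  ... | inj₂ p = subst (0# ≤_) [-1]*[-1]≡1 (*-nonneg (x≤0⇒0≤-x p) (x≤0⇒0≤-x p))
    where
    [-1]*[-1]≡1 : - 1# * - 1# ≡ 1#
    [-1]*[-1]≡1 = trans (sym (-‿distribʳ-* (- 1#) 1#))
                        (trans (cong -_ (*-identityʳ (- 1#))) (-‿involutive 1#))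

  +-nonneg : ∀ {x y} → 0# ≤ x → 0# ≤ y → 0# ≤ x + y
  +-nonneg {x} {y} p q = ≤-trans p (subst (_≤ x + y) (+-identityʳ x) (+-monoʳ-≤ x q))

  0≤fromℕ : ∀ n → 0# ≤ fromℕ n
  0≤fromℕ zero    = ≤-refl
  0≤fromℕ (suc n) = +-nonneg 0≤1 (0≤fromℕ n)

  fromℕ≢0 : ∀ n .{{_ : NonZero n}} → fromℕ n ≢ 0#
  fromℕ≢0 (suc n) eq = 0≢1 (antisym 0≤1 (subst₂ _≤_ (+-identityʳ 1#) eq (+-monoʳ-≤ 1# (0≤fromℕ n))))

  ⁻¹-nonneg : ∀ {x} → 0# ≤ x → x ≢ 0# → 0# ≤ x ⁻¹
  ⁻¹-nonneg {x} 0≤x x≢0 with total 0# (x ⁻¹)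
  ... | inj₁ p = p
  ... | inj₂ p = contradiction (antisym 0≤1 1≤0) 0≢1
    where
    0≤-1 : 0# ≤ - 1#
    0≤-1 = subst (0# ≤_) (trans (sym (-‿distribʳ-* x (x ⁻¹))) (cong -_ (⁻¹-inverseʳ x x≢0)))
                 (*-nonneg 0≤x (x≤0⇒0≤-x p))
    1≤0 : 1# ≤ 0#
    1≤0 = subst₂ _≤_ (+-identityʳ 1#) (-‿inverseʳ 1#) (+-monoʳ-≤ 1# 0≤-1)

  n!⁻¹ : ℕ → ℝ
  n!⁻¹ n = fromℕ (n !) ⁻¹

  n!≢0 : ∀ n → fromℕ (n !) ≢ 0#
  n!≢0 n = fromℕ≢0 (n !) {{n !≢0}}

  0≤n!⁻¹ : ∀ n → 0# ≤ n!⁻¹ n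
  0≤n!⁻¹ n = ⁻¹-nonneg (0≤fromℕ (n !)) (n!≢0 n)

  n!⁻¹-suc : ∀ n → fromℕ (suc n) * n!⁻¹ (suc n) ≡ n!⁻¹ n
  n!⁻¹-suc n = begin
    s * b                ≡⟨ *-identityˡ (s * b) ⟨
    1# * (s * b)         ≡⟨ cong (_* (s * b)) (trans (*-comm a c) (⁻¹-inverseʳ c (n!≢0 n))) ⟨
    (a * c) * (s * b)    ≡⟨ *-assoc a c (s * b) ⟩
    a * (c * (s * b))    ≡⟨ cong (a *_) (*-assoc c s b) ⟨
    a * ((c * s) * b)    ≡⟨ cong (λ z → a * (z * b)) (trans (*-comm c s) (sym (×1-homo-* (suc n) (n !)))) ⟩
    a * (fromℕ (suc n !) * b) ≡⟨ cong (a *_) (⁻¹-inverseʳ _ (n!≢0 (suc n))) ⟩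
    a * 1#               ≡⟨ *-identityʳ a ⟩
    a                    ∎
    where
    open ≡-Reasoning
    open MultProperties semiring using (×1-homo-*)
    s = fromℕ (suc n)
    c = fromℕ (n !)
    a = n!⁻¹ n
    b = n!⁻¹ (suc n)

  0!⁻¹≡1 : n!⁻¹ 0 ≡ 1#
  0!⁻¹≡1 = begin
    n!⁻¹ 0              ≡⟨ *-identityˡ _ ⟨
    1# * n!⁻¹ 0         ≡⟨ cong (_* n!⁻¹ 0) (+-identityʳ 1#) ⟨
    fromℕ 1 * n!⁻¹ 0    ≡⟨ ⁻¹-inverseʳ _ (n!≢0 0) ⟩
    1#                  ∎
    where open ≡-Reasoning

  1^n≡1 : ∀ n → 1# ^ n ≡ 1#
  1^n≡1 zero    = refl
  1^n≡1 (suc n) = trans (*-identityˡ _) (1^n≡1 n)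

  -- Σ_{i<n} 1/i! + 1/n! + 1/n! is at most 3, by induction on n.
  expSum-1-tail≤3 : ∀ n → expSum 1# n + (n!⁻¹ n + n!⁻¹ n) ≤ fromℕ 3
  expSum-1-tail≤3 zero = subst (_≤ fromℕ 3) (sym eq)
    (subst (_≤ fromℕ 3) (+-identityˡ _) (+-monoˡ-≤ (1# + (1# + 0#)) 0≤1))
    where
    eq : 0# + (n!⁻¹ 0 + n!⁻¹ 0) ≡ 1# + (1# + 0#)
    eq = trans (+-identityˡ _)
               (cong₂ _+_ 0!⁻¹≡1 (trans 0!⁻¹≡1 (sym (+-identityʳ 1#))))
  expSum-1-tail≤3 (suc zero) = ≤-reflexive (begin
    0# + 1# * n!⁻¹ 0 + (n!⁻¹ 1 + n!⁻¹ 1)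
      ≡⟨ cong₂ (λ x y → x + (y + y)) (trans (+-identityˡ _) (trans (*-identityˡ _) 0!⁻¹≡1)) 0!⁻¹≡1 ⟩
    1# + (1# + 1#)
      ≡⟨ cong (λ z → 1# + (1# + z)) (+-identityʳ 1#) ⟨
    fromℕ 3 ∎)
    where open ≡-Reasoning
  expSum-1-tail≤3 (suc n@(suc m)) = ≤-trans step (expSum-1-tail≤3 n)
    where
    a = n!⁻¹ n
    b = n!⁻¹ (suc n)
    r = fromℕ m * b
    b+b≤a : b + b ≤ a
    b+b≤a = subst₂ _≤_ (+-identityʳ _) eq (+-monoʳ-≤ (b + b) (*-nonneg (0≤fromℕ m) (0≤n!⁻¹ (suc n))))
      where
      open ≡-Reasoning
      eq : (b + b) + r ≡ a
      eq = begin
        (b + b) + r                              ≡⟨ +-assoc b b r ⟩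
        b + (b + r)                              ≡⟨ cong₂ (λ x y → x + (y + r)) (*-identityˡ b) (*-identityˡ b) ⟨
        1# * b + (1# * b + r)                    ≡⟨ cong (1# * b +_) (distribʳ b 1# (fromℕ m)) ⟨
        1# * b + (1# + fromℕ m) * b              ≡⟨ distribʳ b 1# (1# + fromℕ m) ⟨
        fromℕ (suc n) * b                        ≡⟨ n!⁻¹-suc n ⟩
        a                                        ∎
    step : expSum 1# (suc n) + (b + b) ≤ expSum 1# n + (a + a)
    step = subst₂ _≤_
      (cong (_+ (b + b)) (cong (expSum 1# n +_) (sym (trans (cong (_* a) (1^n≡1 n)) (*-identityˡ a)))))
      (+-assoc (expSum 1# n) a a)
      (+-monoʳ-≤ (expSum 1# n + a) b+b≤a)

  expSum-1≤3 : ∀ n → expSum 1# n ≤ fromℕ 3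
  expSum-1≤3 n = ≤-trans
    (subst (_≤ expSum 1# n + (n!⁻¹ n + n!⁻¹ n)) (+-identityʳ _) (+-monoʳ-≤ (expSum 1# n) (+-nonneg (0≤n!⁻¹ n) (0≤n!⁻¹ n))))
    (expSum-1-tail≤3 n)

  e-supremum : ∃ (IsSupremum (λ x → ∃[ n ] x ≡ expSum 1# n))
  e-supremum = complete _ (expSum 1# 0 , 0 , refl)
    (fromℕ 3 , λ { _ (n , refl) → expSum-1≤3 n })

  e : ℝ
  e = proj₁ e-supremum

  expSum-0≤1 : ∀ n → expSum 0# n ≤ 1#
  expSum-0≤1 zero          = 0≤1
  expSum-0≤1 (suc zero)    = ≤-reflexive (trans (+-identityˡ _) (trans (*-identityˡ _) 0!⁻¹≡1))
  expSum-0≤1 (suc (suc n)) = subst (_≤ 1#) (sym eq) (expSum-0≤1 (suc n))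
    where
    eq : expSum 0# (suc (suc n)) ≡ expSum 0# (suc n)
    eq = trans (cong (expSum 0# (suc n) +_) (trans (cong (_* n!⁻¹ (suc n)) (zeroˡ (0# ^ n))) (zeroˡ _)))
               (+-identityʳ _)

  expSum-2 : ∀ y → expSum y 2 ≡ 1# + y
  expSum-2 y = cong₂ _+_
    (trans (+-identityˡ _) (trans (*-identityˡ _) 0!⁻¹≡1))
    (trans (cong (y * 1# *_) 0!⁻¹≡1) (trans (*-identityʳ _) (*-identityʳ y)))

  -- The natural logarithm of x ≥ 1 is the largest y ≥ 0 with exp y ≤ x,
  -- where exp y, for y ≥ 0, is the supremum of the sums expSum y n.
  log-supremum : ∀ x → 1# ≤ x → ∃ (IsSupremum (λ y → 0# ≤ y × (∀ n → expSum y n ≤ x)))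
  log-supremum x 1≤x = complete _
    (0# , ≤-refl , λ n → ≤-trans (expSum-0≤1 n) 1≤x)
    (x , λ y (_ , exp≤x) → ≤-trans
      (subst₂ _≤_ (+-identityˡ y) (sym (expSum-2 y)) (+-monoˡ-≤ y 0≤1)) (exp≤x 2))

  log : ∀ x → 1# ≤ x → ℝ
  log x 1≤x = proj₁ (log-supremum x 1≤x)

------------------------------------------------------------------------
-- Finitely supported probability distributions, as trees of independent
-- uniform choices

data Dist (A : Set) : Set where
  return  : A → Dist A
  uniform : (m : ℕ) .{{_ : NonZero m}} → (Fin m → Dist A) → Dist A

data Surely {A : Set} (P : A → Set) : Dist A → Set where
  return  : ∀ {a} → P a → Surely P (return a)
  uniform : ∀ {m} .{{_ : NonZero m}} {g : Fin m → Dist A} →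
            (∀ i → Surely P (g i)) → Surely P (uniform m g)

-- The n ! orderings of Fin n: the first entry is arbitrary, and the rest
-- is an ordering of the remaining n ∸ 1 elements.
ordering : ∀ n → Fin (n !) → Vec (Fin n) n
ordering zero    _ = []
ordering (suc n) i = let (x , j) = remQuot (n !) i in x ∷ map (punchIn x) (ordering n j)

------------------------------------------------------------------------
-- Matroids on the ground set Fin n

record Matroid (n : ℕ) : Set₁ where
  field
    Independent  : Pred (Subset n) 0ℓ
    independent? : Decidable Independent
    ∅-independent : Independent ⊥
    hereditary   : ∀ {A B} → A ⊆ B → Independent B → Independent A
    exchange     : ∀ {A B} → Independent A → Independent B → ∣ A ∣ ℕ.< ∣ B ∣ →
                   ∃[ x ] x ∈ B × x ∉ A × Independent (A ∪ ⁅ x ⁆)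

  HasRank : ℕ → Set
  HasRank k = (∃[ B ] Independent B × ∣ B ∣ ≡ k) × (∀ A → Independent A → ∣ A ∣ ℕ.≤ k)

------------------------------------------------------------------------
-- Data stream algorithms

data Operation : Set where
  add sub mul div : Operation

-- The memory of a machine consists of `slots` cells that hold stream
-- elements, `registers` cells that hold real numbers, and a control state
-- of `bits` bits.  Elements are opaque to the machine: they can only be
-- read from the stream, copied, compared for equality and passed to the
-- oracles.  An oracle query, or the output, is given by the subset of
-- slots whose contents form the set.
module _ (slots registers : ℕ) (State : Set) where

  data Instruction : Set where
    startPass    : State → Instruction
    read         : Fin slots → (element endOfStream : State) → Instruction
    copy         : (source target : Fin slots) → State → Instruction
    same?        : (a b : Fin slots) → (yes no : State) → Instruction
    value        : Subset slots → (target : Fin registers) → State → Instruction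
    independent? : Subset slots → (yes no : State) → Instruction
    constant     : ℕ → (target : Fin registers) → State → Instruction
    arithmetic   : Operation → (a b target : Fin registers) → State → Instruction
    atMost?      : (a b : Fin registers) → (yes no : State) → Instruction
    flip         : (heads tails : State) → Instruction
    output       : Subset slots → Instruction

record Machine : Set₁ where
  field
    slots registers bits : ℕ
    State   : Set
    encode  : State ↣ Vec Bool bits
    start   : State
    program : State → Instruction slots registers State

  space : ℕ → ℕ
  space n = slots ℕ.* ⌈log₂ n ⌉ ℕ.+ registers ℕ.+ bits

-- A n k is the machine used on a ground set of size n and rank k.
Algorithm : Set₁
Algorithm = (n k : ℕ) → Machine

-- Space O(k log^{O(1)} n); the condition 2 ≤ n only excludes log n = 0.
SemiStreaming : Algorithm → Set
SemiStreaming A = ∃[ D ] ∃[ c ] ∀ n k → 2 ℕ.≤ n →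
  Machine.space (A n k) n ℕ.≤ D ℕ.* (k ℕ.* ⌈log₂ n ⌉ ℕ.^ c)

contents : ∀ {n s} → Vec (Maybe (Fin n)) s → Subset s → Subset n
contents []             []          = ⊥
contents (just x ∷ xs)  (true ∷ P)  = ⁅ x ⁆ ∪ contents xs P
contents (nothing ∷ xs) (true ∷ P)  = contents xs P
contents (_ ∷ xs)       (false ∷ P) = contents xs P

module Streaming (ℛ : CompleteOrderedField) where
  open CompleteOrderedField ℛ

  expectation : ∀ {A} → (A → ℝ) → Dist A → ℝ
  expectation h (return a)    = h a
  expectation h (uniform m g) = sum (λ i → expectation h (g i)) * fromℕ m ⁻¹

  record MonotoneSubmodular (n : ℕ) : Set where
    field
      f          : Subset n → ℝ
      nonneg     : ∀ A → 0# ≤ f A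
      monotone   : ∀ {A B} → A ⊆ B → f A ≤ f B
      submodular : ∀ A B → f (A ∪ B) + f (A ∩ B) ≤ f A + f B

  record Instance (n k : ℕ) : Set₁ where
    field
      objective : MonotoneSubmodular n
      matroid   : Matroid n
      rank      : Matroid.HasRank matroid k
    open MonotoneSubmodular objective public
    open Matroid matroid public

    IsOptimal : Subset n → Set
    IsOptimal S = Independent S × (∀ T → Independent T → f T ≤ f S)

  perform : Operation → ℝ → ℝ → ℝ
  perform add x y = x + y
  perform sub x y = x - y
  perform mul x y = x * y
  perform div x y = x * y ⁻¹

  record Outcome (n : ℕ) : Set where
    constructor outcome
    field
      solution : Subset n
      passes   : ℕ

  module Execution {n k : ℕ} (I : Instance n k) (M : Machine) where
    open Instance I using (f) renaming (independent? to independent-oracle)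
    open Machine M

    record Configuration : Set where
      constructor configuration
      field
        state    : State
        elements : Vec (Maybe (Fin n)) slots
        reals    : Vec ℝ registers
        stream   : List (Fin n)
        passes   : ℕ

    initial : Configuration
    initial = configuration start (replicate slots nothing) (replicate registers 0#) [] 0

    Result : Set
    Result = Configuration ⊎ Outcome n

    step : Configuration → Dist Result
    step (configuration q xs rs us p) = go (program q) us
      where
      continue : State → Vec (Maybe (Fin n)) slots → Vec ℝ registers → Dist Result
      continue q′ xs′ rs′ = return (inj₁ (configuration q′ xs′ rs′ us p))

      goto : State → Dist Result
      goto q′ = continue q′ xs rs

      go : Instruction slots registers State → List (Fin n) → Dist Result
      go (startPass q′) _ = uniform (n !) {{n !≢0}} λ i →
        return (inj₁ (configuration q′ xs rs (toList (ordering n i)) (suc p)))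
      go (read a q₁ q₂) []        = goto q₂
      go (read a q₁ q₂) (u ∷ us′) = return (inj₁ (configuration q₁ (xs [ a ]≔ just u) rs us′ p))
      go (copy a b q′) _          = continue q′ (xs [ b ]≔ lookup xs a) rs
      go (same? a b q₁ q₂) _      =
        goto (if ⌊ Maybe.≡-dec Fin._≟_ (lookup xs a) (lookup xs b) ⌋ then q₁ else q₂)
      go (value P j q′) _         = continue q′ xs (rs [ j ]≔ f (contents xs P))
      go (independent? P q₁ q₂) _ =
        goto (if ⌊ independent-oracle (contents xs P) ⌋ then q₁ else q₂)
      go (constant c j q′) _      = continue q′ xs (rs [ j ]≔ fromℕ c)
      go (arithmetic o a b j q′) _ =
        continue q′ xs (rs [ j ]≔ perform o (lookup rs a) (lookup rs b))
      go (atMost? a b q₁ q₂) _    = goto (if ⌊ lookup rs a ≤? lookup rs b ⌋ then q₁ else q₂)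
      go (flip q₁ q₂) _           = uniform 2 λ where
        Fin.zero    → goto q₁
        (Fin.suc _) → goto q₂
      go (output P) _             = return (inj₂ (outcome (contents xs P) p))

    -- r ⇓ d: every execution that continues from a result drawn from r
    -- halts, and the final outcome has distribution d.
    infix 4 _⇓_
    data _⇓_ : Dist Result → Dist (Outcome n) → Set where
      halted : ∀ {o} → return (inj₂ o) ⇓ return o
      next   : ∀ {c d} → step c ⇓ d → return (inj₁ c) ⇓ d
      choose : ∀ {m} .{{_ : NonZero m}} {g : Fin m → Dist Result} {h : Fin m → Dist (Outcome n)} →
               (∀ i → g i ⇓ h i) → uniform m g ⇓ uniform m h

    OutputDistribution : Dist (Outcome n) → Set
    OutputDistribution d = return (inj₁ initial) ⇓ d

  -- On every instance, all executions of the algorithm halt after at most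
  -- p passes with an independent set, whose expected value is at least r
  -- times the optimum.
  HasGuarantee : Algorithm → (p : ℕ) → (r : ℝ) → Set₁
  HasGuarantee A p r = ∀ {n k} (I : Instance n k) → let open Instance I in
    ∃[ d ] Execution.OutputDistribution I (A n k) d
         × Surely (λ o → Outcome.passes o ℕ.≤ p) d
         × Surely (λ o → Independent (Outcome.solution o)) d
         × (∀ OPT → IsOptimal OPT → r * f OPT ≤ expectation (λ o → f (Outcome.solution o)) d)

{-# OPTIONS --safe #-}
module Submission where

-- The algorithm makes T = m² passes with m ≥ 2/ε, and works for every order of
-- arrival.  It maintains one independent set C.  Write S(q) for a random subset
-- of S that contains each element independently with probability q.  In pass t,
-- a set B is built by the one-pass algorithm for bases of maximum weight: the
-- weight of an arriving element is the amount by which it increases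
-- H(B) = E f(C(t/T) ∪ B(1/T)), and it replaces the lightest element for which it
-- can be exchanged if it is heavier by a factor 1 + 1/m.  The elements that were
-- accepted and discarded again weigh at most m times as much as B, and only enter
-- the estimate multiplied by the sampling rate 1/T.  So every independent O has
-- f(O) - φ ≤ (m + 1)² (H(B) - φ), where φ = E f(C(t/T)).  Then C and B are merged:
-- by symmetric exchange and multilinearity there is an independent E ⊆ C ∪ B with
-- E f(E((t+1)/T)) ≥ H(B), and it becomes the new C.  The time of a machine is not
-- limited, hence expectations are computed exactly and E is found by exhaustive
-- search.  After T passes f(O) - f(C) ≤ (1 - 1/(m + 1)²)^(m²) f(O) ≤ (1/e + ε) f(O).

open import Defs
import Algebra.Properties.Ring as RingProperties
import Algebra.Properties.Semiring.Mult as MultProperties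
import Algebra.Solver.Ring
open import Algebra.Solver.Ring.AlmostCommutativeRing using (fromCommutativeRing; _-Raw-AlmostCommutative⟶_)
open import Data.Bool.Base using (Bool; true; false; if_then_else_; not; _∧_)
import Data.Bool.Properties as Bool
open import Data.Empty using () renaming (⊥ to Empty)
open import Data.Fin.Base using (Fin; zero; suc; _↑ˡ_; _↑ʳ_; toℕ; fromℕ<; punchIn; punchOut; remQuot)
import Data.Fin.Properties as Fin
open import Data.Fin.Subset using (Subset; _∈_; _∉_; _⊆_; _∪_; _∩_; ⁅_⁆; ⊥; ∁; ∣_∣; ⊤) renaming (_-_ to infixl 5 _∖_)
open import Data.Fin.Subset.Properties using (⊆-refl; ⊆-antisym; p⊆p∪q; q⊆p∪q; x∈p∪q⁻; x∈p∪q⁺; x∈p∩q⁺; x∈p∩q⁻; ∪-identityˡ; ∪-identityʳ; ∪-assoc; ∪-comm; s⊆s; out⊆; ⊥⊆; _∈?_; ⊆-trans; x∈⁅x⁆; x∈⁅y⁆⇒x≡y; p⊂q⇒∣p∣<∣q∣; x∈p⇒∣p-x∣<∣p∣; x∈p∧x≢y⇒x∈p-y; x∉p⇒x∈∁p; x∈∁p⇒x∉p; p─q⊆p; p⊆q⇒∣p∣≤∣q∣; ∈⊤; ∣⊤∣≡n; ∣⊥∣≡0; Empty-unique; p∩q⊆p; ∉⊥; ⊆⊤; ∩-identityˡ)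
open import Data.Integer.Base as ℤ using (ℤ; -[1+_]; +0; +[1+_]) renaming (+_ to pos)
import Data.Integer.Properties as ℤ
open import Data.List.Base as List using (List; []; _∷_; foldl)
import Data.List.Membership.Propositional as List
open import Data.List.Membership.Propositional.Properties using (∈-map⁺)
import Data.List.Relation.Unary.All as All
import Data.List.Relation.Unary.All.Properties as All
import Data.List.Relation.Unary.AllPairs as AllPairs
import Data.List.Relation.Unary.Any as Any
open import Data.List.Relation.Unary.Unique.Propositional using (Unique)
open import Data.List.Relation.Unary.Unique.Propositional.Properties using (map⁺)
open import Data.Maybe.Base as Maybe using (Maybe; just; nothing; maybe′)
open import Data.Maybe.Properties as Maybe using (just-injective)
open import Data.Nat.Base as ℕ using (ℕ; zero; suc; _!; NonZero)
open import Data.Nat.Logarithm using (⌈log₂_⌉; ⌈log₂⌉-mono-≤)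
import Data.Nat.Properties as ℕ
open import Data.Nat.Solver using (module +-*-Solver)
open import Data.Product.Base using (∃; ∃-syntax; Σ-syntax; _×_; _,_; proj₁; proj₂)
open import Data.Sum.Base using (_⊎_; inj₁; inj₂; [_,_]′)
open import Data.Unit.Base using (tt) renaming (⊤ to Unit)
open import Data.Vec.Base using (Vec; []; _∷_; map; zipWith; lookup; replicate; _++_; _[_]≔_; here; there; tabulate; toList)
open import Data.Vec.Properties using ([]=⇒lookup; map-[]≔; lookup∘updateAt; []≔-lookup; []≔-commutes; lookup⇒[]=; lookup∘tabulate; lookup∘updateAt′; lookup-replicate; ∷-injective; map-++; map-cong; map-∘; lookup-++ˡ; lookup-++ʳ; []≔-++-↑ˡ; []≔-++-↑ʳ; toList-map; tabulate∘lookup)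
open import Function.Base using (_∘_)
open import Function.Bundles using (_↣_; mk↣; Injection)
open import Level using (0ℓ)
open import Relation.Binary.Bundles using (Poset)
open import Relation.Binary.PropositionalEquality using (_≡_; _≢_; refl; sym; trans; cong; cong₂; subst; subst₂; module ≡-Reasoning)
import Relation.Binary.Reasoning.PartialOrder as PartialOrderReasoning
open import Relation.Binary.Structures using (IsDecTotalOrder)
open import Relation.Nullary using (¬_; Dec; yes; no; contradiction)
open import Relation.Nullary.Decidable using (⌊_⌋; _×-dec_; ¬?; dec-true; does)
open import Relation.Nullary.Reflects using (Reflects; ofʸ; ofⁿ; _×-reflects_; ¬-reflects; invert)
open import Relation.Unary using (Pred; Decidable)

-- Ordered fields

-- This is a discretised continuous greedy process: at time t/T it stands at the point with rate t/T
-- on the elements of C. An average of T bases would occupy about k T cells; rounding to one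
-- independent set after every pass keeps the number of cells linear in k, whatever ε is. Rounding
-- loses nothing: when mass moves between i and j, the multilinear extension is convex, and the two
-- end points are the two sets of a symmetric exchange. T = m² balances the two losses of a pass.
-- With δ = 1/T and W the total weight of B, the pass gives δ (f(O) - φ) ≤ (1 + 1/m) W + δ (m + 1)
-- W. Since δ m² = 1, this is f(O) - φ ≤ (m + 1)² W. The constant 36 pays for the logarithm, which
-- vanishes as ε tends to 1. If ε ≥ 3/4, then e ≤ 3 makes the required ratio at most 0, and the
-- empty set suffices. If ε ≤ 3/4, then log(1/ε) ≥ 1 - ε ≥ 1/4 and m ≤ 2/ε + 1 ≤ 3/ε, so m² ≤ 9/ε² ≤
-- 36 log(1/ε)/ε².

module OrderedFieldProperties (ℛ : CompleteOrderedField) where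
  open CompleteOrderedField ℛ
  open ExpLog ℛ using (+-monoˡ-≤; x≤0⇒0≤-x; 0≤1; +-nonneg; 0≤fromℕ; fromℕ≢0; ⁻¹-nonneg)
  open RingProperties ring using (-‿distribʳ-*; -‿distribˡ-*; -‿involutive; -‿+-comm; -0#≈0#)
  open MultProperties semiring using (×-homo-+; ×1-homo-*)

  private
    fromℤ : ℤ → ℝ
    fromℤ (pos n)    = fromℕ n
    fromℤ -[1+ n ] = - fromℕ (suc n)

    fromℤ-neg : ∀ i → fromℤ (ℤ.- i) ≡ - fromℤ i
    fromℤ-neg +0       = sym -0#≈0#
    fromℤ-neg +[1+ n ] = refl
    fromℤ-neg -[1+ n ] = sym (-‿involutive _)

    cancel : ∀ a b c → (a + b) - (a + c) ≡ b - c
    cancel a b c = begin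
      (a + b) + - (a + c)     ≡⟨ cong ((a + b) +_) (-‿+-comm a c) ⟨
      (a + b) + (- a + - c)   ≡⟨ cong (_+ (- a + - c)) (+-comm a b) ⟩
      (b + a) + (- a + - c)   ≡⟨ +-assoc b a _ ⟩
      b + (a + (- a + - c))   ≡⟨ cong (b +_) (+-assoc a (- a) (- c)) ⟨
      b + ((a + - a) + - c)   ≡⟨ cong (λ z → b + (z + - c)) (-‿inverseʳ a) ⟩
      b + (0# + - c)          ≡⟨ cong (b +_) (+-identityˡ _) ⟩
      b - c                   ∎
      where open ≡-Reasoning

    fromℤ-⊖ : ∀ m n → fromℤ (m ℤ.⊖ n) ≡ fromℕ m - fromℕ n
    fromℤ-⊖ m       zero    = sym (trans (cong (fromℕ m +_) -0#≈0#) (+-identityʳ _))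
    fromℤ-⊖ zero    (suc n) = sym (+-identityˡ _)
    fromℤ-⊖ (suc m) (suc n) = trans (cong fromℤ (ℤ.[1+m]⊖[1+n]≡m⊖n m n))
      (trans (fromℤ-⊖ m n) (sym (cancel 1# (fromℕ m) (fromℕ n))))

    fromℤ-+ : ∀ i j → fromℤ (i ℤ.+ j) ≡ fromℤ i + fromℤ j
    fromℤ-+ (pos m)    (pos n)    = ×-homo-+ 1# m n
    fromℤ-+ (pos m)    -[1+ n ] = fromℤ-⊖ m (suc n)
    fromℤ-+ -[1+ m ] (pos n)    = trans (fromℤ-⊖ n (suc m)) (+-comm _ _)
    fromℤ-+ -[1+ m ] -[1+ n ] = trans
      (cong (λ k → - fromℕ k) (cong suc (sym (ℕ.+-suc m n))))
      (trans (cong -_ (×-homo-+ 1# (suc m) (suc n))) (sym (-‿+-comm _ _)))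

    fromℤ-* : ∀ i j → fromℤ (i ℤ.* j) ≡ fromℤ i * fromℤ j
    fromℤ-* (pos m)    (pos n)    = trans (cong fromℤ (sym (ℤ.pos-* m n))) (×1-homo-* m n)
    fromℤ-* (pos m)    -[1+ n ] = trans (cong fromℤ (sym (ℤ.neg-distribʳ-* (pos m) +[1+ n ])))
      (trans (fromℤ-neg (pos m ℤ.* +[1+ n ]))
        (trans (cong -_ (fromℤ-* (pos m) +[1+ n ])) (-‿distribʳ-* _ _)))
    fromℤ-* -[1+ m ] (pos n)    = trans (cong fromℤ (sym (ℤ.neg-distribˡ-* +[1+ m ] (pos n))))
      (trans (fromℤ-neg (+[1+ m ] ℤ.* pos n))
        (trans (cong -_ (fromℤ-* +[1+ m ] (pos n))) (-‿distribˡ-* _ _)))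
    fromℤ-* -[1+ m ] -[1+ n ] = trans (×1-homo-* (suc m) (suc n))
      (trans (sym (-‿involutive _)) (trans (cong -_ (-‿distribˡ-* _ _)) (-‿distribʳ-* _ _)))

    -- Sends 1 to 1# on the nose, so that constants in solver goals match.
    coefficient : ℤ → ℝ
    coefficient (pos 1) = 1#
    coefficient i       = fromℤ i

    coefficient≡fromℤ : ∀ i → coefficient i ≡ fromℤ i
    coefficient≡fromℤ (pos 0)             = refl
    coefficient≡fromℤ (pos 1)             = sym (+-identityʳ 1#)
    coefficient≡fromℤ (pos (suc (suc n))) = refl
    coefficient≡fromℤ -[1+ n ]            = refl

    coefficient-homo₂ : ∀ (_∙_ : ℤ → ℤ → ℤ) (_◦_ : ℝ → ℝ → ℝ) →
      (∀ i j → fromℤ (i ∙ j) ≡ fromℤ i ◦ fromℤ j) →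
      ∀ i j → coefficient (i ∙ j) ≡ coefficient i ◦ coefficient j
    coefficient-homo₂ _∙_ _◦_ homo i j = trans (coefficient≡fromℤ (i ∙ j)) (trans (homo i j)
      (sym (cong₂ _◦_ (coefficient≡fromℤ i) (coefficient≡fromℤ j))))

    morphism : ℤ.+-*-rawRing -Raw-AlmostCommutative⟶ fromCommutativeRing commutativeRing
    morphism = record
      { ⟦_⟧    = coefficient
      ; +-homo = coefficient-homo₂ ℤ._+_ _+_ fromℤ-+
      ; *-homo = coefficient-homo₂ ℤ._*_ _*_ fromℤ-*
      ; -‿homo = λ i → trans (coefficient≡fromℤ (ℤ.- i))
                   (trans (fromℤ-neg i) (cong -_ (sym (coefficient≡fromℤ i))))
      ; 0-homo = refl
      ; 1-homo = refl
      }

    coefficient-≟ : ∀ i j → Maybe (coefficient i ≡ coefficient j)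
    coefficient-≟ i j with i ℤ.≟ j
    ... | yes eq = just (cong coefficient eq)
    ... | no _   = nothing

  open Algebra.Solver.Ring ℤ.+-*-rawRing (fromCommutativeRing commutativeRing) morphism coefficient-≟ public
    using (Polynomial; solve; _:+_; _:*_; _:-_; con; _:=_)

  poset : Poset 0ℓ 0ℓ 0ℓ
  poset = record { isPartialOrder = IsDecTotalOrder.isPartialOrder isDecTotalOrder }

  module ≤-Reasoning = PartialOrderReasoning poset

  :0 :1 : ∀ {n} → Polynomial n
  :0 = con (pos 0)
  :1 = con (pos 1)

  fromℕ-+ : ∀ m n → fromℕ (m ℕ.+ n) ≡ fromℕ m + fromℕ n
  fromℕ-+ = ×-homo-+ 1#

  fromℕ-* : ∀ m n → fromℕ (m ℕ.* n) ≡ fromℕ m * fromℕ n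
  fromℕ-* = ×1-homo-*

  fromℕ-1 : fromℕ 1 ≡ 1#
  fromℕ-1 = +-identityʳ 1#

  fromℕ-^ : ∀ m n → fromℕ (m ℕ.^ n) ≡ fromℕ m ^ n
  fromℕ-^ m zero    = fromℕ-1
  fromℕ-^ m (suc n) = trans (fromℕ-* m (m ℕ.^ n)) (cong (fromℕ m *_) (fromℕ-^ m n))

  0≤y-x : ∀ {x y} → x ≤ y → 0# ≤ y - x
  0≤y-x {x} {y} p = subst₂ _≤_ (-‿inverseˡ x) (+-comm (- x) y) (+-monoʳ-≤ (- x) p)

  -- Inequalities are proved by exhibiting the difference of their sides as
  -- a sum of products of non-negative terms.
  ≤-by : ∀ {x y d} → 0# ≤ d → d ≡ y - x → x ≤ y
  ≤-by {x} {y} p refl = subst₂ _≤_ (+-identityʳ x) (solve 2 (λ x y → x :+ (y :- x) := y) refl x y)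
    (+-monoʳ-≤ x p)

  ≰⇒≥ : ∀ {x y} → ¬ x ≤ y → y ≤ x
  ≰⇒≥ {x} {y} ¬p with total x y
  ... | inj₁ p = contradiction p ¬p
  ... | inj₂ p = p

  +-mono-≤ : ∀ {a b c d} → a ≤ b → c ≤ d → a + c ≤ b + d
  +-mono-≤ {b = b} {c} p q = ≤-trans (+-monoˡ-≤ c p) (+-monoʳ-≤ b q)

  *-monoˡ-≤ : ∀ {a x y} → 0# ≤ a → x ≤ y → a * x ≤ a * y
  *-monoˡ-≤ {a} {x} {y} p q = ≤-by (*-nonneg p (0≤y-x q))
    (solve 3 (λ a x y → a :* (y :- x) := a :* y :- a :* x) refl a x y)

  *-monoʳ-≤ : ∀ {a x y} → 0# ≤ a → x ≤ y → x * a ≤ y * a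
  *-monoʳ-≤ {a} {x} {y} p q = subst₂ _≤_ (*-comm a x) (*-comm a y) (*-monoˡ-≤ p q)

  x≤0∧0≤y⇒xy≤0 : ∀ {x y} → x ≤ 0# → 0# ≤ y → x * y ≤ 0#
  x≤0∧0≤y⇒xy≤0 {x} {y} p q = subst (x * y ≤_) (zeroˡ y) (*-monoʳ-≤ q p)

  0<⇒≢0 : ∀ {x} → 0# < x → x ≢ 0#
  0<⇒≢0 (_ , neq) eq = neq (sym eq)

  ⁻¹-inverseˡ : ∀ {x} → x ≢ 0# → x ⁻¹ * x ≡ 1#
  ⁻¹-inverseˡ {x} neq = trans (*-comm _ x) (⁻¹-inverseʳ x neq)

  0<-≤-trans : ∀ {x y} → 0# < x → x ≤ y → 0# < y
  0<-≤-trans (p , neq) q = ≤-trans p q , λ { refl → neq (antisym p q) }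

  0<1 : 0# < 1#
  0<1 = 0≤1 , 0≢1

  0<fromℕ-suc : ∀ n → 0# < fromℕ (suc n)
  0<fromℕ-suc n = 0≤fromℕ (suc n) , λ eq → fromℕ≢0 (suc n) (sym eq)

  1≤fromℕ-suc : ∀ n → 1# ≤ fromℕ (suc n)
  1≤fromℕ-suc n = subst (_≤ fromℕ (suc n)) (+-identityʳ 1#) (+-monoʳ-≤ 1# (0≤fromℕ n))

  *-cancelˡ-≤ : ∀ {a x y} → 0# < a → a * x ≤ a * y → x ≤ y
  *-cancelˡ-≤ {a} {x} {y} 0<a@(0≤a , _) p =
    subst₂ _≤_ (inverse x) (inverse y) (*-monoˡ-≤ (⁻¹-nonneg 0≤a (0<⇒≢0 0<a)) p)
    where
    inverse : ∀ z → a ⁻¹ * (a * z) ≡ z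
    inverse z = trans (sym (*-assoc _ a z))
      (trans (cong (_* z) (⁻¹-inverseˡ (0<⇒≢0 0<a))) (*-identityˡ z))

  ≤⇒1≤*⁻¹ : ∀ {a x} → 0# < a → a ≤ x → 1# ≤ x * a ⁻¹
  ≤⇒1≤*⁻¹ {a} {x} 0<a@(0≤a , _) p = subst (_≤ x * a ⁻¹) (⁻¹-inverseʳ a (0<⇒≢0 0<a))
    (*-monoʳ-≤ (⁻¹-nonneg 0≤a (0<⇒≢0 0<a)) p)

  fromℕ-mono-≤ : ∀ {m n} → m ℕ.≤ n → fromℕ m ≤ fromℕ n
  fromℕ-mono-≤ {n = n} ℕ.z≤n = 0≤fromℕ n
  fromℕ-mono-≤ (ℕ.s≤s p)     = +-monoʳ-≤ 1# (fromℕ-mono-≤ p)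

  ^-nonneg : ∀ {x} n → 0# ≤ x → 0# ≤ x ^ n
  ^-nonneg zero    p = 0≤1
  ^-nonneg (suc n) p = *-nonneg p (^-nonneg n p)

  ^-+ : ∀ x m n → x ^ (m ℕ.+ n) ≡ x ^ m * x ^ n
  ^-+ x zero    n = sym (*-identityˡ _)
  ^-+ x (suc m) n = trans (cong (x *_) (^-+ x m n)) (sym (*-assoc x _ _))

  -- The Archimedean bound is lowered step by step until the next step would fall below x. The upper
  -- estimate is what later bounds the number of passes.
  ceiling : ∀ x → 0# ≤ x → ∃[ n ] x ≤ fromℕ n × fromℕ n ≤ x + 1#
  ceiling x 0≤x = let (n , p) = archimedean x in search n p
    where
    search : ∀ n → x ≤ fromℕ n → ∃[ n ] x ≤ fromℕ n × fromℕ n ≤ x + 1#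
    search zero    p = 0 , p , +-nonneg 0≤x 0≤1
    search (suc n) p with x ≤? fromℕ n
    ... | yes q = search n q
    ... | no ¬q = suc n , p , subst (fromℕ (suc n) ≤_) (+-comm 1# x) (+-monoʳ-≤ 1# (≰⇒≥ ¬q))

-- Bounds on exp and log

module ExpLogBounds (ℛ : CompleteOrderedField) where
  open CompleteOrderedField ℛ
  open ExpLog ℛ
  open OrderedFieldProperties ℛ

  1≤e : 1# ≤ e
  1≤e = subst (_≤ e) (trans (+-identityˡ _) (trans (*-identityˡ _) 0!⁻¹≡1))
    (proj₁ (proj₂ e-supremum) _ (1 , refl))

  0<e : 0# < e
  0<e = 0<-≤-trans 0<1 1≤e

  0≤e⁻¹ : 0# ≤ e ⁻¹
  0≤e⁻¹ = ⁻¹-nonneg (proj₁ 0<e) (0<⇒≢0 0<e)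

  1≤3e⁻¹ : 1# ≤ fromℕ 3 * e ⁻¹
  1≤3e⁻¹ = ≤⇒1≤*⁻¹ 0<e (proj₂ (proj₂ e-supremum) (fromℕ 3) λ { _ (n , refl) → expSum-1≤3 n })

  -- The tangent estimate for powers, with the slope taken at the right end point. Division by the
  -- factorial of `suc n` turns its last term into z times the preceding term of the exponential
  -- series.
  ^-suc-mono : ∀ {x z} → 0# ≤ x → 0# ≤ z → ∀ n →
    (x + z) ^ suc n ≤ x ^ suc n + fromℕ (suc n) * (z * (x + z) ^ n)
  ^-suc-mono {x} {z} 0≤x 0≤z zero = ≤-reflexive
    (trans (solve 2 (λ x z → (x :+ z) :* :1 := x :* :1 :+ :1 :* (z :* :1)) refl x z)
           (cong (λ c → x * 1# + c * (z * 1#)) (sym fromℕ-1)))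
  ^-suc-mono {x} {z} 0≤x 0≤z (suc n) = ≤-by
    (+-nonneg (*-nonneg 0≤x (0≤y-x (^-suc-mono 0≤x 0≤z n)))
              (*-nonneg (*-nonneg (0≤fromℕ (suc n)) 0≤z) (*-nonneg 0≤z (^-nonneg n (+-nonneg 0≤x 0≤z)))))
    (solve 5 (λ x z c a b →
        x :* (b :+ c :* (z :* a) :- (x :+ z) :* a) :+ c :* z :* (z :* a)
        := x :* b :+ (:1 :+ c) :* (z :* ((x :+ z) :* a)) :- (x :+ z) :* ((x :+ z) :* a))
      refl x z (fromℕ (suc n)) ((x + z) ^ n) (x ^ suc n))

  expSum-shift-term : ∀ {x z} → 0# ≤ x → 0# ≤ z → ∀ n →
    (x + z) ^ suc n * n!⁻¹ (suc n) ≤ x ^ suc n * n!⁻¹ (suc n) + z * ((x + z) ^ n * n!⁻¹ n)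
  expSum-shift-term {x} {z} 0≤x 0≤z n = subst ((x + z) ^ suc n * n!⁻¹ (suc n) ≤_) eq
    (*-monoʳ-≤ (0≤n!⁻¹ (suc n)) (^-suc-mono 0≤x 0≤z n))
    where
    eq : (x ^ suc n + fromℕ (suc n) * (z * (x + z) ^ n)) * n!⁻¹ (suc n)
         ≡ x ^ suc n * n!⁻¹ (suc n) + z * ((x + z) ^ n * n!⁻¹ n)
    eq = trans
      (solve 5 (λ p c z q b → (p :+ c :* (z :* q)) :* b := p :* b :+ z :* (q :* (c :* b))) refl
        (x ^ suc n) (fromℕ (suc n)) z ((x + z) ^ n) (n!⁻¹ (suc n)))
      (cong (λ r → x ^ suc n * n!⁻¹ (suc n) + z * ((x + z) ^ n * r)) (n!⁻¹-suc n))

  expSum-suc-shift : ∀ {x z} → 0# ≤ x → 0# ≤ z → ∀ n →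
    expSum (x + z) (suc n) ≤ expSum x (suc n) + z * expSum (x + z) n
  expSum-suc-shift {x} {z} 0≤x 0≤z zero = ≤-reflexive (sym (trans (cong (expSum x 1 +_) (zeroʳ z)) (+-identityʳ _)))
  expSum-suc-shift {x} {z} 0≤x 0≤z (suc n) = subst (expSum (x + z) (suc (suc n)) ≤_)
    (solve 5 (λ a z b c d → (a :+ z :* b) :+ (c :+ z :* d) := (a :+ c) :+ z :* (b :+ d)) refl
      (expSum x (suc n)) z (expSum (x + z) n) (x ^ suc n * n!⁻¹ (suc n)) ((x + z) ^ n * n!⁻¹ n))
    (+-mono-≤ (expSum-suc-shift 0≤x 0≤z n) (expSum-shift-term 0≤x 0≤z n))

  expSum-mono-suc : ∀ {x} → 0# ≤ x → ∀ n → expSum x n ≤ expSum x (suc n)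
  expSum-mono-suc {x} 0≤x n = subst (_≤ expSum x (suc n)) (+-identityʳ _)
    (+-monoʳ-≤ (expSum x n) (*-nonneg (^-nonneg n 0≤x) (0≤n!⁻¹ n)))

  -- A truncated form of exp (x + z) (1 - z) ≤ exp x.
  expSum-shift : ∀ {x z} → 0# ≤ x → 0# ≤ z → ∀ n →
    expSum (x + z) n * (1# - z) ≤ expSum x n
  expSum-shift {x} {z} 0≤x 0≤z zero = ≤-reflexive (zeroˡ _)
  expSum-shift {x} {z} 0≤x 0≤z (suc n) = ≤-by
    (+-nonneg (0≤y-x (expSum-suc-shift 0≤x 0≤z n)) (*-nonneg 0≤z (0≤y-x (expSum-mono-suc (+-nonneg 0≤x 0≤z) n))))
    (solve 4 (λ a b c z → (a :+ z :* b :- c) :+ z :* (c :- b) := a :- c :* (:1 :- z)) refl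
      (expSum x (suc n)) (expSum (x + z) n) (expSum (x + z) (suc n)) z)

  -- Applying `expSum-shift` m times walks from `fromℕ m * z` down to 0, where every partial sum is
  -- at most 1. Partial sums are the right objects because `e` and `log` are given as suprema over
  -- them.
  expSum-power : ∀ {z} → 0# ≤ z → z ≤ 1# → ∀ m n → expSum (fromℕ m * z) n * (1# - z) ^ m ≤ 1#
  expSum-power {z} 0≤z z≤1 zero n = ≤-trans (≤-reflexive (*-identityʳ _))
    (subst (λ x → expSum x n ≤ 1#) (sym (zeroˡ z)) (expSum-0≤1 n))
  expSum-power {z} 0≤z z≤1 (suc m) n = ≤-trans
    (≤-trans (≤-reflexive eq) (*-monoʳ-≤ (^-nonneg m (0≤y-x z≤1)) (expSum-shift (*-nonneg (0≤fromℕ m) 0≤z) 0≤z n)))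
    (expSum-power 0≤z z≤1 m n)
    where
    eq : expSum (fromℕ (suc m) * z) n * (1# - z) ^ suc m ≡ expSum (fromℕ m * z + z) n * (1# - z) * (1# - z) ^ m
    eq = trans (cong (λ x → expSum x n * (1# - z) ^ suc m)
                  (solve 2 (λ c z → (:1 :+ c) :* z := c :* z :+ z) refl (fromℕ m) z))
               (sym (*-assoc _ _ _))

  -- `expSum-power` bounds each partial sum of e by the reciprocal of the power, so the supremum
  -- obeys the same bound. Strictness in `z < 1#` keeps the power positive and hence invertible.
  [1-1/m]^m≤e⁻¹ : ∀ {z} → 0# ≤ z → z < 1# → ∀ m → fromℕ m * z ≡ 1# → (1# - z) ^ m ≤ e ⁻¹
  [1-1/m]^m≤e⁻¹ {z} 0≤z (z≤1 , z≢1) m mz≡1 = *-cancelˡ-≤ 0<e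
    (subst₂ _≤_ (*-comm _ e) (sym (⁻¹-inverseʳ e (0<⇒≢0 0<e))) e*r≤1)
    where
    r = (1# - z) ^ m
    r<  : ∀ k → 0# < (1# - z) ^ k
    r< zero    = 0<1
    r< (suc k) = *-nonneg (0≤y-x z≤1) (proj₁ (r< k)) , λ eq →
      proj₂ (r< k) (antisym (proj₁ (r< k)) (*-cancelˡ-≤ 0<1-z (≤-reflexive (trans (sym eq) (sym (zeroʳ _))))))
      where
      0<1-z : 0# < 1# - z
      0<1-z = 0≤y-x z≤1 , λ eq → z≢1 (sym (trans (solve 1 (λ z → :1 := z :+ (:1 :- z)) refl z)
        (trans (cong (z +_) (sym eq)) (+-identityʳ z))))
    e≤r⁻¹ : e ≤ r ⁻¹
    e≤r⁻¹ = proj₂ (proj₂ e-supremum) (r ⁻¹) λ { _ (n , refl) → *-cancelˡ-≤ (r< m)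
      (subst₂ _≤_ (trans (cong (λ x → expSum x n * r) mz≡1) (*-comm _ r))
        (sym (⁻¹-inverseʳ r (0<⇒≢0 (r< m)))) (expSum-power 0≤z z≤1 m n)) }
    e*r≤1 : r * e ≤ 1#
    e*r≤1 = subst (r * e ≤_) (⁻¹-inverseʳ r (0<⇒≢0 (r< m))) (*-monoˡ-≤ (proj₁ (r< m)) e≤r⁻¹)

  log-nonneg : ∀ x (1≤x : 1# ≤ x) → 0# ≤ log x 1≤x
  log-nonneg x 1≤x = proj₁ (proj₂ (log-supremum x 1≤x)) 0# (≤-refl , λ n → ≤-trans (expSum-0≤1 n) 1≤x)

  -- As `log` is a supremum, it suffices that every partial sum of exp (1 - x) is at most 1/x, which
  -- is `expSum-power` with a single factor and z = 1 - x.
  1-x≤log[x⁻¹] : ∀ {x} → 0# < x → x ≤ 1# → (1≤x⁻¹ : 1# ≤ x ⁻¹) → 1# - x ≤ log (x ⁻¹) 1≤x⁻¹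
  1-x≤log[x⁻¹] {x} 0<x x≤1 1≤x⁻¹ = proj₁ (proj₂ (log-supremum (x ⁻¹) 1≤x⁻¹)) (1# - x)
    (0≤y-x x≤1 , λ n → *-cancelˡ-≤ 0<x (subst₂ _≤_ (eq n) (sym (⁻¹-inverseʳ x (0<⇒≢0 0<x)))
      (expSum-power (0≤y-x x≤1) 1-x≤1 1 n)))
    where
    1-x≤1 : 1# - x ≤ 1#
    1-x≤1 = ≤-by (proj₁ 0<x) (solve 1 (λ x → x := :1 :- (:1 :- x)) refl x)
    eq : ∀ n → expSum (fromℕ 1 * (1# - x)) n * (1# - (1# - x)) ^ 1 ≡ x * expSum (1# - x) n
    eq n = trans (cong₂ (λ a b → expSum a n * (b * 1#))
                   (trans (cong (_* (1# - x)) fromℕ-1) (*-identityˡ _))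
                   (solve 1 (λ x → :1 :- (:1 :- x) := x) refl x))
                 (trans (cong (expSum (1# - x) n *_) (*-identityʳ x)) (*-comm _ x))

module _ (ℛ : CompleteOrderedField) where
  open CompleteOrderedField ℛ
  open ExpLog ℛ
  open OrderedFieldProperties ℛ

  module DecayRate (μ : ℝ) (0≤μ : 0# ≤ μ) where
    -- A pass closes at least the fraction z of the gap to the optimum, so 1 - z is the decay
    -- factor.
    N z : ℝ
    N = (1# + μ) * (1# + μ)
    z = N ⁻¹

    1≤N : 1# ≤ N
    1≤N = ≤-by (+-nonneg (+-nonneg 0≤μ 0≤μ) (*-nonneg 0≤μ 0≤μ))
      (solve 1 (λ μ → μ :+ μ :+ μ :* μ := (:1 :+ μ) :* (:1 :+ μ) :- :1) refl μ)

    0<N : 0# < N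
    0<N = 0<-≤-trans 0<1 1≤N

    N*z≡1 : N * z ≡ 1#
    N*z≡1 = ⁻¹-inverseʳ N (0<⇒≢0 0<N)

    0≤z : 0# ≤ z
    0≤z = ⁻¹-nonneg (proj₁ 0<N) (0<⇒≢0 0<N)

    z≤1 : z ≤ 1#
    z≤1 = *-cancelˡ-≤ 0<N (subst₂ _≤_ (sym N*z≡1) (sym (*-identityʳ N)) 1≤N)

-- Expectations over random subsets

∪⁅⁆≡[]≔true : ∀ {n} (R : Subset n) u → R ∪ ⁅ u ⁆ ≡ R [ u ]≔ true
∪⁅⁆≡[]≔true (b ∷ R) zero    = cong₂ _∷_ (Bool.∨-zeroʳ b) (∪-identityʳ R)
∪⁅⁆≡[]≔true (b ∷ R) (suc u) = cong₂ _∷_ (Bool.∨-identityʳ b) (∪⁅⁆≡[]≔true R u)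

∪-mono : ∀ {n} {A A′ B B′ : Subset n} → A ⊆ A′ → B ⊆ B′ → A ∪ B ⊆ A′ ∪ B′
∪-mono {A = A} {B = B} p q x∈ = x∈p∪q⁺ ([ (λ a → inj₁ (p a)) , (λ b → inj₂ (q b)) ]′ (x∈p∪q⁻ A B x∈))

∩-monoˡ : ∀ {n} {A A′ : Subset n} B → A ⊆ A′ → A ∩ B ⊆ A′ ∩ B
∩-monoˡ {A = A} B p x∈ = let (a , b) = x∈p∩q⁻ A B x∈ in x∈p∩q⁺ (p a , b)

∉⇒lookup≡false : ∀ {n} {P : Subset n} {i} → i ∉ P → lookup P i ≡ false
∉⇒lookup≡false {P = true  ∷ P} {zero}  i∉ = contradiction here i∉
∉⇒lookup≡false {P = false ∷ P} {zero}  i∉ = refl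
∉⇒lookup≡false {P = _ ∷ P}     {suc i} i∉ = ∉⇒lookup≡false (i∉ ∘ there)

module Expectation (ℛ : CompleteOrderedField) where
  open CompleteOrderedField ℛ
  open ExpLog ℛ using (+-nonneg; 0≤1)
  open OrderedFieldProperties ℛ

  private variable n : ℕ

  -- The multilinear extension: 𝔼 x g is the expected value of g at the random
  -- set that contains each i independently with probability lookup x i.
  𝔼 : Vec ℝ n → (Subset n → ℝ) → ℝ
  𝔼 []       g = g []
  𝔼 (x ∷ xs) g = x * 𝔼 xs (λ R → g (true ∷ R)) + (1# - x) * 𝔼 xs (λ R → g (false ∷ R))

  infix 8 _▸_
  _▸_ : ℝ → Subset n → Vec ℝ n
  q ▸ Z = map (if_then q else 0#) Z

  IsProbability : ℝ → Set
  IsProbability q = 0# ≤ q × q ≤ 1#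

  Probabilities : Vec ℝ n → Set
  Probabilities x = ∀ i → IsProbability (lookup x i)

  0-probability : IsProbability 0#
  0-probability = ≤-refl , 0≤1

  ▸-probabilities : ∀ {q} → IsProbability q → (Z : Subset n) → Probabilities (q ▸ Z)
  ▸-probabilities pq (true  ∷ Z) zero    = pq
  ▸-probabilities pq (false ∷ Z) zero    = 0-probability
  ▸-probabilities pq (_ ∷ Z)     (suc i) = ▸-probabilities pq Z i

  replicate-probabilities : ∀ {q} → IsProbability q → Probabilities (replicate n q)
  replicate-probabilities pq zero    = pq
  replicate-probabilities pq (suc i) = replicate-probabilities pq i

  𝔼-cong : ∀ (x : Vec ℝ n) {g h} → (∀ R → g R ≡ h R) → 𝔼 x g ≡ 𝔼 x h
  𝔼-cong []       eq = eq []
  𝔼-cong (x ∷ xs) eq = cong₂ (λ a b → x * a + (1# - x) * b)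
    (𝔼-cong xs (λ R → eq (true ∷ R))) (𝔼-cong xs (λ R → eq (false ∷ R)))

  𝔼-mono : ∀ (x : Vec ℝ n) {g h} → Probabilities x → (∀ R → g R ≤ h R) → 𝔼 x g ≤ 𝔼 x h
  𝔼-mono []       px le = le []
  𝔼-mono (x ∷ xs) px le = +-mono-≤
    (*-monoˡ-≤ (proj₁ (px zero)) (𝔼-mono xs (λ i → px (suc i)) (λ R → le (true ∷ R))))
    (*-monoˡ-≤ (0≤y-x (proj₂ (px zero))) (𝔼-mono xs (λ i → px (suc i)) (λ R → le (false ∷ R))))

  𝔼-+ : ∀ (x : Vec ℝ n) g h → 𝔼 x (λ R → g R + h R) ≡ 𝔼 x g + 𝔼 x h
  𝔼-+ []       g h = refl
  𝔼-+ (x ∷ xs) g h = trans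
    (cong₂ (λ a b → x * a + (1# - x) * b) (𝔼-+ xs _ _) (𝔼-+ xs _ _))
    (solve 5 (λ x a b c d → x :* (a :+ b) :+ (:1 :- x) :* (c :+ d)
                := (x :* a :+ (:1 :- x) :* c) :+ (x :* b :+ (:1 :- x) :* d)) refl x _ _ _ _)

  𝔼-* : ∀ (x : Vec ℝ n) c g → 𝔼 x (λ R → c * g R) ≡ c * 𝔼 x g
  𝔼-* []       c g = refl
  𝔼-* (x ∷ xs) c g = trans
    (cong₂ (λ a b → x * a + (1# - x) * b) (𝔼-* xs c _) (𝔼-* xs c _))
    (solve 4 (λ x c a b → x :* (c :* a) :+ (:1 :- x) :* (c :* b)
                := c :* (x :* a :+ (:1 :- x) :* b)) refl x c _ _)

  𝔼-∸ : ∀ (x : Vec ℝ n) g h → 𝔼 x (λ R → g R - h R) ≡ 𝔼 x g - 𝔼 x h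
  𝔼-∸ []       g h = refl
  𝔼-∸ (x ∷ xs) g h = trans
    (cong₂ (λ a b → x * a + (1# - x) * b) (𝔼-∸ xs _ _) (𝔼-∸ xs _ _))
    (solve 5 (λ x a b c d → x :* (a :- b) :+ (:1 :- x) :* (c :- d)
                := (x :* a :+ (:1 :- x) :* c) :- (x :* b :+ (:1 :- x) :* d)) refl x _ _ _ _)

  𝔼-const : ∀ (x : Vec ℝ n) c → 𝔼 x (λ _ → c) ≡ c
  𝔼-const []       c = refl
  𝔼-const (x ∷ xs) c = trans
    (cong₂ (λ a b → x * a + (1# - x) * b) (𝔼-const xs c) (𝔼-const xs c))
    (solve 2 (λ x c → x :* c :+ (:1 :- x) :* c := c) refl x c)

  𝔼-0 : ∀ (xs : Vec ℝ n) g → 𝔼 (0# ∷ xs) g ≡ 𝔼 xs (λ R → g (false ∷ R))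
  𝔼-0 xs g = solve 2 (λ a b → :0 :* a :+ (:1 :- :0) :* b := b) refl _ _

  𝔼-1 : ∀ (xs : Vec ℝ n) g → 𝔼 (1# ∷ xs) g ≡ 𝔼 xs (λ R → g (true ∷ R))
  𝔼-1 xs g = solve 2 (λ a b → :1 :* a :+ (:1 :- :1) :* b := a) refl _ _

  𝔼-0▸ : ∀ (Z : Subset n) g → 𝔼 (0# ▸ Z) g ≡ g ⊥
  𝔼-0▸ []          g = refl
  𝔼-0▸ (true  ∷ Z) g = trans (𝔼-0 (0# ▸ Z) g) (𝔼-0▸ Z _)
  𝔼-0▸ (false ∷ Z) g = trans (𝔼-0 (0# ▸ Z) g) (𝔼-0▸ Z _)

  𝔼-1▸ : ∀ (Z : Subset n) g → 𝔼 (1# ▸ Z) g ≡ g Z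
  𝔼-1▸ []          g = refl
  𝔼-1▸ (true  ∷ Z) g = trans (𝔼-1 (1# ▸ Z) g) (𝔼-1▸ Z _)
  𝔼-1▸ (false ∷ Z) g = trans (𝔼-0 (1# ▸ Z) g) (𝔼-1▸ Z _)

  𝔼-▸⊥ : ∀ n q (g : Subset n → ℝ) → 𝔼 (q ▸ ⊥) g ≡ g ⊥
  𝔼-▸⊥ zero    q g = refl
  𝔼-▸⊥ (suc n) q g = trans (𝔼-0 (q ▸ ⊥) g) (𝔼-▸⊥ n q _)

  -- A coupling: one random R serves all Z, so samples of nested sets become nested outcome by
  -- outcome.
  𝔼-▸-∩ : ∀ q (Z : Subset n) g → 𝔼 (q ▸ Z) g ≡ 𝔼 (replicate n q) (λ R → g (Z ∩ R))
  𝔼-▸-∩ q []          g = refl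
  𝔼-▸-∩ q (true  ∷ Z) g = cong₂ (λ a b → q * a + (1# - q) * b) (𝔼-▸-∩ q Z _) (𝔼-▸-∩ q Z _)
  𝔼-▸-∩ q (false ∷ Z) g = trans (𝔼-0 (q ▸ Z) g) (trans (𝔼-▸-∩ q Z _)
    (solve 2 (λ q a → a := q :* a :+ (:1 :- q) :* a) refl q _))

  𝔼-++ : ∀ {m} (x : Vec ℝ m) (y : Vec ℝ n) g → 𝔼 (x ++ y) g ≡ 𝔼 x (λ P → 𝔼 y (λ Q → g (P ++ Q)))
  𝔼-++ []       y g = refl
  𝔼-++ (x ∷ xs) y g = cong₂ (λ a b → x * a + (1# - x) * b) (𝔼-++ xs y _) (𝔼-++ xs y _)

  -- Once membership of i is overwritten, its rate has no influence. With `𝔼-split` this exhibits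
  -- the expected value as an affine function of a single rate.
  𝔼-set : ∀ i (x : Vec ℝ n) c a (g : Subset n → ℝ) → 𝔼 (x [ i ]≔ c) (λ R → g (R [ i ]≔ a)) ≡ 𝔼 x (λ R → g (R [ i ]≔ a))
  𝔼-set zero    (x ∷ xs) c a g =
    solve 3 (λ x c b → c :* b :+ (:1 :- c) :* b := x :* b :+ (:1 :- x) :* b) refl x c _
  𝔼-set (suc i) (x ∷ xs) c a g = cong₂ (λ a b → x * a + (1# - x) * b) (𝔼-set i xs c a (λ R → g (true ∷ R))) (𝔼-set i xs c a (λ R → g (false ∷ R)))

  𝔼-split : ∀ i (x : Vec ℝ n) (g : Subset n → ℝ) → 𝔼 x g ≡
    lookup x i * 𝔼 x (λ R → g (R [ i ]≔ true)) + (1# - lookup x i) * 𝔼 x (λ R → g (R [ i ]≔ false))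
  𝔼-split zero    (x ∷ xs) g =
    solve 3 (λ x a b → x :* a :+ (:1 :- x) :* b
       := x :* (x :* a :+ (:1 :- x) :* a) :+ (:1 :- x) :* (x :* b :+ (:1 :- x) :* b))
      refl x _ _
  𝔼-split (suc i) (x ∷ xs) g = trans
    (cong₂ (λ a b → x * a + (1# - x) * b) (𝔼-split i xs _) (𝔼-split i xs _))
    (solve 6 (λ x y a b c d →
        x :* (y :* a :+ (:1 :- y) :* b) :+ (:1 :- x) :* (y :* c :+ (:1 :- y) :* d)
        := y :* (x :* a :+ (:1 :- x) :* c) :+ (:1 :- y) :* (x :* b :+ (:1 :- x) :* d))
      refl x (lookup xs i) _ _ _ _)

  -- Monotone submodular functions at random sets

  record SubmodularFunction (g : Subset n → ℝ) : Set where
    field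
      nonneg      : ∀ A → 0# ≤ g A
      mono        : ∀ {A B} → A ⊆ B → g A ≤ g B
      diminishing : ∀ {A B} S → A ⊆ B → g (B ∪ S) + g A ≤ g (A ∪ S) + g B

  monotone-section : ∀ {g : Subset (suc n) → ℝ} → (∀ {A B} → A ⊆ B → g A ≤ g B) → ∀ b {A B} → A ⊆ B → g (b ∷ A) ≤ g (b ∷ B)
  monotone-section mono b p = mono (s⊆s p)

  false∷≤true∷ : ∀ {g : Subset (suc n) → ℝ} → (∀ {A B} → A ⊆ B → g A ≤ g B) → ∀ R → g (false ∷ R) ≤ g (true ∷ R)
  false∷≤true∷ mono R = mono {false ∷ R} {true ∷ R} (out⊆ ⊆-refl)

  𝔼-mono-probability : ∀ (x y : Vec ℝ n) {g : Subset n → ℝ} → Probabilities x → Probabilities y →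
    (∀ i → lookup x i ≤ lookup y i) → (∀ {A B} → A ⊆ B → g A ≤ g B) → 𝔼 x g ≤ 𝔼 y g
  𝔼-mono-probability []       []       px py le mono = ≤-refl
  𝔼-mono-probability (x ∷ xs) (y ∷ ys) {g} px py le mono = ≤-by
    (+-nonneg
      (+-nonneg (*-nonneg (proj₁ (px zero)) (0≤y-x (recurse true)))
                (*-nonneg (0≤y-x (proj₂ (px zero))) (0≤y-x (recurse false))))
      (*-nonneg (0≤y-x (le zero)) (0≤y-x (𝔼-mono ys (λ i → py (suc i)) (false∷≤true∷ mono)))))
    (solve 6 (λ x y a b c d →
        (x :* (c :- a) :+ (:1 :- x) :* (d :- b)) :+ (y :- x) :* (c :- d)
        := y :* c :+ (:1 :- y) :* d :- (x :* a :+ (:1 :- x) :* b))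
      refl x y _ _ _ _)
    where
    recurse : ∀ b → 𝔼 xs (λ R → g (b ∷ R)) ≤ 𝔼 ys (λ R → g (b ∷ R))
    recurse b = 𝔼-mono-probability xs ys (λ i → px (suc i)) (λ i → py (suc i)) (λ i → le (suc i)) (monotone-section mono b)

  -- An element lies in the union of two independent samples with probability x + y - xy, at most x
  -- + y. In each coordinate the excess is xy times a monotone increment.
  𝔼-∪≤𝔼-+ : ∀ (x y : Vec ℝ n) {g : Subset n → ℝ} → Probabilities x → Probabilities y →
    Probabilities (zipWith _+_ x y) → (∀ {A B} → A ⊆ B → g A ≤ g B) →
    𝔼 x (λ P → 𝔼 y (λ Q → g (P ∪ Q))) ≤ 𝔼 (zipWith _+_ x y) g
  𝔼-∪≤𝔼-+ []       []       px py pz mono = ≤-refl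
  𝔼-∪≤𝔼-+ {n = suc n} (x ∷ xs) (y ∷ ys) {g} px py pz mono = subst (_≤ 𝔼 (zipWith _+_ (x ∷ xs) (y ∷ ys)) g) (sym lhs)
    (≤-by
      (+-nonneg
        (+-nonneg (*-nonneg (+-nonneg (proj₁ (px zero)) (proj₁ (py zero))) (0≤y-x (recurse true)))
                  (*-nonneg (0≤y-x (proj₂ (pz zero))) (0≤y-x (recurse false))))
        (*-nonneg (*-nonneg (proj₁ (px zero)) (proj₁ (py zero))) (0≤y-x
          (𝔼-mono xs (λ i → px (suc i)) (λ P → 𝔼-mono ys (λ i → py (suc i)) (λ Q → false∷≤true∷ mono (P ∪ Q)))))))
      (solve 6 (λ x y a b c d →
          (x :+ y) :* (c :- a) :+ (:1 :- (x :+ y)) :* (d :- b) :+ x :* y :* (a :- b)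
          := (x :+ y) :* c :+ (:1 :- (x :+ y)) :* d :-
             (x :* (y :* a :+ (:1 :- y) :* a) :+ (:1 :- x) :* (y :* a :+ (:1 :- y) :* b)))
        refl x y (𝔼𝔼 true) (𝔼𝔼 false) (𝔼 (zipWith _+_ xs ys) (λ R → g (true ∷ R))) (𝔼 (zipWith _+_ xs ys) (λ R → g (false ∷ R)))))
    where
    𝔼𝔼 : Bool → ℝ
    𝔼𝔼 b = 𝔼 xs (λ P → 𝔼 ys (λ Q → g (b ∷ (P ∪ Q))))
    recurse : ∀ b → 𝔼𝔼 b ≤ 𝔼 (zipWith _+_ xs ys) (λ R → g (b ∷ R))
    recurse b = 𝔼-∪≤𝔼-+ xs ys (λ i → px (suc i)) (λ i → py (suc i)) (λ i → pz (suc i)) (monotone-section mono b)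
    inner : ∀ (h k : Subset n → Subset n → ℝ) →
      𝔼 xs (λ P → y * 𝔼 ys (h P) + (1# - y) * 𝔼 ys (k P))
      ≡ y * 𝔼 xs (λ P → 𝔼 ys (h P)) + (1# - y) * 𝔼 xs (λ P → 𝔼 ys (k P))
    inner h k = trans (𝔼-+ xs _ _) (cong₂ _+_ (𝔼-* xs y _) (𝔼-* xs (1# - y) _))
    lhs : 𝔼 (x ∷ xs) (λ P → 𝔼 (y ∷ ys) (λ Q → g (P ∪ Q))) ≡
      x * (y * 𝔼𝔼 true + (1# - y) * 𝔼𝔼 true) + (1# - x) * (y * 𝔼𝔼 true + (1# - y) * 𝔼𝔼 false)
    lhs = cong₂ (λ a b → x * a + (1# - x) * b) (inner _ _) (inner _ _)

  ∑ : Subset n → (Fin n → ℝ) → ℝ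
  ∑ []          h = 0#
  ∑ (true  ∷ P) h = h zero + ∑ P (λ i → h (suc i))
  ∑ (false ∷ P) h = ∑ P (λ i → h (suc i))

  ∑-mono : ∀ (P : Subset n) {h k} → (∀ {i} → i ∈ P → h i ≤ k i) → ∑ P h ≤ ∑ P k
  ∑-mono []          le = ≤-refl
  ∑-mono (true  ∷ P) le = +-mono-≤ (le here) (∑-mono P (λ p → le (there p)))
  ∑-mono (false ∷ P) le = ∑-mono P (λ p → le (there p))

  ∑-cong : ∀ (P : Subset n) {h k} → (∀ {i} → i ∈ P → h i ≡ k i) → ∑ P h ≡ ∑ P k
  ∑-cong P eq = antisym (∑-mono P (λ p → ≤-reflexive (eq p))) (∑-mono P (λ p → ≤-reflexive (sym (eq p))))

  ∑-* : ∀ (P : Subset n) c h → ∑ P (λ i → c * h i) ≡ c * ∑ P h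
  ∑-* []          c h = sym (zeroʳ c)
  ∑-* (true  ∷ P) c h = trans (cong (c * h zero +_) (∑-* P c _)) (sym (distribˡ c _ _))
  ∑-* (false ∷ P) c h = ∑-* P c _

  ∑-nonneg : ∀ (P : Subset n) {h} → (∀ i → 0# ≤ h i) → 0# ≤ ∑ P h
  ∑-nonneg []          le = ≤-refl
  ∑-nonneg (true  ∷ P) le = +-nonneg (le zero) (∑-nonneg P (λ i → le (suc i)))
  ∑-nonneg (false ∷ P) le = ∑-nonneg P (λ i → le (suc i))

  ∑-set-true : ∀ (P : Subset n) i h → ∑ (P [ i ]≔ true) h ≡ h i + ∑ (P [ i ]≔ false) h
  ∑-set-true (_ ∷ P)     zero    h = refl
  ∑-set-true (true  ∷ P) (suc i) h = trans (cong (h zero +_) (∑-set-true P i _))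
    (solve 3 (λ a b c → a :+ (b :+ c) := b :+ (a :+ c)) refl (h zero) (h (suc i)) _)
  ∑-set-true (false ∷ P) (suc i) h = ∑-set-true P i _

  𝔼-∑ : ∀ {m} (x : Vec ℝ m) (P : Subset n) (h : Fin n → Subset m → ℝ) →
    𝔼 x (λ R → ∑ P (λ i → h i R)) ≡ ∑ P (λ i → 𝔼 x (h i))
  𝔼-∑ x []          h = 𝔼-const x 0#
  𝔼-∑ x (true  ∷ P) h = trans (𝔼-+ x _ _) (cong (𝔼 x (h zero) +_) (𝔼-∑ x P _))
  𝔼-∑ x (false ∷ P) h = 𝔼-∑ x P _

  module _ {g : Subset n → ℝ} (G : SubmodularFunction g) where
    open SubmodularFunction G

    private
      -- The induction fixes one coordinate at a time, so the claim is made for arbitrary sections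
      -- φ. Having put in the first element, the marginals of the others have only shrunk.
      union-bound-section : ∀ {m} (φ : Subset m → ℝ) →
        (∀ {A B} S → A ⊆ B → φ (B ∪ S) + φ A ≤ φ (A ∪ S) + φ B) →
        ∀ O → φ O - φ ⊥ ≤ ∑ O (λ o → φ ⁅ o ⁆ - φ ⊥)
      union-bound-section φ dim [] = ≤-reflexive (-‿inverseʳ (φ []))
      union-bound-section φ dim (false ∷ O) =
        union-bound-section (λ S → φ (false ∷ S)) (λ S p → dim (false ∷ S) (s⊆s p)) O
      union-bound-section φ dim (true ∷ O) = ≤-by
        (+-nonneg (0≤y-x (union-bound-section (λ S → φ (true ∷ S)) (λ S p → dim (false ∷ S) (s⊆s p)) O))
                  (0≤y-x (∑-mono O (λ {o} _ → ≤-by (0≤y-x (first o))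
                    (solve 4 (λ a b c d → (a :+ b) :- (c :+ d) := (a :- d) :- (c :- b)) refl
                      (φ (false ∷ ⁅ o ⁆)) (φ (true ∷ ⊥)) (φ (true ∷ ⁅ o ⁆)) (φ (false ∷ ⊥)))))))
        (solve 5 (λ a b c d e → (a :- (b :- c)) :+ (d :- a) := ((c :- e) :+ d) :- (b :- e)) refl
          (∑ O (λ o → φ (true ∷ ⁅ o ⁆) - φ (true ∷ ⊥))) (φ (true ∷ O)) (φ (true ∷ ⊥))
          (∑ O (λ o → φ (false ∷ ⁅ o ⁆) - φ (false ∷ ⊥))) (φ (false ∷ ⊥)))
        where
        first : ∀ o → φ (true ∷ ⁅ o ⁆) + φ (false ∷ ⊥) ≤ φ (false ∷ ⁅ o ⁆) + φ (true ∷ ⊥)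
        first o = subst₂ (λ A B → φ (true ∷ A) + φ (false ∷ ⊥) ≤ φ (false ∷ B) + φ (true ∷ ⊥))
          (∪-identityˡ ⁅ o ⁆) (∪-identityˡ ⁅ o ⁆) (dim {false ∷ ⊥} {true ∷ ⊥} (false ∷ ⁅ o ⁆) (out⊆ ⊆-refl))

    union-bound : ∀ R O → g (R ∪ O) - g R ≤ ∑ O (λ o → g (R ∪ ⁅ o ⁆) - g R)
    union-bound R O = subst (λ A → g (R ∪ O) - g A ≤ ∑ O (λ o → g (R ∪ ⁅ o ⁆) - g A)) (∪-identityʳ R)
      (union-bound-section (λ S → g (R ∪ S)) (λ {A} {B} S p →
        subst₂ (λ X Y → g X + g (R ∪ A) ≤ g Y + g (R ∪ B)) (∪-assoc R B S) (∪-assoc R A S)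
          (diminishing S (∪-mono ⊆-refl p))) O)

    -- Union with a random set, followed by averaging, keeps diminishing returns. A pass can
    -- therefore be analysed for one submodular function of B alone, into which the sampled C is
    -- absorbed.
    smoothed : ∀ {m} {x : Vec ℝ m} (φ : Subset m → Subset n) → Probabilities x →
      SubmodularFunction (λ Y → 𝔼 x (λ R → g (Y ∪ φ R)))
    smoothed {x = x} φ px = record
      { nonneg      = λ A → subst (_≤ 𝔼 x (λ R → g (A ∪ φ R))) (𝔼-const x 0#) (𝔼-mono x px (λ R → nonneg _))
      ; mono        = λ p → 𝔼-mono x px (λ R → mono (∪-mono p ⊆-refl))
      ; diminishing = λ {A} {B} S p → subst₂ _≤_ (𝔼-+ x _ _) (𝔼-+ x _ _) (𝔼-mono x px λ R →
          subst₂ (λ X Y → g X + g (A ∪ φ R) ≤ g Y + g (B ∪ φ R)) (swap B S (φ R)) (swap A S (φ R))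
            (diminishing S (∪-mono p ⊆-refl)))
      }
      where
      swap : ∀ B S R → (B ∪ R) ∪ S ≡ (B ∪ S) ∪ R
      swap B S R = trans (∪-assoc B R S) (trans (cong (B ∪_) (∪-comm R S)) (sym (∪-assoc B S R)))

  lookup-▸ : ∀ q (Z : Subset n) i → lookup (q ▸ Z) i ≡ (if lookup Z i then q else 0#)
  lookup-▸ q (b ∷ Z) zero    = refl
  lookup-▸ q (b ∷ Z) (suc i) = lookup-▸ q Z i

  lookup-▸-∈ : ∀ q {Z : Subset n} {i} → i ∈ Z → lookup (q ▸ Z) i ≡ q
  lookup-▸-∈ q {Z} {i} i∈ = trans (lookup-▸ q Z i) (cong (if_then q else 0#) ([]=⇒lookup i∈))

  lookup-▸-∉ : ∀ q {Z : Subset n} {i} → i ∉ Z → lookup (q ▸ Z) i ≡ 0#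
  lookup-▸-∉ q {Z} {i} i∉ = trans (lookup-▸ q Z i) (cong (if_then q else 0#) (∉⇒lookup≡false i∉))

  𝔼-▸-insert : ∀ q (g : Subset n → ℝ) {Z u} → u ∉ Z →
    𝔼 (q ▸ (Z ∪ ⁅ u ⁆)) g ≡ q * 𝔼 (q ▸ Z) (λ R → g (R ∪ ⁅ u ⁆)) + (1# - q) * 𝔼 (q ▸ Z) g
  𝔼-▸-insert q g {Z} {u} u∉Z = trans added (cong₂ (λ a b → q * a + (1# - q) * b)
    (𝔼-cong (q ▸ Z) (λ R → cong g (sym (∪⁅⁆≡[]≔true R u)))) (sym old))
    where
    x = q ▸ Z
    a = 𝔼 x (λ R → g (R [ u ]≔ true))
    b = 𝔼 x (λ R → g (R [ u ]≔ false))
    old : 𝔼 x g ≡ b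
    old = trans (𝔼-split u x g) (trans (cong (λ c → c * a + (1# - c) * b) (lookup-▸-∉ q u∉Z))
      (solve 2 (λ a b → :0 :* a :+ (:1 :- :0) :* b := b) refl a b))
    added : 𝔼 (q ▸ (Z ∪ ⁅ u ⁆)) g ≡ q * a + (1# - q) * b
    added = trans (cong (λ S → 𝔼 (q ▸ S) g) (∪⁅⁆≡[]≔true Z u)) (trans (cong (λ y → 𝔼 y g) (map-[]≔ (if_then q else 0#) Z u))
      (trans (𝔼-split u (x [ u ]≔ q) g)
        (trans (cong₂ (λ X Y → lookup (x [ u ]≔ q) u * X + (1# - lookup (x [ u ]≔ q) u) * Y)
            (𝔼-set u x q true g) (𝔼-set u x q false g))
          (cong (λ c → c * a + (1# - c) * b) (lookup∘updateAt u x)))))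

  𝔼-swap : ∀ {m} (x : Vec ℝ m) (y : Vec ℝ n) (g : Subset m → Subset n → ℝ) →
    𝔼 x (λ P → 𝔼 y (λ Q → g P Q)) ≡ 𝔼 y (λ Q → 𝔼 x (λ P → g P Q))
  𝔼-swap []       y g = refl
  𝔼-swap (x ∷ xs) y g = trans
    (cong₂ (λ a b → x * a + (1# - x) * b) (𝔼-swap xs y _) (𝔼-swap xs y _))
    (sym (trans (𝔼-+ y _ _) (cong₂ _+_ (𝔼-* y x _) (𝔼-* y (1# - x) _))))

  module Sampling {g : Subset n → ℝ} (G : SubmodularFunction g) (δ : ℝ) (pδ : IsProbability δ) where
    open SubmodularFunction G

    H : Subset n → ℝ
    H Z = 𝔼 (δ ▸ Z) g

    -- The increase of H when a further copy of u is added.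
    D : Fin n → Subset n → ℝ
    D u Z = δ * 𝔼 (δ ▸ Z) (λ R → g (R ∪ ⁅ u ⁆) - g R)

    H-add : ∀ {u Z} → u ∉ Z → H (Z ∪ ⁅ u ⁆) - H Z ≡ D u Z
    H-add {u} {Z} u∉Z = trans (cong (_- H Z) (𝔼-▸-insert δ g u∉Z))
      (trans (solve 3 (λ δ a b → (δ :* a :+ (:1 :- δ) :* b) :- b := δ :* (a :- b)) refl δ _ (H Z))
        (cong (δ *_) (sym (𝔼-∸ (δ ▸ Z) _ _))))

    -- Under the coupling of `𝔼-▸-∩` the sample of Z is contained in that of Z′, and diminishing
    -- returns apply to each outcome.
    D-antitone : ∀ u {Z Z′} → Z ⊆ Z′ → D u Z′ ≤ D u Z
    D-antitone u {Z} {Z′} p = *-monoˡ-≤ (proj₁ pδ) (subst₂ _≤_ (sym (𝔼-▸-∩ δ Z′ _)) (sym (𝔼-▸-∩ δ Z _))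
      (𝔼-mono (replicate n δ) (replicate-probabilities pδ) λ R →
        ≤-by (0≤y-x (diminishing ⁅ u ⁆ (∩-monoˡ R p)))
          (solve 4 (λ a b c d → (a :+ b) :- (c :+ d) := (a :- d) :- (c :- b)) refl _ _ _ _)))

    D-nonneg : ∀ u Z → 0# ≤ D u Z
    D-nonneg u Z = *-nonneg (proj₁ pδ) (subst (_≤ 𝔼 (δ ▸ Z) (λ R → g (R ∪ ⁅ u ⁆) - g R)) (𝔼-const (δ ▸ Z) 0#)
      (𝔼-mono (δ ▸ Z) (▸-probabilities pδ Z) (λ R → 0≤y-x (mono (p⊆p∪q ⁅ u ⁆)))))

    -- The union bound, averaged over the sample. An element of O that lies in Z is still absent
    -- from the sample with probability 1 - δ, so its marginal has to be counted; this is why D, and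
    -- not the increase of H, is summed.
    ∑D≥ : ∀ O Z → δ * (g O - H Z) ≤ ∑ O (λ o → D o Z)
    ∑D≥ O Z = subst (δ * (g O - H Z) ≤_)
      (trans (cong (δ *_) (𝔼-∑ (δ ▸ Z) O _)) (sym (∑-* O δ _)))
      (*-monoˡ-≤ (proj₁ pδ) (subst (_≤ 𝔼 (δ ▸ Z) (λ R → ∑ O (λ o → g (R ∪ ⁅ o ⁆) - g R)))
        (trans (𝔼-∸ (δ ▸ Z) _ _) (cong (_- H Z) (𝔼-const (δ ▸ Z) (g O))))
        (𝔼-mono (δ ▸ Z) (▸-probabilities pδ Z) λ R → ≤-trans
          (≤-by (0≤y-x (mono (q⊆p∪q R O))) (solve 3 (λ a b c → a :- b := (a :- c) :- (b :- c)) refl _ _ (g R)))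
          (union-bound G R O))))

-- Matroid exchange, and merging two independent sets

∈-[]≔false⁻ : ∀ {n} {P : Subset n} i {k} → k ∈ P [ i ]≔ false → k ∈ P × k ≢ i
∈-[]≔false⁻ {P = _ ∷ P} zero    (there k∈) = there k∈ , λ ()
∈-[]≔false⁻ {P = _ ∷ P} (suc i) here       = here , λ ()
∈-[]≔false⁻ {P = _ ∷ P} (suc i) (there k∈) =
  let (k∈P , k≢i) = ∈-[]≔false⁻ i k∈ in there k∈P , k≢i ∘ Fin.suc-injective

∈-[]≔false⁺ : ∀ {n} {P : Subset n} i {k} → k ∈ P → k ≢ i → k ∈ P [ i ]≔ false
∈-[]≔false⁺ zero    here       k≢i = contradiction refl k≢i
∈-[]≔false⁺ zero    (there k∈) k≢i = there k∈
∈-[]≔false⁺ (suc i) here       k≢i = here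
∈-[]≔false⁺ (suc i) (there k∈) k≢i = there (∈-[]≔false⁺ i k∈ (k≢i ∘ cong suc))

∈-[]≔true⁻ : ∀ {n} {P : Subset n} i {k} → k ∈ P [ i ]≔ true → k ∈ P ⊎ k ≡ i
∈-[]≔true⁻ {P = _ ∷ P} zero    here       = inj₂ refl
∈-[]≔true⁻ {P = _ ∷ P} zero    (there k∈) = inj₁ (there k∈)
∈-[]≔true⁻ {P = _ ∷ P} (suc i) here       = inj₁ here
∈-[]≔true⁻ {P = _ ∷ P} (suc i) (there k∈) =
  [ (λ k∈P → inj₁ (there k∈P)) , (λ eq → inj₂ (cong suc eq)) ]′ (∈-[]≔true⁻ i k∈)

∪⁅⁆-⊆ : ∀ {n} {A B : Subset n} {x} → A ⊆ B → x ∈ B → A ∪ ⁅ x ⁆ ⊆ B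
∪⁅⁆-⊆ {A = A} {B} {x} p x∈B k∈ = [ p , (λ k∈x → subst (_∈ B) (sym (x∈⁅y⁆⇒x≡y x k∈x)) x∈B) ]′ (x∈p∪q⁻ A ⁅ x ⁆ k∈)

∈-∪⁅⁆ : ∀ {n} (A : Subset n) x → x ∈ A ∪ ⁅ x ⁆
∈-∪⁅⁆ A x = q⊆p∪q A ⁅ x ⁆ (x∈⁅x⁆ x)

∣p∪⁅x⁆∣≤1+∣p∣ : ∀ {n} (P : Subset n) x → ∣ P ∪ ⁅ x ⁆ ∣ ℕ.≤ suc ∣ P ∣
∣p∪⁅x⁆∣≤1+∣p∣ (true  ∷ P) zero    = ℕ.s≤s (ℕ.m≤n⇒m≤1+n (ℕ.≤-reflexive (cong ∣_∣ (∪-identityʳ P))))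
∣p∪⁅x⁆∣≤1+∣p∣ (false ∷ P) zero    = ℕ.s≤s (ℕ.≤-reflexive (cong ∣_∣ (∪-identityʳ P)))
∣p∪⁅x⁆∣≤1+∣p∣ (true  ∷ P) (suc x) = ℕ.s≤s (∣p∪⁅x⁆∣≤1+∣p∣ P x)
∣p∪⁅x⁆∣≤1+∣p∣ (false ∷ P) (suc x) = ∣p∪⁅x⁆∣≤1+∣p∣ P x

∣p∣<∣p∪⁅x⁆∣ : ∀ {n} {P : Subset n} {x} → x ∉ P → ∣ P ∣ ℕ.< ∣ P ∪ ⁅ x ⁆ ∣
∣p∣<∣p∪⁅x⁆∣ {P = P} {x} x∉P = p⊂q⇒∣p∣<∣q∣ (p⊆p∪q ⁅ x ⁆ , x , ∈-∪⁅⁆ P x , x∉P)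

⊆∧∣≥∣⇒⊇ : ∀ {n} {A B : Subset n} → A ⊆ B → ∣ B ∣ ℕ.≤ ∣ A ∣ → B ⊆ A
⊆∧∣≥∣⇒⊇ {A = A} p le {x} x∈B with x ∈? A
... | yes x∈A = x∈A
... | no  x∉A = contradiction le (ℕ.<⇒≱ (p⊂q⇒∣p∣<∣q∣ (p , x , x∈B , x∉A)))

⊆-or-witness : ∀ {n} (A B : Subset n) → A ⊆ B ⊎ (∃[ x ] x ∈ A × x ∉ B)
⊆-or-witness A B with Fin.any? (λ x → (x ∈? A) ×-dec ¬? (x ∈? B))
... | yes w = inj₂ w
... | no ¬w = inj₁ λ {x} x∈A → decide x x∈A
  where
  decide : ∀ x → x ∈ A → x ∈ B
  decide x x∈A with x ∈? B
  ... | yes x∈B = x∈B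
  ... | no  x∉B = contradiction (x , x∈A , x∉B) ¬w

separate : ∀ {n} {P : Pred (Fin n) 0ℓ} → Decidable P → Subset n
separate P? = tabulate (λ i → does (P? i))

∈-separate⁺ : ∀ {n} {P : Pred (Fin n) 0ℓ} (P? : Decidable P) {i} → P i → i ∈ separate P?
∈-separate⁺ P? {i} p = lookup⇒[]= i _ (trans (lookup∘tabulate _ i) (dec-true (P? i) p))

∈-separate⁻ : ∀ {n} {P : Pred (Fin n) 0ℓ} (P? : Decidable P) {i} → i ∈ separate P? → P i
∈-separate⁻ P? {i} i∈ with P? i | trans (sym (lookup∘tabulate (λ i → does (P? i)) i)) ([]=⇒lookup i∈)
... | yes p | _ = p
... | no _  | ()

module MatroidProperties {n} (M : Matroid n) where
  open Matroid M renaming (independent? to Independent?)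

  -- Takes the place of extension to a base: the result keeps A, stays inside A ∪ B and is at least
  -- as large as B, which lets cardinalities replace a rank function.
  augment : ∀ {A B} → Independent A → Independent B →
    ∃[ C ] Independent C × A ⊆ C × C ⊆ A ∪ B × ∣ B ∣ ℕ.≤ ∣ C ∣
  augment {B = B} iA iB = go ∣ B ∣ iA (ℕ.m≤m+n _ _)
    where
    go : ∀ d {A} → Independent A → ∣ B ∣ ℕ.≤ d ℕ.+ ∣ A ∣ →
      ∃[ C ] Independent C × A ⊆ C × C ⊆ A ∪ B × ∣ B ∣ ℕ.≤ ∣ C ∣
    go d {A} iA le with ∣ B ∣ ℕ.≤? ∣ A ∣
    go d       {A} iA le | yes B≤A = A , iA , ⊆-refl , p⊆p∪q B , B≤A
    go zero    {A} iA le | no  B≰A = contradiction le B≰A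
    go (suc d) {A} iA le | no  B≰A =
      let (x , x∈B , x∉A , iAx) = exchange iA iB (ℕ.≰⇒> B≰A)
          (C , iC , Ax⊆C , C⊆ , B≤C) = go d iAx (ℕ.≤-trans le
            (ℕ.≤-trans (ℕ.≤-reflexive (sym (ℕ.+-suc d ∣ A ∣))) (ℕ.+-monoʳ-≤ d (∣p∣<∣p∪⁅x⁆∣ x∉A))))
      in C , iC , ⊆-trans (p⊆p∪q ⁅ x ⁆) Ax⊆C
         , (λ k∈ → [ ∪⁅⁆-⊆ (p⊆p∪q B) (q⊆p∪q A B x∈B) , q⊆p∪q A B ]′ (x∈p∪q⁻ (A ∪ ⁅ x ⁆) B (C⊆ k∈)))
         , B≤C

  -- Let J consist of the elements of B that i can replace; J with i is dependent. If no element of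
  -- J extended C without i, then C without i would span J and hence i, against the independence of
  -- C.
  symmetric-exchange : ∀ {C B i} → Independent C → Independent B → i ∈ C → i ∉ B → ¬ Independent (B ∪ ⁅ i ⁆) →
    ∃[ j ] j ∈ B × j ∉ C × Independent ((C ∖ i) ∪ ⁅ j ⁆) × Independent ((B ∖ j) ∪ ⁅ i ⁆)
  symmetric-exchange {C} {B} {i} iC iB i∈C i∉B ¬iBi = result
    where
    K = C ∖ i
    exchangeable? : Decidable (λ j → j ∈ B × Independent ((B ∖ j) ∪ ⁅ i ⁆))
    exchangeable? j = (j ∈? B) ×-dec Independent? _
    J = separate exchangeable?
    J⊆B : J ⊆ B
    J⊆B j∈J = proj₁ (∈-separate⁻ exchangeable? j∈J)
    iJ : Independent J
    iJ = hereditary J⊆B iB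
    iK : Independent K
    iK = hereditary (p─q⊆p C ⁅ i ⁆) iC

    -- J ∪ {i} is the fundamental circuit of i with respect to B.
    ¬iJi : ¬ Independent (J ∪ ⁅ i ⁆)
    ¬iJi iJi with augment iJi iB
    ... | (N , iN , Ji⊆N , N⊆ , B≤N) with ⊆-or-witness B N
    ...   | inj₁ B⊆N = ¬iBi (hereditary (∪⁅⁆-⊆ B⊆N (Ji⊆N (∈-∪⁅⁆ J i))) iN)
    ...   | inj₂ (j , j∈B , j∉N) = j∉N (Ji⊆N (p⊆p∪q ⁅ i ⁆ (∈-separate⁺ exchangeable? (j∈B , hereditary ⊇N iN))))
      where
      N⊆Bji : N ⊆ (B ∖ j) ∪ ⁅ i ⁆
      N⊆Bji {k} k∈N with x∈p∪q⁻ (J ∪ ⁅ i ⁆) B (N⊆ k∈N)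
      ... | inj₂ k∈B = p⊆p∪q ⁅ i ⁆ (x∈p∧x≢y⇒x∈p-y k∈B λ { refl → j∉N k∈N })
      ... | inj₁ k∈Ji with x∈p∪q⁻ J ⁅ i ⁆ k∈Ji
      ...   | inj₁ k∈J = p⊆p∪q ⁅ i ⁆ (x∈p∧x≢y⇒x∈p-y (J⊆B k∈J) λ { refl → j∉N k∈N })
      ...   | inj₂ k∈i = q⊆p∪q (B ∖ j) ⁅ i ⁆ k∈i
      ⊇N : (B ∖ j) ∪ ⁅ i ⁆ ⊆ N
      ⊇N = ⊆∧∣≥∣⇒⊇ N⊆Bji (ℕ.≤-trans (∣p∪⁅x⁆∣≤1+∣p∣ (B ∖ j) i)
        (ℕ.≤-trans (x∈p⇒∣p-x∣<∣p∣ j∈B) B≤N))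

    witness : ∀ {x} → x ∈ J → x ∉ K → Independent (K ∪ ⁅ x ⁆) →
      ∃[ j ] j ∈ B × j ∉ C × Independent (K ∪ ⁅ j ⁆) × Independent ((B ∖ j) ∪ ⁅ i ⁆)
    witness {x} x∈J x∉K iKx = let (x∈B , iBx) = ∈-separate⁻ exchangeable? x∈J in
      x , x∈B , (λ x∈C → x∉K (x∈p∧x≢y⇒x∈p-y x∈C λ { refl → i∉B x∈B })) , iKx , iBx

    result : ∃[ j ] j ∈ B × j ∉ C × Independent (K ∪ ⁅ j ⁆) × Independent ((B ∖ j) ∪ ⁅ i ⁆)
    -- If N is larger than K, an exchange already yields an element of J. Otherwise C is larger than
    -- N, so some x of C extends N; x = i would make J with i independent, and any other x lies in K
    -- and makes N ∪ ⁅ x ⁆ larger than K.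
    result with augment iJ iK
    ... | (N , iN , J⊆N , N⊆ , K≤N) with ∣ N ∣ ℕ.≤? ∣ K ∣
    ...   | no N≰K =
      let (x , x∈N , x∉K , iKx) = exchange iK iN (ℕ.≰⇒> N≰K)
      in witness ([ (λ x∈J → x∈J) , (λ x∈K → contradiction x∈K x∉K) ]′ (x∈p∪q⁻ J K (N⊆ x∈N))) x∉K iKx
    ...   | yes N≤K with exchange iN iC (ℕ.≤-<-trans N≤K (x∈p⇒∣p-x∣<∣p∣ i∈C))
    ...     | (x , x∈C , x∉N , iNx) with x Fin.≟ i
    ...       | yes refl = contradiction (hereditary (∪⁅⁆-⊆ (⊆-trans J⊆N (p⊆p∪q ⁅ i ⁆)) (∈-∪⁅⁆ N i)) iNx) ¬iJi
    ...       | no  x≢i with exchange iK iNx (ℕ.≤-<-trans K≤N (∣p∣<∣p∪⁅x⁆∣ x∉N))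
    ...         | (y , y∈Nx , y∉K , iKy) = witness y∈J y∉K iKy
      where
      y∈J : y ∈ J
      y∈J with x∈p∪q⁻ N ⁅ x ⁆ y∈Nx
      ... | inj₂ y∈x = contradiction (subst (_∈ K) (sym (x∈⁅y⁆⇒x≡y x y∈x)) (x∈p∧x≢y⇒x∈p-y x∈C x≢i)) y∉K
      ... | inj₁ y∈N = [ (λ y∈J → y∈J) , (λ y∈K → contradiction y∈K y∉K) ]′ (x∈p∪q⁻ J K (N⊆ y∈N))

-- Rounding a mixture of two independent sets to one

module Merging (ℛ : CompleteOrderedField) {n} (M : Matroid n) where
  open CompleteOrderedField ℛ
  open ExpLog ℛ using (+-nonneg; +-monoˡ-≤)
  open OrderedFieldProperties ℛ
  open Expectation ℛ
  open Matroid M renaming (independent? to Independent?)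
  open MatroidProperties M

  zipWith-[]≔ˡ : ∀ {m} (x y : Vec ℝ m) i c → zipWith _+_ (x [ i ]≔ c) y ≡ zipWith _+_ x y [ i ]≔ (c + lookup y i)
  zipWith-[]≔ˡ (x ∷ xs) (y ∷ ys) zero    c = refl
  zipWith-[]≔ˡ (x ∷ xs) (y ∷ ys) (suc i) c = cong (_ ∷_) (zipWith-[]≔ˡ xs ys i c)

  zipWith-[]≔ʳ : ∀ {m} (x y : Vec ℝ m) i c → zipWith _+_ x (y [ i ]≔ c) ≡ zipWith _+_ x y [ i ]≔ (lookup x i + c)
  zipWith-[]≔ʳ (x ∷ xs) (y ∷ ys) zero    c = refl
  zipWith-[]≔ʳ (x ∷ xs) (y ∷ ys) (suc i) c = cong (_ ∷_) (zipWith-[]≔ʳ xs ys i c)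

  lookup-zipWith-+ : ∀ {m} (x y : Vec ℝ m) i → lookup (zipWith _+_ x y) i ≡ lookup x i + lookup y i
  lookup-zipWith-+ (x ∷ xs) (y ∷ ys) zero    = refl
  lookup-zipWith-+ (x ∷ xs) (y ∷ ys) (suc i) = lookup-zipWith-+ xs ys i

  module _ {f : Subset n → ℝ} (F : SubmodularFunction f)
    {p q : ℝ} (0≤p : 0# ≤ p) (0≤q : 0# ≤ q) (p+q≤1 : p + q ≤ 1#) where
    open SubmodularFunction F

    mixture : Subset n → Subset n → Vec ℝ n
    mixture C B = zipWith _+_ (p ▸ C) (q ▸ B)

    private
      p≤p+q : p ≤ p + q
      p≤p+q = subst (_≤ p + q) (+-identityʳ p) (+-monoʳ-≤ p 0≤q)

      q≤p+q : q ≤ p + q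
      q≤p+q = subst (_≤ p + q) (+-identityˡ q) (+-monoˡ-≤ q 0≤p)

      p-probability : IsProbability p
      p-probability = 0≤p , ≤-trans p≤p+q p+q≤1

      q-probability : IsProbability q
      q-probability = 0≤q , ≤-trans q≤p+q p+q≤1

      p+q-probability : IsProbability (p + q)
      p+q-probability = +-nonneg 0≤p 0≤q , p+q≤1

    mixture-probabilities : ∀ C B → Probabilities (mixture C B)
    mixture-probabilities C B i = subst IsProbability (sym (lookup-zipWith-+ (p ▸ C) (q ▸ B) i))
      ( +-nonneg (proj₁ (▸-probabilities p-probability C i)) (proj₁ (▸-probabilities q-probability B i))
      , ≤-trans (+-mono-≤ (at-most 0≤p C i) (at-most 0≤q B i)) p+q≤1 )
      where
      at-most : ∀ {m r} → 0# ≤ r → (Z : Subset m) → ∀ i → lookup (r ▸ Z) i ≤ r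
      at-most 0≤r (true  ∷ Z) zero    = ≤-refl
      at-most 0≤r (false ∷ Z) zero    = 0≤r
      at-most 0≤r (_ ∷ Z)     (suc i) = at-most 0≤r Z i

    ▸-mono : ∀ {m} {r} {Z Z′ : Subset m} → 0# ≤ r → Z ⊆ Z′ → ∀ i → lookup (r ▸ Z) i ≤ lookup (r ▸ Z′) i
    ▸-mono {r = r} {Z} {Z′} 0≤r Z⊆Z′ i with i ∈? Z
    ... | yes i∈Z = ≤-reflexive (trans (lookup-▸-∈ r i∈Z) (sym (lookup-▸-∈ r (Z⊆Z′ i∈Z))))
    ... | no  i∉Z with i ∈? Z′
    ...   | yes i∈Z′ = subst₂ _≤_ (sym (lookup-▸-∉ r i∉Z)) (sym (lookup-▸-∈ r i∈Z′)) 0≤r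
    ...   | no  i∉Z′ = ≤-reflexive (trans (lookup-▸-∉ r i∉Z) (sym (lookup-▸-∉ r i∉Z′)))

    𝔼-mixture-monoʳ : ∀ C {B B′} → B ⊆ B′ → 𝔼 (mixture C B) f ≤ 𝔼 (mixture C B′) f
    𝔼-mixture-monoʳ C {B} {B′} B⊆B′ = 𝔼-mono-probability (mixture C B) (mixture C B′) (mixture-probabilities C B) (mixture-probabilities C B′)
      (λ i → subst₂ _≤_ (sym (lookup-zipWith-+ (p ▸ C) (q ▸ B) i)) (sym (lookup-zipWith-+ (p ▸ C) (q ▸ B′) i))
        (+-monoʳ-≤ _ (▸-mono 0≤q B⊆B′ i))) mono

    𝔼-mixture-⊆ : ∀ {C B} → C ⊆ B → 𝔼 (mixture C B) f ≤ 𝔼 ((p + q) ▸ B) f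
    𝔼-mixture-⊆ {C} {B} C⊆B = 𝔼-mono-probability (mixture C B) ((p + q) ▸ B) (mixture-probabilities C B) (▸-probabilities p+q-probability B)
      (λ i → ≤-trans (≤-reflexive (lookup-zipWith-+ (p ▸ C) (q ▸ B) i))
        (≤-trans (+-monoˡ-≤ _ (▸-mono 0≤p C⊆B i)) (≤-reflexive (added B i)))) mono
      where
      added : ∀ {m} (Z : Subset m) i → lookup (p ▸ Z) i + lookup (q ▸ Z) i ≡ lookup ((p + q) ▸ Z) i
      added (true  ∷ Z) zero    = refl
      added (false ∷ Z) zero    = +-identityʳ 0#
      added (_ ∷ Z)     (suc i) = added Z i

    module _ {i j : Fin n} (i≢j : i ≢ j) (X : Vec ℝ n) where
      private
        G : Bool → Bool → ℝ
        G a b = 𝔼 X (λ R → f ((R [ i ]≔ a) [ j ]≔ b))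

      -- With all other coordinates averaged out, the expected value is bilinear in the rates of i
      -- and j.
      𝔼-two-coordinates : ∀ c d → 𝔼 ((X [ i ]≔ c) [ j ]≔ d) f ≡
        d * (c * G true true + (1# - c) * G false true) + (1# - d) * (c * G true false + (1# - c) * G false false)
      𝔼-two-coordinates c d = trans (𝔼-split j Y f)
        (cong₂ _+_ (cong₂ _*_ (lookup∘updateAt j (X [ i ]≔ c)) (inner true))
                   (cong₂ _*_ (cong (λ r → 1# - r) (lookup∘updateAt j (X [ i ]≔ c))) (inner false)))
        where
        Y = (X [ i ]≔ c) [ j ]≔ d
        inner : ∀ b → 𝔼 Y (λ R → f (R [ j ]≔ b)) ≡ c * G true b + (1# - c) * G false b
        inner b = trans (𝔼-set j (X [ i ]≔ c) d b f)
          (trans (𝔼-split i (X [ i ]≔ c) (λ R → f (R [ j ]≔ b)))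
            (cong₂ _+_ (cong₂ _*_ (lookup∘updateAt i X) (𝔼-set i X c true (λ R → f (R [ j ]≔ b))))
                       (cong₂ _*_ (cong (λ r → 1# - r) (lookup∘updateAt i X)) (𝔼-set i X c false (λ R → f (R [ j ]≔ b))))))

      -- The coefficient of the product of the two rates is thus at most 0, which makes shifting
      -- mass between i and j a convex motion.
      G-submodular : Probabilities X → G true true + G false false ≤ G true false + G false true
      G-submodular pX = subst₂ _≤_ (𝔼-+ X _ _) (𝔼-+ X _ _) (𝔼-mono X pX λ R →
        ≤-trans (≤-reflexive (cong₂ (λ A B → f A + f B) (union R true) refl))
          (≤-trans (diminishing {R′ R false} {R′ R true} ⁅ j ⁆ (below R))
            (≤-reflexive (trans (cong (λ A → f A + f (R′ R true)) (sym (union R false))) (+-comm _ _)))))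
        where
        R′ : Subset n → Bool → Subset n
        R′ R a = (R [ i ]≔ a) [ j ]≔ false
        union : ∀ R a → (R [ i ]≔ a) [ j ]≔ true ≡ R′ R a ∪ ⁅ j ⁆
        union R a = trans (sym (updateTwice (R [ i ]≔ a) j)) (sym (∪⁅⁆≡[]≔true (R′ R a) j))
          where
          updateTwice : ∀ {m} (P : Subset m) j → (P [ j ]≔ false) [ j ]≔ true ≡ P [ j ]≔ true
          updateTwice (_ ∷ P) zero    = refl
          updateTwice (b ∷ P) (suc j) = cong (b ∷_) (updateTwice P j)
        below : ∀ R → R′ R false ⊆ R′ R true
        below R {k} k∈ = let (k∈R , k≢j) = ∈-[]≔false⁻ j k∈ ; (k∈R′ , k≢i) = ∈-[]≔false⁻ i k∈R in
          ∈-[]≔false⁺ j (lookup⇒[]= k _ (trans (lookup∘updateAt′ k i k≢i R) ([]=⇒lookup k∈R′))) k≢j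

      -- For fixed i + j marginal mass the bilinear form with negative mixed term
      -- is largest at an end point.
      swap-improves : Probabilities X → 𝔼 ((X [ i ]≔ p) [ j ]≔ q) f ≤ 𝔼 ((X [ i ]≔ 0#) [ j ]≔ (p + q)) f
                                      ⊎ 𝔼 ((X [ i ]≔ p) [ j ]≔ q) f ≤ 𝔼 ((X [ i ]≔ (p + q)) [ j ]≔ 0#) f
      swap-improves pX with total (G true false) (G false true)
      ... | inj₁ le = inj₁ (subst₂ _≤_ (sym (𝔼-two-coordinates p q)) (sym (𝔼-two-coordinates 0# (p + q)))
        (≤-by (+-nonneg (*-nonneg 0≤p (0≤y-x le)) (*-nonneg (*-nonneg 0≤p 0≤q) (0≤y-x (G-submodular pX))))
          (solve 6 (λ p q a b c d →
              p :* (c :- b) :+ p :* q :* ((b :+ c) :- (a :+ d))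
              := (p :+ q) :* (:0 :* a :+ (:1 :- :0) :* c) :+
                   (:1 :- (p :+ q)) :* (:0 :* b :+ (:1 :- :0) :* d)
                 :- (q :* (p :* a :+ (:1 :- p) :* c) :+ (:1 :- q) :* (p :* b :+ (:1 :- p) :* d)))
            refl p q (G true true) (G true false) (G false true) (G false false))))
      ... | inj₂ le = inj₂ (subst₂ _≤_ (sym (𝔼-two-coordinates p q)) (sym (𝔼-two-coordinates (p + q) 0#))
        (≤-by (+-nonneg (*-nonneg 0≤q (0≤y-x le)) (*-nonneg (*-nonneg 0≤p 0≤q) (0≤y-x (G-submodular pX))))
          (solve 6 (λ p q a b c d →
              q :* (b :- c) :+ p :* q :* ((b :+ c) :- (a :+ d))
              := :0 :* ((p :+ q) :* a :+ (:1 :- (p :+ q)) :* c) :+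
                   (:1 :- :0) :* ((p :+ q) :* b :+ (:1 :- (p :+ q)) :* d)
                 :- (q :* (p :* a :+ (:1 :- p) :* c) :+ (:1 :- q) :* (p :* b :+ (:1 :- p) :* d)))
            refl p q (G true true) (G true false) (G false true) (G false false))))

    -- Both ends of the shift are mixtures again: all mass p + q on j means exchanging i for j in C,
    -- all of it on i means exchanging j for i in B. These are the two sets that symmetric exchange
    -- keeps independent.
    swap-mixture : ∀ {C B i j} → i ∈ C → i ∉ B → j ∈ B → j ∉ C →
        𝔼 (mixture C B) f ≤ 𝔼 (mixture ((C [ i ]≔ false) [ j ]≔ true) B) f
      ⊎ 𝔼 (mixture C B) f ≤ 𝔼 (mixture C ((B [ j ]≔ false) [ i ]≔ true)) f
    swap-mixture {C} {B} {i} {j} i∈C i∉B j∈B j∉C = subst₂ (λ x y → 𝔼 (mixture C B) f ≤ 𝔼 x f ⊎ 𝔼 (mixture C B) f ≤ 𝔼 y f)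
      (sym first) (sym second) (subst (λ x → 𝔼 x f ≤ 𝔼 ((X [ i ]≔ 0#) [ j ]≔ (p + q)) f ⊎ 𝔼 x f ≤ 𝔼 ((X [ i ]≔ (p + q)) [ j ]≔ 0#) f) same
        (swap-improves i≢j X (mixture-probabilities C B)))
      where
      X = mixture C B
      i≢j : i ≢ j
      i≢j refl = j∉C i∈C
      same : (X [ i ]≔ p) [ j ]≔ q ≡ X
      same = trans (cong₂ (λ a b → (X [ i ]≔ a) [ j ]≔ b) (sym Xi) (sym Xj))
        (trans (cong (_[ j ]≔ lookup X j) ([]≔-lookup X i)) ([]≔-lookup X j))
        where
        Xi : lookup X i ≡ p
        Xi = trans (lookup-zipWith-+ (p ▸ C) (q ▸ B) i)
          (trans (cong₂ _+_ (lookup-▸-∈ p i∈C) (lookup-▸-∉ q i∉B)) (+-identityʳ p))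
        Xj : lookup X j ≡ q
        Xj = trans (lookup-zipWith-+ (p ▸ C) (q ▸ B) j)
          (trans (cong₂ _+_ (lookup-▸-∉ p j∉C) (lookup-▸-∈ q j∈B)) (+-identityˡ q))
      first : mixture ((C [ i ]≔ false) [ j ]≔ true) B ≡ (X [ i ]≔ 0#) [ j ]≔ (p + q)
      first = trans (cong (λ x → zipWith _+_ x (q ▸ B)) (trans (map-[]≔ _ (C [ i ]≔ false) j) (cong (_[ j ]≔ p) (map-[]≔ _ C i))))
        (trans (zipWith-[]≔ˡ _ (q ▸ B) j p) (cong₂ (λ x c → x [ j ]≔ (p + c))
          (trans (zipWith-[]≔ˡ (p ▸ C) (q ▸ B) i 0#)
            (cong (X [ i ]≔_) (trans (cong (0# +_) (lookup-▸-∉ q i∉B)) (+-identityʳ 0#))))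
          (lookup-▸-∈ q j∈B)))
      second : mixture C ((B [ j ]≔ false) [ i ]≔ true) ≡ (X [ i ]≔ (p + q)) [ j ]≔ 0#
      second = trans (cong (zipWith _+_ (p ▸ C)) (trans (map-[]≔ _ (B [ j ]≔ false) i) (cong (_[ i ]≔ q) (map-[]≔ _ B j))))
        (trans (zipWith-[]≔ʳ (p ▸ C) _ i q)
          (trans (cong₂ (λ x c → x [ i ]≔ (c + q))
            (trans (zipWith-[]≔ʳ (p ▸ C) (q ▸ B) j 0#)
              (cong (X [ j ]≔_) (trans (cong (_+ 0#) (lookup-▸-∉ p j∉C)) (+-identityʳ 0#))))
            (lookup-▸-∈ p i∈C))
          ([]≔-commutes X j i (i≢j ∘ sym))))

    -- A deterministic form of swap rounding. Every step takes an element out of C minus B without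
    -- lowering the expected value; once C ⊆ B the rates add up on B. The inclusion of E in C ∪ B
    -- guarantees that E can be assembled from stored cells.
    merge-mixture : ∀ {C B} → Independent C → Independent B →
      ∃[ E ] Independent E × E ⊆ C ∪ B × 𝔼 (mixture C B) f ≤ 𝔼 ((p + q) ▸ E) f
    merge-mixture {C} {B} iC iB = go (suc ∣ C ∩ ∁ B ∣) iC iB (ℕ.n<1+n _)
      where
      replaced : ∀ {A : Subset n} {i j} → Independent ((A ∖ i) ∪ ⁅ j ⁆) → Independent ((A [ i ]≔ false) [ j ]≔ true)
      replaced {A} {i} {j} = hereditary λ {k} k∈ → [ (λ k∈A → let (k∈A , k≢i) = ∈-[]≔false⁻ i k∈A in
          p⊆p∪q ⁅ j ⁆ (x∈p∧x≢y⇒x∈p-y k∈A k≢i)) , (λ { refl → ∈-∪⁅⁆ (A ∖ i) j }) ]′ (∈-[]≔true⁻ j k∈)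
      smaller : ∀ {A B : Subset n} {x} → A ⊆ B → x ∈ B → x ∉ A → ∀ {d} → ∣ B ∣ ℕ.≤ d → ∣ A ∣ ℕ.< d
      smaller A⊆B x∈B x∉A = ℕ.≤-trans (p⊂q⇒∣p∣<∣q∣ (A⊆B , _ , x∈B , x∉A))
      within : ∀ {E C′ B′ D : Subset n} → C′ ⊆ D → B′ ⊆ D → E ⊆ C′ ∪ B′ → E ⊆ D
      within {C′ = C′} {B′} p q r k∈ = [ p , q ]′ (x∈p∪q⁻ C′ B′ (r k∈))
      go : ∀ d {C B} → Independent C → Independent B → ∣ C ∩ ∁ B ∣ ℕ.< d →
        ∃[ E ] Independent E × E ⊆ C ∪ B × 𝔼 (mixture C B) f ≤ 𝔼 ((p + q) ▸ E) f
      go (suc d) {C} {B} iC iB (ℕ.s≤s le) with ⊆-or-witness C B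
      ... | inj₁ C⊆B = B , iB , q⊆p∪q C B , 𝔼-mixture-⊆ C⊆B
      ... | inj₂ (i , i∈C , i∉B) with Independent? (B ∪ ⁅ i ⁆)
      ...   | yes iBi =
        let (E , iE , E⊆ , better) = go d iC iBi
              (smaller (λ {k} k∈ → let (a , b) = x∈p∩q⁻ C (∁ (B ∪ ⁅ i ⁆)) k∈ in
                         x∈p∩q⁺ (a , x∉p⇒x∈∁p (x∈∁p⇒x∉p b ∘ p⊆p∪q ⁅ i ⁆)))
                       (x∈p∩q⁺ (i∈C , x∉p⇒x∈∁p i∉B))
                       (λ i∈ → x∈∁p⇒x∉p (proj₂ (x∈p∩q⁻ C _ i∈)) (∈-∪⁅⁆ B i)) le)
        in E , iE , within (p⊆p∪q B) (∪⁅⁆-⊆ (q⊆p∪q C B) (p⊆p∪q B i∈C)) E⊆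
           , ≤-trans (𝔼-mixture-monoʳ C (p⊆p∪q ⁅ i ⁆)) better
      ...   | no ¬iBi with symmetric-exchange iC iB i∈C i∉B ¬iBi
      ...     | (j , j∈B , j∉C , iC′ , iB′) with swap-mixture i∈C i∉B j∈B j∉C
      ...       | inj₁ better₁ =
        let C′ = (C [ i ]≔ false) [ j ]≔ true
            split : ∀ {k} → k ∈ C′ → (k ∈ C × k ≢ i) ⊎ k ≡ j
            split k∈ = [ (λ k∈A → inj₁ (∈-[]≔false⁻ i k∈A)) , inj₂ ]′ (∈-[]≔true⁻ j k∈)
            (E , iE , E⊆ , better) = go d (replaced iC′) iB
              (smaller (λ {k} k∈ → let (a , b) = x∈p∩q⁻ C′ (∁ B) k∈ in
                         [ (λ (k∈C , _) → x∈p∩q⁺ (k∈C , b)) , (λ { refl → contradiction j∈B (x∈∁p⇒x∉p b) }) ]′ (split a))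
                       (x∈p∩q⁺ (i∈C , x∉p⇒x∈∁p i∉B))
                       (λ i∈ → [ (λ (_ , i≢i) → i≢i refl) , (λ { refl → i∉B j∈B }) ]′ (split (proj₁ (x∈p∩q⁻ C′ (∁ B) i∈)))) le)
        in E , iE , within (λ k∈ → [ (λ (k∈C , _) → p⊆p∪q B k∈C) , (λ { refl → q⊆p∪q C B j∈B }) ]′ (split k∈)) (q⊆p∪q C B) E⊆
           , ≤-trans better₁ better
      ...       | inj₂ better₂ =
        let B′ = (B [ j ]≔ false) [ i ]≔ true
            split : ∀ {k} → k ∈ B′ → (k ∈ B × k ≢ j) ⊎ k ≡ i
            split k∈ = [ (λ k∈A → inj₁ (∈-[]≔false⁻ j k∈A)) , inj₂ ]′ (∈-[]≔true⁻ i k∈)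
            i∈B′ : i ∈ B′
            i∈B′ = lookup⇒[]= i _ (lookup∘updateAt i (B [ j ]≔ false))
            keep : ∀ {k} → k ∈ B → k ≢ j → k ≢ i → k ∈ B′
            keep {k} k∈B k≢j k≢i = lookup⇒[]= k _ (trans (lookup∘updateAt′ k i k≢i (B [ j ]≔ false)) ([]=⇒lookup (∈-[]≔false⁺ j k∈B k≢j)))
            (E , iE , E⊆ , better) = go d iC (replaced iB′)
              (smaller (λ {k} k∈ → let (a , b) = x∈p∩q⁻ C (∁ B′) k∈ in
                         x∈p∩q⁺ (a , x∉p⇒x∈∁p λ k∈B → x∈∁p⇒x∉p b (keep k∈B (λ { refl → j∉C a }) (λ { refl → i∉B k∈B }))))
                       (x∈p∩q⁺ (i∈C , x∉p⇒x∈∁p i∉B))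
                       (λ i∈ → x∈∁p⇒x∉p (proj₂ (x∈p∩q⁻ C (∁ B′) i∈)) i∈B′) le)
        in E , iE , within (p⊆p∪q B) (λ k∈ → [ (λ (k∈B , _) → q⊆p∪q C B k∈B) , (λ { refl → p⊆p∪q B i∈C }) ]′ (split k∈)) E⊆
           , ≤-trans better₂ better

    merge : ∀ {C B} → Independent C → Independent B → ∃[ E ] Independent E × E ⊆ C ∪ B ×
      𝔼 (p ▸ C) (λ P → 𝔼 (q ▸ B) (λ Q → f (P ∪ Q))) ≤ 𝔼 ((p + q) ▸ E) f
    merge {C} {B} iC iB = let (E , iE , E⊆ , le) = merge-mixture iC iB in
      E , iE , E⊆ , ≤-trans (𝔼-∪≤𝔼-+ (p ▸ C) (q ▸ B) (▸-probabilities p-probability C)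
        (▸-probabilities q-probability B) (mixture-probabilities C B) mono) le

-- Memory cells and majorization

Cells : ℕ → ℕ → Set
Cells n s = Vec (Maybe (Fin n)) s

∈-contents⁻ : ∀ {n s} (xs : Cells n s) P {u} → u ∈ contents xs P → ∃[ i ] i ∈ P × lookup xs i ≡ just u
∈-contents⁻ []             []          u∈ = contradiction u∈ ∉⊥
∈-contents⁻ (just x ∷ xs)  (true ∷ P)  u∈ with x∈p∪q⁻ ⁅ x ⁆ (contents xs P) u∈
... | inj₁ u∈x = zero , here , cong just (sym (x∈⁅y⁆⇒x≡y x u∈x))
... | inj₂ u∈P = let (i , i∈P , eq) = ∈-contents⁻ xs P u∈P in suc i , there i∈P , eq
∈-contents⁻ (nothing ∷ xs) (true ∷ P)  u∈ = let (i , i∈P , eq) = ∈-contents⁻ xs P u∈ in suc i , there i∈P , eq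
∈-contents⁻ (just x ∷ xs)  (false ∷ P) u∈ = let (i , i∈P , eq) = ∈-contents⁻ xs P u∈ in suc i , there i∈P , eq
∈-contents⁻ (nothing ∷ xs) (false ∷ P) u∈ = let (i , i∈P , eq) = ∈-contents⁻ xs P u∈ in suc i , there i∈P , eq

∈-contents⁺ : ∀ {n s} (xs : Cells n s) P {i u} → i ∈ P → lookup xs i ≡ just u → u ∈ contents xs P
∈-contents⁺ (just x ∷ xs)  (true ∷ P)  {u = u} here refl = p⊆p∪q (contents xs P) (x∈⁅x⁆ u)
∈-contents⁺ (just x ∷ xs)  (true ∷ P)  (there i∈P) eq = q⊆p∪q ⁅ x ⁆ (contents xs P) (∈-contents⁺ xs P i∈P eq)
∈-contents⁺ (nothing ∷ xs) (true ∷ P)  (there i∈P) eq = ∈-contents⁺ xs P i∈P eq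
∈-contents⁺ (just x ∷ xs)  (false ∷ P) (there i∈P) eq = ∈-contents⁺ xs P i∈P eq
∈-contents⁺ (nothing ∷ xs) (false ∷ P) (there i∈P) eq = ∈-contents⁺ xs P i∈P eq

contents-mono : ∀ {n s} (xs : Cells n s) {P Q} → P ⊆ Q → contents xs P ⊆ contents xs Q
contents-mono xs {P} {Q} P⊆Q u∈ = let (i , i∈P , eq) = ∈-contents⁻ xs P u∈ in ∈-contents⁺ xs Q (P⊆Q i∈P) eq

contents-[]≔ : ∀ {n s} (xs : Cells n s) {P : Subset s} {i} u → i ∈ P →
  contents (xs [ i ]≔ just u) P ≡ contents xs (P [ i ]≔ false) ∪ ⁅ u ⁆
contents-[]≔ xs {P} {i} u i∈P = ⊆-antisym to from
  where
  to : contents (xs [ i ]≔ just u) P ⊆ contents xs (P [ i ]≔ false) ∪ ⁅ u ⁆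
  to x∈ with ∈-contents⁻ (xs [ i ]≔ just u) P x∈
  ... | (j , j∈P , eq) with j Fin.≟ i
  ...   | yes refl = subst (_∈ _) (just-injective (trans (sym (lookup∘updateAt i xs)) eq)) (∈-∪⁅⁆ (contents xs (P [ i ]≔ false)) u)
  ...   | no  j≢i  = p⊆p∪q ⁅ u ⁆ (∈-contents⁺ xs _ (∈-[]≔false⁺ i j∈P j≢i) (trans (sym (lookup∘updateAt′ j i j≢i xs)) eq))
  from : contents xs (P [ i ]≔ false) ∪ ⁅ u ⁆ ⊆ contents (xs [ i ]≔ just u) P
  from = ∪⁅⁆-⊆
    (λ x∈ → let (j , j∈ , eq) = ∈-contents⁻ xs (P [ i ]≔ false) x∈ ; (j∈P , j≢i) = ∈-[]≔false⁻ i j∈ in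
      ∈-contents⁺ (xs [ i ]≔ just u) P j∈P (trans (lookup∘updateAt′ j i j≢i xs) eq))
    (∈-contents⁺ (xs [ i ]≔ just u) P i∈P (lookup∘updateAt i xs))

contents-[]≔-∉ : ∀ {n s} (xs : Cells n s) {P : Subset s} {i} v → i ∉ P → contents (xs [ i ]≔ v) P ≡ contents xs P
contents-[]≔-∉ xs {P} {i} v i∉P = ⊆-antisym
  (λ x∈ → let (j , j∈P , eq) = ∈-contents⁻ (xs [ i ]≔ v) P x∈ in
    ∈-contents⁺ xs P j∈P (trans (sym (lookup∘updateAt′ j i (λ eq → i∉P (subst (_∈ P) eq j∈P)) xs)) eq))
  (λ x∈ → let (j , j∈P , eq) = ∈-contents⁻ xs P x∈ in
    ∈-contents⁺ (xs [ i ]≔ v) P j∈P (trans (lookup∘updateAt′ j i (λ eq → i∉P (subst (_∈ P) eq j∈P)) xs) eq))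

contents-nothing : ∀ {n} s P → contents {n} (replicate s nothing) P ≡ ⊥
contents-nothing zero    []          = refl
contents-nothing (suc s) (true  ∷ P) = contents-nothing s P
contents-nothing (suc s) (false ∷ P) = contents-nothing s P

-- An element held by two cells would be sampled twice. Excluding this lets random sets of cells
-- stand for random sets of elements.
Distinct : ∀ {n s} → Cells n s → Subset s → Set
Distinct xs P = ∀ {i j u} → i ∈ P → j ∈ P → lookup xs i ≡ just u → lookup xs j ≡ just u → i ≡ j

Distinct-tail : ∀ {n s x b} {xs : Cells n s} {P} → Distinct (x ∷ xs) (b ∷ P) → Distinct xs P
Distinct-tail d i∈ j∈ eq eq′ = Fin.suc-injective (d (there i∈) (there j∈) eq eq′)

Distinct-head : ∀ {n s x} {xs : Cells n s} {P} → Distinct (just x ∷ xs) (true ∷ P) → x ∉ contents xs P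
Distinct-head {xs = xs} {P} d x∈ with ∈-contents⁻ xs P x∈
... | (i , i∈ , eq) with d here (there i∈) refl eq
...   | ()

∣contents∣≤∣P∣ : ∀ {n s} (xs : Cells n s) P → ∣ contents xs P ∣ ℕ.≤ ∣ P ∣
∣contents∣≤∣P∣ {n} []         []          = ℕ.≤-reflexive (∣⊥∣≡0 n)
∣contents∣≤∣P∣ (just x ∷ xs)  (true ∷ P)  = ℕ.≤-trans (ℕ.≤-reflexive (cong ∣_∣ (∪-comm ⁅ x ⁆ (contents xs P))))
  (ℕ.≤-trans (∣p∪⁅x⁆∣≤1+∣p∣ (contents xs P) x) (ℕ.s≤s (∣contents∣≤∣P∣ xs P)))
∣contents∣≤∣P∣ (nothing ∷ xs) (true ∷ P)  = ℕ.m≤n⇒m≤1+n (∣contents∣≤∣P∣ xs P)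
∣contents∣≤∣P∣ (just x ∷ xs)  (false ∷ P) = ∣contents∣≤∣P∣ xs P
∣contents∣≤∣P∣ (nothing ∷ xs) (false ∷ P) = ∣contents∣≤∣P∣ xs P

∣P∣≤∣contents∣ : ∀ {n s} (xs : Cells n s) P → Distinct xs P → (∀ {i} → i ∈ P → lookup xs i ≢ nothing) →
  ∣ P ∣ ℕ.≤ ∣ contents xs P ∣
∣P∣≤∣contents∣ []             []          d filled = ℕ.z≤n
∣P∣≤∣contents∣ (just x ∷ xs)  (true ∷ P)  d filled =
  ℕ.≤-trans (ℕ.s≤s (∣P∣≤∣contents∣ xs P (Distinct-tail d) (filled ∘ there)))
    (ℕ.≤-trans (∣p∣<∣p∪⁅x⁆∣ (Distinct-head d)) (ℕ.≤-reflexive (cong ∣_∣ (∪-comm (contents xs P) ⁅ x ⁆))))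
∣P∣≤∣contents∣ (nothing ∷ xs) (true ∷ P)  d filled = contradiction refl (filled here)
∣P∣≤∣contents∣ (just x ∷ xs)  (false ∷ P) d filled = ∣P∣≤∣contents∣ xs P (Distinct-tail d) (filled ∘ there)
∣P∣≤∣contents∣ (nothing ∷ xs) (false ∷ P) d filled = ∣P∣≤∣contents∣ xs P (Distinct-tail d) (filled ∘ there)

∣[]≔false∣ : ∀ {n} {P : Subset n} {i} → i ∈ P → suc ∣ P [ i ]≔ false ∣ ≡ ∣ P ∣
∣[]≔false∣ here                     = refl
∣[]≔false∣ {P = true  ∷ P} (there i∈) = cong suc (∣[]≔false∣ i∈)
∣[]≔false∣ {P = false ∷ P} (there i∈) = ∣[]≔false∣ i∈

∩-[]≔false : ∀ {n} (P Q : Subset n) i → (P [ i ]≔ false) ∩ Q ≡ (P ∩ Q) [ i ]≔ false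
∩-[]≔false (p ∷ P) (q ∷ Q) zero    = refl
∩-[]≔false (p ∷ P) (q ∷ Q) (suc i) = cong (_ ∷_) (∩-[]≔false P Q i)

[]≔-restore : ∀ {A : Set} {n} (xs : Vec A n) i {a b} → lookup xs i ≡ a → (xs [ i ]≔ b) [ i ]≔ a ≡ xs
[]≔-restore (x ∷ xs) zero    refl = refl
[]≔-restore (x ∷ xs) (suc i) eq   = cong (x ∷_) ([]≔-restore xs i eq)

extremum : ∀ {A : Set} (_≼_ : A → A → Set) → (∀ a b → a ≼ b ⊎ b ≼ a) → (∀ {a b c} → a ≼ b → b ≼ c → a ≼ c) →
  ∀ {n} (P : Subset n) (h : Fin n → A) → (∀ {i} → i ∉ P) ⊎ (∃[ i ] i ∈ P × (∀ {j} → j ∈ P → h j ≼ h i))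
extremum _≼_ tot tr []      h = inj₁ λ ()
extremum _≼_ tot tr (b ∷ P) h with extremum _≼_ tot tr P (h ∘ suc)
extremum _≼_ tot tr (false ∷ P) h | inj₁ empty = inj₁ λ { (there i∈) → empty i∈ }
extremum _≼_ tot tr (true  ∷ P) h | inj₁ empty = inj₂ (zero , here , λ
  { here → [ (λ p → p) , (λ p → p) ]′ (tot (h zero) (h zero)) ; (there i∈) → contradiction i∈ empty })
extremum _≼_ tot tr (false ∷ P) h | inj₂ (i , i∈ , best) = inj₂ (suc i , there i∈ , λ { (there j∈) → best j∈ })
extremum _≼_ tot tr (true  ∷ P) h | inj₂ (i , i∈ , best) with tot (h zero) (h (suc i))
... | inj₁ p = inj₂ (suc i , there i∈ , λ { here → p ; (there j∈) → best j∈ })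
... | inj₂ p = inj₂ (zero , here , λ { here → [ (λ q → q) , (λ q → q) ]′ (tot (h zero) (h zero)) ; (there j∈) → tr (best j∈) p })

-- Comparison of sums by counting above thresholds

module Majorization (ℛ : CompleteOrderedField) where
  open CompleteOrderedField ℛ
  open OrderedFieldProperties ℛ
  open Expectation ℛ using (∑; ∑-set-true; ∑-mono; ∑-nonneg)

  above? : ∀ {n} (h : Fin n → ℝ) θ → Decidable (λ i → ¬ h i ≤ θ)
  above? h θ i = ¬? (h i ≤? θ)

  above : ∀ {n} → (Fin n → ℝ) → ℝ → Subset n
  above h θ = separate (above? h θ)

  ∑-remove : ∀ {n} {P : Subset n} {i} h → i ∈ P → ∑ P h ≡ h i + ∑ (P [ i ]≔ false) h
  ∑-remove {P = P} {i} h i∈P = trans (cong (λ Q → ∑ Q h) (sym (trans (cong ((P [ i ]≔ false) [ i ]≔_) (sym ([]=⇒lookup i∈P)))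
      ([]≔-restore P i refl))))
    (trans (∑-set-true (P [ i ]≔ false) i h) (cong (λ Q → h i + ∑ Q h)
      (trans (idempotent P i) refl)))
    where
    idempotent : ∀ {n} (P : Subset n) i → (P [ i ]≔ false) [ i ]≔ false ≡ P [ i ]≔ false
    idempotent (_ ∷ P) zero    = refl
    idempotent (b ∷ P) (suc i) = cong (b ∷_) (idempotent P i)

  ∑-empty : ∀ {n} (P : Subset n) h → (∀ {i} → i ∉ P) → ∑ P h ≡ 0#
  ∑-empty []          h empty = refl
  ∑-empty (true  ∷ P) h empty = contradiction here empty
  ∑-empty (false ∷ P) h empty = ∑-empty P (h ∘ suc) (λ i∈ → empty (there i∈))

  nonempty⇒0<∣∣ : ∀ {n} {P : Subset n} {i} → i ∈ P → 0 ℕ.< ∣ P ∣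
  nonempty⇒0<∣∣ i∈P = subst (0 ℕ.<_) (∣[]≔false∣ i∈P) (ℕ.s≤s ℕ.z≤n)

  ∣∅∣ : ∀ {n} {P : Subset n} → (∀ {i} → i ∉ P) → ∣ P ∣ ≡ 0
  ∣∅∣ {n} empty = trans (cong ∣_∣ (Empty-unique (λ (_ , i∈) → empty i∈))) (∣⊥∣≡0 n)

  -- Weak majorization: match the largest x with the largest y and recurse.
  ∑-majorized : ∀ {a b} (P : Subset a) (x : Fin a → ℝ) (Q : Subset b) (y : Fin b → ℝ) → (∀ i → 0# ≤ y i) →
    (∀ θ → 0# ≤ θ → ∣ P ∩ above x θ ∣ ℕ.≤ ∣ Q ∩ above y θ ∣) → ∑ P x ≤ ∑ Q y
  ∑-majorized {a} {b} P x Q y 0≤y counts = go ∣ P ∣ P Q refl counts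
    where
    go : ∀ d (P : Subset a) (Q : Subset b) → ∣ P ∣ ≡ d →
      (∀ θ → 0# ≤ θ → ∣ P ∩ above x θ ∣ ℕ.≤ ∣ Q ∩ above y θ ∣) → ∑ P x ≤ ∑ Q y
    go d P Q eq counts with extremum _≤_ total ≤-trans P x
    ... | inj₁ empty = subst (_≤ ∑ Q y) (sym (∑-empty P x empty)) (∑-nonneg Q 0≤y)
    go zero P Q eq counts | inj₂ (i , i∈P , i-max) = contradiction (subst (0 ℕ.<_) eq (nonempty⇒0<∣∣ i∈P)) λ ()
    go (suc d) P Q eq counts | inj₂ (i , i∈P , i-max) with x i ≤? 0#
    ... | yes xi≤0 = ≤-trans (∑-mono P (λ j∈ → ≤-trans (i-max j∈) xi≤0))
          (≤-trans (≤-reflexive (∑-0 P)) (∑-nonneg Q 0≤y))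
      where
      ∑-0 : ∀ {n} (P : Subset n) → ∑ P (λ _ → 0#) ≡ 0#
      ∑-0 []          = refl
      ∑-0 (true  ∷ P) = trans (+-identityˡ _) (∑-0 P)
      ∑-0 (false ∷ P) = ∑-0 P
    ... | no xi≰0 with extremum _≤_ total ≤-trans Q y
    ...   | inj₁ empty = contradiction (counts 0# ≤-refl) (ℕ.<⇒≱ (subst (ℕ._< ∣ P ∩ above x 0# ∣)
            (sym (∣∅∣ (λ j∈ → empty (proj₁ (x∈p∩q⁻ Q (above y 0#) j∈)))))
            (nonempty⇒0<∣∣ (x∈p∩q⁺ (i∈P , ∈-separate⁺ (above? x 0#) xi≰0)))))
    ...   | inj₂ (j , j∈Q , j-max) = subst₂ _≤_ (sym (∑-remove x i∈P)) (sym (∑-remove y j∈Q))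
            (+-mono-≤ xi≤yj (go d (P [ i ]≔ false) (Q [ j ]≔ false) (ℕ.suc-injective (trans (∣[]≔false∣ i∈P) eq)) counts′))
      where
      xi≤yj : x i ≤ y j
      xi≤yj with x i ≤? y j
      ... | yes p = p
      ... | no ¬p = contradiction (counts (y j) (0≤y j)) (ℕ.<⇒≱ (subst (ℕ._< ∣ P ∩ above x (y j) ∣)
            (sym (∣∅∣ (λ k∈ → let (k∈Q , k∈) = x∈p∩q⁻ Q (above y (y j)) k∈ in
              ∈-separate⁻ (above? y (y j)) k∈ (j-max k∈Q))))
            (nonempty⇒0<∣∣ (x∈p∩q⁺ (i∈P , ∈-separate⁺ (above? x (y j)) ¬p)))))
      counts′ : ∀ θ → 0# ≤ θ → ∣ (P [ i ]≔ false) ∩ above x θ ∣ ℕ.≤ ∣ (Q [ j ]≔ false) ∩ above y θ ∣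
      counts′ θ 0≤θ with x i ≤? θ
      ... | yes xi≤θ = ℕ.≤-trans (ℕ.≤-reflexive (∣∅∣ λ k∈ → let (k∈P , k∈) = x∈p∩q⁻ (P [ i ]≔ false) (above x θ) k∈ in
              ∈-separate⁻ (above? x θ) k∈ (≤-trans (i-max (proj₁ (∈-[]≔false⁻ i k∈P))) xi≤θ))) ℕ.z≤n
      ... | no xi≰θ = ℕ.≤-pred (subst₂ ℕ._≤_
              (trans (sym (∣[]≔false∣ i∈)) (cong (suc ∘ ∣_∣) (sym (∩-[]≔false P (above x θ) i))))
              (trans (sym (∣[]≔false∣ j∈)) (cong (suc ∘ ∣_∣) (sym (∩-[]≔false Q (above y θ) j))))
              (counts θ 0≤θ))
        where
        i∈ : i ∈ P ∩ above x θ
        i∈ = x∈p∩q⁺ (i∈P , ∈-separate⁺ (above? x θ) xi≰θ)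
        j∈ : j ∈ Q ∩ above y θ
        j∈ = x∈p∩q⁺ (j∈Q , ∈-separate⁺ (above? y θ) (λ yj≤θ → xi≰θ (≤-trans xi≤yj yj≤θ)))

-- Analysis of one pass

module _ (ℛ : CompleteOrderedField) where
  open CompleteOrderedField ℛ
  open ExpLog ℛ using (+-nonneg; +-monoˡ-≤; 0≤1; ⁻¹-nonneg)
  open OrderedFieldProperties ℛ
  open Expectation ℛ
  open Majorization ℛ

  module PassAnalysis {n k} (M : Matroid n) (rank≤k : ∀ A → Matroid.Independent M A → ∣ A ∣ ℕ.≤ k)
    {g : Subset n → ℝ} (G : SubmodularFunction g) {δ : ℝ} (pδ : IsProbability δ) {μ : ℝ} (0≤μ : 0# ≤ μ) where
    open Matroid M renaming (independent? to Independent?)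
    open MatroidProperties M
    open Sampling G δ pδ

    private
      0<1+μ : 0# < 1# + μ
      0<1+μ = 0<-≤-trans 0<1 (subst (_≤ 1# + μ) (+-identityʳ 1#) (+-monoʳ-≤ 1# 0≤μ))

      ν : ℝ
      ν = (1# + μ) ⁻¹

      0≤ν : 0# ≤ ν
      0≤ν = ⁻¹-nonneg (proj₁ 0<1+μ) (0<⇒≢0 0<1+μ)

    -- Being heavier by the factor 1 + 1/μ is tested after multiplication by μ/(1 + μ). The
    -- bracketing is that of the machine arithmetic, so that the threshold register holds this term
    -- by definition.
    discount : ℝ → ℝ
    discount x = (x * μ) * ν

    discount-mono : ∀ {x y} → x ≤ y → discount x ≤ discount y
    discount-mono p = *-monoʳ-≤ 0≤ν (*-monoʳ-≤ 0≤μ p)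

    undiscount : ∀ x → (1# + μ) * discount x ≡ μ * x
    undiscount x = trans (solve 3 (λ x μ ν → (:1 :+ μ) :* ((x :* μ) :* ν) := ((:1 :+ μ) :* ν) :* (μ :* x)) refl x μ ν)
      (trans (cong (_* (μ * x)) (⁻¹-inverseʳ _ (0<⇒≢0 0<1+μ))) (*-identityˡ _))

    discount≤ : ∀ {x} → 0# ≤ x → discount x ≤ x
    discount≤ {x} 0≤x = *-cancelˡ-≤ 0<1+μ (≤-trans (≤-reflexive (undiscount x))
      (≤-by 0≤x (solve 2 (λ x μ → x := (:1 :+ μ) :* x :- μ :* x) refl x μ)))

    -- Taking out the content of an empty cell takes out nothing. Plain insertion is therefore an
    -- exchange with an empty cell, whose weight is 0.
    Exchangeable : Cells n k → Fin n → Fin k → Set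
    Exchangeable B u i = Independent (contents B (⊤ [ i ]≔ false) ∪ ⁅ u ⁆)

    weight : Cells n k → Fin n → ℝ
    weight B u = H (contents B ⊤ ∪ ⁅ u ⁆) - H (contents B ⊤)

    Eligible : Cells n k → Vec ℝ k → Fin n → Fin k → Set
    Eligible B w u i = Exchangeable B u i × lookup w i ≤ discount (weight B u)
      × (∀ j → Exchangeable B u j → lookup w i ≤ lookup w j)

    data Arrival (B : Cells n k) (w : Vec ℝ k) (u : Fin n) : Cells n k → Vec ℝ k → Set where
      accept : ∀ i → Eligible B w u i → Arrival B w u (B [ i ]≔ just u) (w [ i ]≔ weight B u)
      reject : (∀ i → ¬ Eligible B w u i) → Arrival B w u B w

    heavy : Cells n k → Vec ℝ k → ℝ → Subset n
    heavy B w θ = contents B (above (lookup w) θ)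

    Spanned : Subset n → Fin n → Set
    Spanned X o = o ∈ X ⊎ ¬ Independent (X ∪ ⁅ o ⁆)

    Spanned-mono : ∀ {X Y o} → X ⊆ Y → Spanned X o → Spanned Y o
    Spanned-mono X⊆Y (inj₁ o∈X)  = inj₁ (X⊆Y o∈X)
    Spanned-mono X⊆Y (inj₂ ¬iXo) = inj₂ (¬iXo ∘ hereditary (∪-mono X⊆Y ⊆-refl))

    ∣spanned∣≤ : ∀ {X O} → Independent X → Independent O → (∀ {o} → o ∈ O → Spanned X o) → ∣ O ∣ ℕ.≤ ∣ X ∣
    ∣spanned∣≤ {X} {O} iX iO spanned with ∣ O ∣ ℕ.≤? ∣ X ∣
    ... | yes p = p
    ... | no ¬p with exchange iX iO (ℕ.≰⇒> ¬p)
    ...   | (x , x∈O , x∉X , iXx) = contradiction (spanned x∈O) [ x∉X , (λ ¬iXx → ¬iXx iXx) ]′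

    -- A is the set of all elements accepted so far, and us the rest of the stream.
    record Invariant (us : List (Fin n)) (B : Cells n k) (w : Vec ℝ k) : Set where
      field
        A           : Subset n
        distinct    : Distinct B ⊤
        independent : Independent (contents B ⊤)
        unused      : ∀ {i} → lookup B i ≡ nothing → lookup w i ≡ 0#
        nonnegative : ∀ i → 0# ≤ lookup w i
        B⊆A         : contents B ⊤ ⊆ A
        A-passed    : ∀ {o} → o ∈ A → ¬ o List.∈ us
        -- Weights are fixed on arrival; later removals can only raise the marginals of the elements
        -- that stay. The claim covers every set Y of cells because a replacement applies it to the
        -- cells left over.
        lower       : ∀ Y → ∑ Y (lookup w) ≤ H (contents B Y) - H ⊥
        -- When weight w gives way to w′, the left side grows by at most w′ and the right side by (1
        -- + μ) (w′ - w), which suffices because eligibility means (1 + μ) w ≤ μ w′.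
        upper       : H A - H ⊥ ≤ (1# + μ) * ∑ ⊤ (lookup w)
        -- A certificate, threshold by threshold, that B is a nearly heaviest base: an element that
        -- has passed is either light relative to A or spanned by the cells heavier than θ.
        charged     : ∀ o → o List.∈ us ⊎ (∀ θ → 0# ≤ θ → discount (D o A) ≤ θ ⊎ Spanned (heavy B w θ) o)

    module _ {B : Cells n k} {w : Vec ℝ k} {u : Fin n} (distinct : Distinct B ⊤) (independent : Independent (contents B ⊤))
      (unused : ∀ {i} → lookup B i ≡ nothing → lookup w i ≡ 0#) (u∉B : u ∉ contents B ⊤) where

      -- Otherwise the heavy cells and u extend to an N as large as the base. If N omits some s of
      -- the base, then s is light and N is the base with u in place of s, so the cell of s is
      -- exchangeable. If N omits nothing, u can be inserted: either some cell is light, hence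
      -- exchangeable, or all k cells are filled and N exceeds the rank.
      spanned-by-heavy : ∀ {θ} → 0# ≤ θ → (∀ j → lookup w j ≤ θ → ¬ Exchangeable B u j) → Spanned (heavy B w θ) u
      spanned-by-heavy {θ} 0≤θ blocked with Independent? (heavy B w θ ∪ ⁅ u ⁆)
      ... | no ¬iXu = inj₂ ¬iXu
      ... | yes iXu with augment iXu independent
      ...   | (N , iN , Xu⊆N , N⊆ , S≤N) with ⊆-or-witness (contents B ⊤) N
      ...     | inj₂ (s , s∈S , s∉N) = contradiction exchangeable (blocked j wj≤θ)
        where
        S = contents B ⊤
        X = heavy B w θ
        cell = ∈-contents⁻ B ⊤ s∈S
        j = proj₁ cell
        Bj≡s = proj₂ (proj₂ cell)
        Q = contents B (⊤ [ j ]≔ false) ∪ ⁅ u ⁆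
        wj≤θ : lookup w j ≤ θ
        wj≤θ with lookup w j ≤? θ
        ... | yes p = p
        ... | no ¬p = contradiction (Xu⊆N (p⊆p∪q ⁅ u ⁆ (∈-contents⁺ B _ (∈-separate⁺ (above? (lookup w) θ) ¬p) Bj≡s))) s∉N
        other : ∀ {x} → x ∈ N → x ∈ S → x ∈ Q
        other {x} x∈N x∈S = let (i , i∈ , Bi≡x) = ∈-contents⁻ B ⊤ x∈S in
          p⊆p∪q ⁅ u ⁆ (∈-contents⁺ B _ (∈-[]≔false⁺ j i∈ λ i≡j →
            s∉N (subst (_∈ N) (just-injective (trans (sym Bi≡x) (trans (cong (lookup B) i≡j) Bj≡s))) x∈N)) Bi≡x)
        N⊆Q : N ⊆ Q
        N⊆Q x∈N with x∈p∪q⁻ (X ∪ ⁅ u ⁆) S (N⊆ x∈N)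
        ... | inj₂ x∈S = other x∈N x∈S
        ... | inj₁ x∈Xu with x∈p∪q⁻ X ⁅ u ⁆ x∈Xu
        ...   | inj₁ x∈X = other x∈N (contents-mono B ⊆⊤ x∈X)
        ...   | inj₂ x∈u = q⊆p∪q (contents B (⊤ [ j ]≔ false)) ⁅ u ⁆ x∈u
        exchangeable : Exchangeable B u j
        exchangeable = hereditary (⊆∧∣≥∣⇒⊇ N⊆Q (ℕ.≤-trans (∣p∪⁅x⁆∣≤1+∣p∣ (contents B (⊤ [ j ]≔ false)) u)
          (ℕ.≤-trans (p⊂q⇒∣p∣<∣q∣ (contents-mono B ⊆⊤ , s , s∈S , λ s∈ →
              let (i , i∈ , Bi≡s) = ∈-contents⁻ B _ s∈ in proj₂ (∈-[]≔false⁻ {P = ⊤} j i∈) (distinct ∈⊤ ∈⊤ Bi≡s Bj≡s)))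
            S≤N))) iN
      ...     | inj₁ S⊆N with Fin.any? (λ j → lookup w j ≤? θ)
      ...       | yes (j , wj≤θ) = contradiction
        (hereditary (∪⁅⁆-⊆ (⊆-trans (contents-mono B ⊆⊤) S⊆N) (Xu⊆N (∈-∪⁅⁆ _ u))) iN) (blocked j wj≤θ)
      ...       | no none = contradiction (rank≤k N iN) (ℕ.<⇒≱ (begin
        suc k                      ≡⟨ cong suc (∣⊤∣≡n k) ⟨
        suc ∣ ⊤ {n = k} ∣          ≤⟨ ℕ.s≤s (∣P∣≤∣contents∣ B ⊤ distinct filled) ⟩
        suc ∣ contents B ⊤ ∣       ≤⟨ ∣p∣<∣p∪⁅x⁆∣ u∉B ⟩
        ∣ contents B ⊤ ∪ ⁅ u ⁆ ∣   ≤⟨ p⊆q⇒∣p∣≤∣q∣ (∪⁅⁆-⊆ S⊆N (Xu⊆N (∈-∪⁅⁆ _ u))) ⟩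
        ∣ N ∣                      ∎))
        where
        open ℕ.≤-Reasoning
        -- An empty cell has weight 0, at most θ, and would be a light cell.
        filled : ∀ {i} → i ∈ ⊤ → lookup B i ≢ nothing
        filled {i} _ Bi≡nothing = none (i , subst (_≤ θ) (sym (unused Bi≡nothing)) 0≤θ)

    arrival-preserves : ∀ {u us B w B′ w′} → ¬ u List.∈ us → Arrival B w u B′ w′ → Invariant (u ∷ us) B w → Invariant us B′ w′
    arrival-preserves {u} {us} {B} {w} u∉us (reject none) inv = record
      { Invariant inv
      ; A-passed = λ o∈A → A-passed o∈A ∘ Any.there
      ; charged  = charged′
      }
      where
      open Invariant inv
      u∉A : u ∉ A
      u∉A u∈A = A-passed u∈A (Any.here refl)
      -- If θ is below the discounted weight of u, no exchangeable cell is as light as θ: the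
      -- lightest exchangeable cell would have been eligible.
      rejected : ∀ θ → 0# ≤ θ → discount (D u A) ≤ θ ⊎ Spanned (heavy B w θ) u
      rejected θ 0≤θ with discount (weight B u) ≤? θ
      ... | yes v≤θ = inj₁ (≤-trans (discount-mono (≤-trans (D-antitone u B⊆A) (≤-reflexive (sym (H-add (u∉A ∘ B⊆A)))))) v≤θ)
      ... | no  v≰θ = inj₂ (spanned-by-heavy {B} {w} distinct independent unused (u∉A ∘ B⊆A) 0≤θ blocked)
        where
        exchangeable? : Decidable (Exchangeable B u)
        exchangeable? i = Independent? _
        blocked : ∀ j → lookup w j ≤ θ → ¬ Exchangeable B u j
        blocked j wj≤θ ex with extremum (λ a b → b ≤ a) (λ a b → total b a) (λ p q → ≤-trans q p) (separate exchangeable?) (lookup w)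
        ... | inj₁ empty = empty (∈-separate⁺ exchangeable? ex)
        ... | inj₂ (i , i∈ , least) = none i
          ( ∈-separate⁻ exchangeable? i∈
          , ≤-trans (least (∈-separate⁺ exchangeable? ex)) (≤-trans wj≤θ (≰⇒≥ v≰θ))
          , λ j′ ex′ → least (∈-separate⁺ exchangeable? ex′))
      charged′ : ∀ o → o List.∈ us ⊎ (∀ θ → 0# ≤ θ → discount (D o A) ≤ θ ⊎ Spanned (heavy B w θ) o)
      charged′ o with charged o
      ... | inj₂ c                = inj₂ c
      ... | inj₁ (Any.there o∈us) = inj₁ o∈us
      ... | inj₁ (Any.here refl)  = inj₂ rejected
    arrival-preserves {u} {us} {B} {w} u∉us (accept i (ex , wi≤v , least)) inv = record
      { A           = A ∪ ⁅ u ⁆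
      ; distinct    = distinct′
      ; independent = subst Independent (sym (contents-[]≔ B u ∈⊤)) ex
      ; unused      = unused′
      ; nonnegative = nonnegative′
      ; B⊆A         = subst (_⊆ A ∪ ⁅ u ⁆) (sym (contents-[]≔ B u ∈⊤)) (∪-mono (⊆-trans (contents-mono B ⊆⊤) B⊆A) ⊆-refl)
      ; A-passed    = λ o∈ → [ (λ o∈A → A-passed o∈A ∘ Any.there)
                             , (λ o∈u → subst (λ o → ¬ o List.∈ us) (sym (x∈⁅y⁆⇒x≡y u o∈u)) u∉us) ]′ (x∈p∪q⁻ A ⁅ u ⁆ o∈)
      ; lower       = lower′
      ; upper       = upper′
      ; charged     = charged′
      }
      where
      open Invariant inv
      S  = contents B ⊤
      wᵤ = weight B u
      B′ = B [ i ]≔ just u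
      w′ = w [ i ]≔ wᵤ
      u∉A : u ∉ A
      u∉A u∈A = A-passed u∈A (Any.here refl)
      u∉S : u ∉ S
      u∉S = u∉A ∘ B⊆A
      wᵤ≡D : wᵤ ≡ D u S
      wᵤ≡D = H-add u∉S
      0≤wᵤ : 0# ≤ wᵤ
      0≤wᵤ = subst (0# ≤_) (sym wᵤ≡D) (D-nonneg u S)
      wi≤wᵤ : lookup w i ≤ wᵤ
      wi≤wᵤ = ≤-trans wi≤v (discount≤ 0≤wᵤ)
      B′≢ : ∀ {j} → j ≢ i → lookup B′ j ≡ lookup B j
      B′≢ {j} j≢i = lookup∘updateAt′ j i j≢i B
      B′i : lookup B′ i ≡ just u
      B′i = lookup∘updateAt i B
      w′≢ : ∀ {j} → j ≢ i → lookup w′ j ≡ lookup w j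
      w′≢ {j} j≢i = lookup∘updateAt′ j i j≢i w
      w′i : lookup w′ i ≡ wᵤ
      w′i = lookup∘updateAt i w
      elsewhere : ∀ {j x} → j ≢ i → lookup B′ j ≡ just x → x ≢ u
      elsewhere j≢i eq refl = u∉S (∈-contents⁺ B ⊤ ∈⊤ (trans (sym (B′≢ j≢i)) eq))
      distinct′ : Distinct B′ ⊤
      distinct′ {j} {j′} _ _ eq eq′ with j Fin.≟ i | j′ Fin.≟ i
      ... | yes refl | yes refl = refl
      ... | yes refl | no  ≢i   = contradiction (just-injective (trans (sym eq) B′i)) (elsewhere ≢i eq′)
      ... | no  ≢i   | yes refl = contradiction (just-injective (trans (sym eq′) B′i)) (elsewhere ≢i eq)
      ... | no  ≢i   | no  ≢i′  = distinct ∈⊤ ∈⊤ (trans (sym (B′≢ ≢i)) eq) (trans (sym (B′≢ ≢i′)) eq′)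
      unused′ : ∀ {j} → lookup B′ j ≡ nothing → lookup w′ j ≡ 0#
      unused′ {j} eq with j Fin.≟ i
      ... | yes refl = contradiction (trans (sym eq) B′i) λ ()
      ... | no  j≢i  = trans (w′≢ j≢i) (unused (trans (sym (B′≢ j≢i)) eq))
      nonnegative′ : ∀ j → 0# ≤ lookup w′ j
      nonnegative′ j with j Fin.≟ i
      ... | yes refl = subst (0# ≤_) (sym w′i) 0≤wᵤ
      ... | no  j≢i  = subst (0# ≤_) (sym (w′≢ j≢i)) (nonnegative j)
      ∑-unchanged : ∀ Y → i ∉ Y → ∑ Y (lookup w′) ≡ ∑ Y (lookup w)
      ∑-unchanged Y i∉Y = ∑-cong Y (λ j∈Y → w′≢ λ { refl → i∉Y j∈Y })
      i∉removed : ∀ {Y} → i ∉ Y [ i ]≔ false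
      i∉removed {Y} i∈ = proj₂ (∈-[]≔false⁻ {P = Y} i i∈) refl
      ∑-changed : ∀ {Y} → i ∈ Y → ∑ Y (lookup w′) ≡ wᵤ + ∑ (Y [ i ]≔ false) (lookup w)
      ∑-changed {Y} i∈Y = trans (∑-remove (lookup w′) i∈Y) (cong₂ _+_ w′i (∑-unchanged (Y [ i ]≔ false) (i∉removed {Y})))
      lower′ : ∀ Y → ∑ Y (lookup w′) ≤ H (contents B′ Y) - H ⊥
      lower′ Y with i ∈? Y
      ... | no  i∉Y = subst₂ _≤_ (sym (∑-unchanged Y i∉Y)) (cong (λ Z → H Z - H ⊥) (sym (contents-[]≔-∉ B (just u) i∉Y))) (lower Y)
      ... | yes i∈Y = subst₂ _≤_ (sym (∑-changed i∈Y)) (cong (λ Z → H Z - H ⊥) (sym (contents-[]≔ B u i∈Y)))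
          (≤-by (+-nonneg (0≤y-x (lower (Y [ i ]≔ false))) (0≤y-x gain))
            (solve 5 (λ s z e zu wᵤ → ((z :- e) :- s) :+ ((zu :- z) :- wᵤ) := (zu :- e) :- (wᵤ :+ s)) refl
              (∑ (Y [ i ]≔ false) (lookup w)) (H Z) (H ⊥) (H (Z ∪ ⁅ u ⁆)) wᵤ))
        where
        Z = contents B (Y [ i ]≔ false)
        Z⊆S : Z ⊆ S
        Z⊆S = contents-mono B ⊆⊤
        -- The weight of u is measured against all of S; against the part Z its marginal is at least
        -- as large.
        gain : wᵤ ≤ H (Z ∪ ⁅ u ⁆) - H Z
        gain = subst₂ _≤_ (sym wᵤ≡D) (sym (H-add (u∉S ∘ Z⊆S))) (D-antitone u Z⊆S)
      upper′ : H (A ∪ ⁅ u ⁆) - H ⊥ ≤ (1# + μ) * ∑ ⊤ (lookup w′)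
      upper′ = subst (λ s → H (A ∪ ⁅ u ⁆) - H ⊥ ≤ (1# + μ) * s) (sym (∑-changed {⊤} ∈⊤))
        (≤-by (+-nonneg (+-nonneg (0≤y-x (subst (λ s → H A - H ⊥ ≤ (1# + μ) * s) (∑-remove (lookup w) ∈⊤) upper))
                                  (0≤y-x gain))
                        (0≤y-x (subst ((1# + μ) * lookup w i ≤_) (undiscount wᵤ) (*-monoˡ-≤ (proj₁ 0<1+μ) wi≤v))))
          (solve 7 (λ μ a e w s au wᵤ →
              (((:1 :+ μ) :* (w :+ s) :- (a :- e)) :+ (wᵤ :- (au :- a))) :+ (μ :* wᵤ :- (:1 :+ μ) :* w)
              := (:1 :+ μ) :* (wᵤ :+ s) :- (au :- e)) refl
            μ (H A) (H ⊥) (lookup w i) (∑ (⊤ [ i ]≔ false) (lookup w)) (H (A ∪ ⁅ u ⁆)) wᵤ))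
        where
        gain : H (A ∪ ⁅ u ⁆) - H A ≤ wᵤ
        gain = subst₂ _≤_ (sym (H-add u∉A)) (sym wᵤ≡D) (D-antitone u B⊆A)
      above-mono : ∀ {θ} → above (lookup w) θ ⊆ above (lookup w′) θ
      above-mono {θ} {j} j∈ with j Fin.≟ i
      ... | no  j≢i  = ∈-separate⁺ (above? (lookup w′) θ) (subst (λ x → ¬ x ≤ θ) (sym (w′≢ j≢i)) (∈-separate⁻ (above? (lookup w) θ) j∈))
      ... | yes refl = ∈-separate⁺ (above? (lookup w′) θ) λ w′i≤θ →
              ∈-separate⁻ (above? (lookup w) θ) j∈ (≤-trans wi≤wᵤ (subst (_≤ θ) w′i w′i≤θ))
      iB′ : Independent (contents B′ ⊤)
      iB′ = subst Independent (sym (contents-[]≔ B u ∈⊤)) ex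
      -- If the replaced cell is light, no heavy cell is lost. If it is heavy, so is every cell
      -- exchangeable for u, since i is the lightest of them, and u lies in the old heavy span. The
      -- new heavy set then lies in that span and is no smaller, so it spans the same elements.
      still-spanned : ∀ θ → 0# ≤ θ → ∀ {o} → Spanned (heavy B w θ) o → Spanned (heavy B′ w′ θ) o
      still-spanned θ 0≤θ {o} spanned with lookup w i ≤? θ
      ... | yes wi≤θ = Spanned-mono (λ x∈ → let (j , j∈ , eq) = ∈-contents⁻ B (above (lookup w) θ) x∈ in
              ∈-contents⁺ B′ _ (above-mono j∈) (trans (B′≢ λ j≡i →
                ∈-separate⁻ (above? (lookup w) θ) j∈ (subst (λ j → lookup w j ≤ θ) (sym j≡i) wi≤θ)) eq)) spanned
      ... | no wi≰θ with o ∈? heavy B′ w′ θ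
      ...   | yes o∈X′ = inj₁ o∈X′
      ...   | no  o∉X′ = inj₂ λ iX′o → impossible (exchange (hereditary (contents-mono B ⊆⊤) independent) iX′o X<X′o)
        where
        X  = heavy B w θ
        X′ = heavy B′ w′ θ
        u-spanned : Spanned X u
        u-spanned = spanned-by-heavy {B} {w} distinct independent unused u∉S 0≤θ λ j wj≤θ exj → wi≰θ (≤-trans (least j exj) wj≤θ)
        filled : ∀ {j} → j ∈ above (lookup w′) θ → lookup B′ j ≢ nothing
        filled j∈ eq = ∈-separate⁻ (above? (lookup w′) θ) j∈ (subst (_≤ θ) (sym (unused′ eq)) 0≤θ)
        X<X′o : ∣ X ∣ ℕ.< ∣ X′ ∪ ⁅ o ⁆ ∣
        X<X′o = ℕ.≤-<-trans (ℕ.≤-trans (∣contents∣≤∣P∣ B _) (ℕ.≤-trans (p⊆q⇒∣p∣≤∣q∣ above-mono)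
          (∣P∣≤∣contents∣ B′ _ (λ _ _ → distinct′ ∈⊤ ∈⊤) filled))) (∣p∣<∣p∪⁅x⁆∣ o∉X′)
        unspanned : ∀ {x} → x ∉ X → Independent (X ∪ ⁅ x ⁆) → ¬ Spanned X x
        unspanned x∉X iXx = [ x∉X , (λ ¬iXx → ¬iXx iXx) ]′
        impossible : ¬ (∃[ x ] x ∈ X′ ∪ ⁅ o ⁆ × x ∉ X × Independent (X ∪ ⁅ x ⁆))
        impossible (x , x∈X′o , x∉X , iXx) with x∈p∪q⁻ X′ ⁅ o ⁆ x∈X′o
        ... | inj₂ x∈o = unspanned x∉X iXx (subst (Spanned X) (sym (x∈⁅y⁆⇒x≡y o x∈o)) spanned)
        ... | inj₁ x∈X′ with ∈-contents⁻ B′ _ x∈X′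
        ...   | (j , j∈ , eq) with j Fin.≟ i
        ...     | yes refl = unspanned x∉X iXx (subst (Spanned X) (just-injective (trans (sym B′i) eq)) u-spanned)
        ...     | no  j≢i  = x∉X (∈-contents⁺ B _ (∈-separate⁺ (above? (lookup w) θ)
                    (subst (λ x → ¬ x ≤ θ) (w′≢ j≢i) (∈-separate⁻ (above? (lookup w′) θ) j∈))) (trans (sym (B′≢ j≢i)) eq))
      accepted : ∀ θ → 0# ≤ θ → discount (D u (A ∪ ⁅ u ⁆)) ≤ θ ⊎ Spanned (heavy B′ w′ θ) u
      accepted θ 0≤θ with wᵤ ≤? θ
      ... | yes wᵤ≤θ = inj₁ (≤-trans (discount-mono (≤-trans (D-antitone u (⊆-trans B⊆A (p⊆p∪q ⁅ u ⁆))) (≤-reflexive (sym wᵤ≡D))))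
              (≤-trans (discount≤ 0≤wᵤ) wᵤ≤θ))
      ... | no  wᵤ≰θ = inj₂ (inj₁ (∈-contents⁺ B′ _ (∈-separate⁺ (above? (lookup w′) θ) (subst (λ x → ¬ x ≤ θ) (sym w′i) wᵤ≰θ)) B′i))
      charged′ : ∀ o → o List.∈ us ⊎ (∀ θ → 0# ≤ θ → discount (D o (A ∪ ⁅ u ⁆)) ≤ θ ⊎ Spanned (heavy B′ w′ θ) o)
      charged′ o with charged o
      ... | inj₁ (Any.there o∈us) = inj₁ o∈us
      ... | inj₁ (Any.here refl)  = inj₂ accepted
      ... | inj₂ c = inj₂ λ θ 0≤θ →
        [ (λ v≤θ → inj₁ (≤-trans (discount-mono (D-antitone o {A} (p⊆p∪q ⁅ u ⁆))) v≤θ))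
        , (λ s → inj₂ (still-spanned θ 0≤θ s)) ]′ (c θ 0≤θ)

    initial-invariant : ∀ {us} → (∀ o → o List.∈ us) → Invariant us (replicate k nothing) (replicate k 0#)
    initial-invariant all∈us = record
      { A           = ⊥
      ; distinct    = λ {i} _ _ eq _ → contradiction (trans (sym (lookup-replicate i nothing)) eq) λ ()
      ; independent = subst Independent (sym (contents-nothing k ⊤)) ∅-independent
      ; unused      = λ {i} _ → lookup-replicate i 0#
      ; nonnegative = λ i → ≤-reflexive (sym (lookup-replicate i 0#))
      ; B⊆A         = subst (_⊆ ⊥) (sym (contents-nothing k ⊤)) ⊆-refl
      ; A-passed    = λ o∈⊥ → contradiction o∈⊥ ∉⊥
      ; lower       = λ Y → ≤-reflexive (trans (∑-zeros Y) (sym (trans (cong (λ Z → H Z - H ⊥) (contents-nothing k Y)) (-‿inverseʳ (H ⊥)))))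
      ; upper       = ≤-reflexive (trans (-‿inverseʳ (H ⊥)) (sym (trans (cong ((1# + μ) *_) (∑-zeros {k} ⊤)) (zeroʳ _))))
      ; charged     = λ o → inj₁ (all∈us o)
      }
      where
      ∑-zeros : ∀ {s} (Y : Subset s) → ∑ Y (lookup (replicate s 0#)) ≡ 0#
      ∑-zeros []          = refl
      ∑-zeros (true  ∷ Y) = trans (+-identityˡ _) (∑-zeros Y)
      ∑-zeros (false ∷ Y) = ∑-zeros Y

    -- The set A of all accepted elements mediates between O and B: the union bound relates O to A,
    -- majorization bounds the marginals of O over A by the stored weights, and `upper` bounds H A
    -- by them.
    pass-gain : ∀ {B w O} → (δ * μ) * μ ≡ 1# → Invariant [] B w → Independent O →
      g O - g ⊥ ≤ ((1# + μ) * (1# + μ)) * (H (contents B ⊤) - g ⊥)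
    pass-gain {B} {w} {O} δμμ≡1 inv iO = subst (λ h → g O - h ≤ ((1# + μ) * (1# + μ)) * (H (contents B ⊤) - h)) (𝔼-▸⊥ n δ g) (begin
      g O - H ⊥
        ≡⟨ *-identityˡ _ ⟨
      1# * (g O - H ⊥)
        ≡⟨ cong (_* (g O - H ⊥)) δμμ≡1 ⟨
      δ * μ * μ * (g O - H ⊥)
        ≤⟨ ≤-by (*-nonneg 0≤μ (+-nonneg (*-nonneg 0≤μ (0≤y-x (∑D≥ O A)))
              (+-nonneg (0≤y-x μ∑D≤) (*-nonneg (*-nonneg (proj₁ pδ) 0≤μ) (0≤y-x upper)))))
            (solve 7 (λ μ δ a e o s W →
                μ :* (μ :* (s :- δ :* (o :- a)) :+ (((:1 :+ μ) :* W :- μ :* s) :+ δ :* μ :* ((:1 :+ μ) :* W :- (a :- e))))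
                := (μ :* ((:1 :+ μ) :* W) :+ δ :* μ :* μ :* ((:1 :+ μ) :* W)) :- δ :* μ :* μ :* (o :- e)) refl
              μ δ (H A) (H ⊥) (g O) (∑ O (λ o → D o A)) W) ⟩
      μ * ((1# + μ) * W) + δ * μ * μ * ((1# + μ) * W)
        ≡⟨ cong (λ c → μ * ((1# + μ) * W) + c * ((1# + μ) * W)) δμμ≡1 ⟩
      μ * ((1# + μ) * W) + 1# * ((1# + μ) * W)
        ≡⟨ solve 2 (λ μ W → μ :* ((:1 :+ μ) :* W) :+ :1 :* ((:1 :+ μ) :* W)
                    := ((:1 :+ μ) :* (:1 :+ μ)) :* W) refl μ W ⟩
      ((1# + μ) * (1# + μ)) * W
        ≤⟨ *-monoˡ-≤ (*-nonneg (proj₁ 0<1+μ) (proj₁ 0<1+μ)) (lower ⊤) ⟩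
      ((1# + μ) * (1# + μ)) * (H (contents B ⊤) - H ⊥) ∎)
      where
      open Invariant inv
      open ≤-Reasoning
      W = ∑ ⊤ (lookup w)
      v : Fin n → ℝ
      v o = discount (D o A)
      -- The elements of O above θ are independent and spanned by the cells above θ, hence no more
      -- numerous.
      counts : ∀ θ → 0# ≤ θ → ∣ O ∩ above v θ ∣ ℕ.≤ ∣ ⊤ ∩ above (lookup w) θ ∣
      counts θ 0≤θ = ℕ.≤-trans
        (∣spanned∣≤ (hereditary (contents-mono B ⊆⊤) independent) (hereditary (p∩q⊆p O (above v θ)) iO) spanned)
        (ℕ.≤-trans (∣contents∣≤∣P∣ B _) (ℕ.≤-reflexive (cong ∣_∣ (sym (∩-identityˡ (above (lookup w) θ))))))
        where
        spanned : ∀ {o} → o ∈ O ∩ above v θ → Spanned (heavy B w θ) o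
        spanned {o} o∈ with charged o
        ... | inj₂ c = [ (λ v≤θ → contradiction v≤θ (∈-separate⁻ (above? v θ) (proj₂ (x∈p∩q⁻ O (above v θ) o∈)))) , (λ s → s) ]′ (c θ 0≤θ)
      ∑v≤W : ∑ O v ≤ W
      ∑v≤W = ∑-majorized O v ⊤ (lookup w) nonnegative counts
      μ∑D≤ : μ * ∑ O (λ o → D o A) ≤ (1# + μ) * W
      μ∑D≤ = ≤-trans (≤-reflexive (trans (sym (∑-* O μ _)) (trans (∑-cong O (λ {o} _ → sym (undiscount (D o A)))) (∑-* O (1# + μ) v))))
        (*-monoˡ-≤ (proj₁ 0<1+μ) ∑v≤W)

-- A programming language for machines

Fits : ℕ → Set → Set
Fits b A = A ↣ Vec Bool b

pad : ∀ {a b} → a ℕ.≤ b → Vec Bool a → Vec Bool b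
pad ℕ.z≤n     []       = replicate _ false
pad (ℕ.s≤s p) (x ∷ xs) = x ∷ pad p xs

pad-injective : ∀ {a b} (p : a ℕ.≤ b) {xs ys} → pad p xs ≡ pad p ys → xs ≡ ys
pad-injective ℕ.z≤n     {[]}     {[]}     eq = refl
pad-injective (ℕ.s≤s p) {x ∷ xs} {y ∷ ys} eq = let (eq₁ , eq₂) = ∷-injective eq in cong₂ _∷_ eq₁ (pad-injective p eq₂)

fits-≤ : ∀ {a b A} → a ℕ.≤ b → Fits a A → Fits b A
fits-≤ p f = mk↣ {to = pad p ∘ Injection.to f} (Injection.injective f ∘ pad-injective p)

fits-Unit : ∀ {b} → Fits b Unit
fits-Unit = mk↣ {to = λ _ → replicate _ false} λ _ → refl

fits-Empty : ∀ {b} → Fits b Empty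
fits-Empty = mk↣ {to = λ ()} λ { {()} }

-- One tag bit per binary choice: the code length is the depth of the tree of sums, not the number
-- of states.
fits-⊎ : ∀ {b A B} → Fits b A → Fits b B → Fits (suc b) (A ⊎ B)
fits-⊎ {b} {A} {B} f g = mk↣ {to = to} injective
  where
  to : A ⊎ B → Vec Bool (suc b)
  to (inj₁ x) = true  ∷ Injection.to f x
  to (inj₂ y) = false ∷ Injection.to g y
  injective : ∀ {x y} → to x ≡ to y → x ≡ y
  injective {inj₁ x} {inj₁ y} eq = cong inj₁ (Injection.injective f (proj₂ (∷-injective eq)))
  injective {inj₂ x} {inj₂ y} eq = cong inj₂ (Injection.injective g (proj₂ (∷-injective eq)))
  injective {inj₁ x} {inj₂ y} eq = contradiction (proj₁ (∷-injective eq)) λ ()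
  injective {inj₂ x} {inj₁ y} eq = contradiction (proj₁ (∷-injective eq)) λ ()

fits-branch : ∀ {b A B C} → Fits b A → Fits b B → Fits b C → Fits (2 ℕ.+ b) (A ⊎ (B ⊎ C))
fits-branch {b} f g h = fits-⊎ (fits-≤ (ℕ.n≤1+n b) f) (fits-⊎ g h)

-- Structured programs, compiled to the control graph of a machine whose states
-- are the positions in the program.
module Language (slots registers : ℕ) where

  data Test : Set where
    atMost : (a b : Fin registers) → Test
    indep  : Subset slots → Test
    same   : (a b : Fin slots) → Test
    always : Test
    _and_  : Test → Test → Test
    negate : Test → Test

  data Command : Set where
    copy       : (source target : Fin slots) → Command
    value      : Subset slots → (target : Fin registers) → Command
    constant   : ℕ → (target : Fin registers) → Command
    arithmetic : Operation → (a b target : Fin registers) → Command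
    skip       : Command
    _then_     : Command → Command → Command
    ifte       : Test → Command → Command → Command

  data Program : Set where
    run    : Command → Program
    pass   : (target : Fin slots) (body : Command) → Program
    _then_ : Program → Program → Program

  infixr 5 _then_

  -- One position per emitted instruction. `always` emits none, so control passes straight through
  -- it.
  TestPosition : Test → Set
  TestPosition (atMost a b) = Unit
  TestPosition (indep P)    = Unit
  TestPosition (same a b)   = Unit
  TestPosition always       = Empty
  TestPosition (t and u)    = TestPosition t ⊎ TestPosition u
  TestPosition (negate t)   = TestPosition t

  Position : Command → Set
  Position skip         = Empty
  Position (c then d)   = Position c ⊎ Position d
  Position (ifte t c d) = TestPosition t ⊎ (Position c ⊎ Position d)
  Position _            = Unit

  ProgramPosition : Program → Set
  ProgramPosition (run c)    = Position c
  ProgramPosition (pass a c) = Unit ⊎ (Unit ⊎ Position c)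
  ProgramPosition (P then Q) = ProgramPosition P ⊎ ProgramPosition Q

  module _ {Q : Set} where
    -- The state in which execution begins. The embedding e places local positions among all states,
    -- and x and y are the states in which to continue after success and failure.
    enterTest : ∀ t → (TestPosition t → Q) → Q → Q → Q
    enterTest (atMost a b) e x y = e tt
    enterTest (indep P)    e x y = e tt
    enterTest (same a b)   e x y = e tt
    enterTest always       e x y = x
    enterTest (t and u)    e x y = enterTest t (e ∘ inj₁) (enterTest u (e ∘ inj₂) x y) y
    enterTest (negate t)   e x y = enterTest t e y x

    enter : ∀ c → (Position c → Q) → Q → Q
    enter (copy _ _)           e x = e tt
    enter (value _ _)          e x = e tt
    enter (constant _ _)       e x = e tt
    enter (arithmetic _ _ _ _) e x = e tt
    enter skip                 e x = x
    enter (c then d)           e x = enter c (e ∘ inj₁) (enter d (e ∘ inj₂) x)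
    enter (ifte t c d)         e x = enterTest t (e ∘ inj₁) (enter c (e ∘ inj₂ ∘ inj₁) x) (enter d (e ∘ inj₂ ∘ inj₂) x)

    enterProgram : ∀ P → (ProgramPosition P → Q) → Q → Q
    enterProgram (run c)    e x = enter c e x
    enterProgram (pass a c) e x = e (inj₁ tt)
    enterProgram (P then R) e x = enterProgram P (e ∘ inj₁) (enterProgram R (e ∘ inj₂) x)

    codeTest : ∀ t → (TestPosition t → Q) → Q → Q → TestPosition t → Instruction slots registers Q
    codeTest (atMost a b) e x y _        = atMost? a b x y
    codeTest (indep P)    e x y _        = independent? P x y
    codeTest (same a b)   e x y _        = same? a b x y
    codeTest (t and u)    e x y (inj₁ p) = codeTest t (e ∘ inj₁) (enterTest u (e ∘ inj₂) x y) y p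
    codeTest (t and u)    e x y (inj₂ p) = codeTest u (e ∘ inj₂) x y p
    codeTest (negate t)   e x y p        = codeTest t e y x p

    code : ∀ c → (Position c → Q) → Q → Position c → Instruction slots registers Q
    code (copy a b)           e x _ = copy a b x
    code (value P j)          e x _ = value P j x
    code (constant c j)       e x _ = constant c j x
    code (arithmetic o a b j) e x _ = arithmetic o a b j x
    code (c then d)   e x (inj₁ p)        = code c (e ∘ inj₁) (enter d (e ∘ inj₂) x) p
    code (c then d)   e x (inj₂ p)        = code d (e ∘ inj₂) x p
    code (ifte t c d) e x (inj₁ p)        =
      codeTest t (e ∘ inj₁) (enter c (e ∘ inj₂ ∘ inj₁) x) (enter d (e ∘ inj₂ ∘ inj₂) x) p
    code (ifte t c d) e x (inj₂ (inj₁ p)) = code c (e ∘ inj₂ ∘ inj₁) x p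
    code (ifte t c d) e x (inj₂ (inj₂ p)) = code d (e ∘ inj₂ ∘ inj₂) x p

    codeProgram : ∀ P → (ProgramPosition P → Q) → Q → ProgramPosition P → Instruction slots registers Q
    codeProgram (run c)    e x p                = code c e x p
    codeProgram (pass a c) e x (inj₁ _)         = startPass (e (inj₂ (inj₁ tt)))
    codeProgram (pass a c) e x (inj₂ (inj₁ _))  = read a (enter c (e ∘ inj₂ ∘ inj₂) (e (inj₂ (inj₁ tt)))) x
    codeProgram (pass a c) e x (inj₂ (inj₂ p))  = code c (e ∘ inj₂ ∘ inj₂) (e (inj₂ (inj₁ tt))) p
    codeProgram (P then R) e x (inj₁ p)         = codeProgram P (e ∘ inj₁) (enterProgram R (e ∘ inj₂) x) p
    codeProgram (P then R) e x (inj₂ p)         = codeProgram R (e ∘ inj₂) x p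

  fits-pass : ∀ {b a c} → Fits b (Position c) → Fits (2 ℕ.+ b) (ProgramPosition (pass a c))
  fits-pass fc = fits-⊎ fits-Unit (fits-⊎ fits-Unit fc)

  module _ {b} (P : Program) (fits : Fits b (ProgramPosition P)) (result : Subset slots) where
    private
      stateProgram : ProgramPosition P ⊎ Unit → Instruction slots registers (ProgramPosition P ⊎ Unit)
      stateProgram (inj₁ p) = codeProgram P inj₁ (inj₂ tt) p
      stateProgram (inj₂ _) = output result

    compile : Machine
    compile = record
      { slots = slots ; registers = registers ; bits = suc b
      ; State = ProgramPosition P ⊎ Unit ; encode = fits-⊎ fits fits-Unit
      ; start = enterProgram P inj₁ (inj₂ tt) ; program = stateProgram }

  -- Semantics of programs, and correctness of their compilation

  module Semantics (ℛ : CompleteOrderedField) {n k} (I : Streaming.Instance ℛ n k) where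
    open CompleteOrderedField ℛ
    open Streaming ℛ
    open Instance I using (f) renaming (independent? to Independent?)

    -- Not a record type, so that ⟦_⟧ does not unfold on a neutral argument.
    infix 4 _&_
    data Memory : Set where
      _&_ : Vec (Maybe (Fin n)) slots → Vec ℝ registers → Memory

    cellsOf : Memory → Vec (Maybe (Fin n)) slots
    cellsOf (xs & rs) = xs

    ⟦_⟧ᵗ : Test → Memory → Bool
    ⟦ atMost a b ⟧ᵗ (xs & rs) = ⌊ lookup rs a ≤? lookup rs b ⌋
    ⟦ indep P ⟧ᵗ    (xs & rs) = ⌊ Independent? (contents xs P) ⌋
    ⟦ same a b ⟧ᵗ   (xs & rs) = ⌊ Maybe.≡-dec Fin._≟_ (lookup xs a) (lookup xs b) ⌋
    ⟦ always ⟧ᵗ     σ         = true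
    ⟦ t and u ⟧ᵗ    σ         = ⟦ t ⟧ᵗ σ ∧ ⟦ u ⟧ᵗ σ
    ⟦ negate t ⟧ᵗ   σ         = not (⟦ t ⟧ᵗ σ)

    ⟦_⟧ : Command → Memory → Memory
    ⟦ copy a b ⟧           (xs & rs) = xs [ b ]≔ lookup xs a & rs
    ⟦ value P j ⟧          (xs & rs) = xs & rs [ j ]≔ f (contents xs P)
    ⟦ constant c j ⟧       (xs & rs) = xs & rs [ j ]≔ fromℕ c
    ⟦ arithmetic o a b j ⟧ (xs & rs) = xs & rs [ j ]≔ perform o (lookup rs a) (lookup rs b)
    ⟦ skip ⟧               σ         = σ
    ⟦ c then d ⟧           σ         = ⟦ d ⟧ (⟦ c ⟧ σ)
    ⟦ ifte t c d ⟧         σ         = if ⟦ t ⟧ᵗ σ then ⟦ c ⟧ σ else ⟦ d ⟧ σ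

    arrive : Fin slots → Command → Memory → Fin n → Memory
    arrive a c (xs & rs) u = ⟦ c ⟧ (xs [ a ]≔ just u & rs)

    -- Weakest preconditions. A pass demands its postcondition for every ordering, so that the
    -- result holds for every outcome and not merely on average.
    wp : Program → (Memory → ℕ → Set) → Memory → ℕ → Set
    wp (run c)    K σ p = K (⟦ c ⟧ σ) p
    wp (pass a c) K σ p = ∀ i → K (foldl (arrive a c) σ (toList (ordering n i))) (suc p)
    wp (P then Q) K σ p = wp P (wp Q K) σ p

    module Correctness {b} (P₀ : Program) (fits : Fits b (ProgramPosition P₀)) (result : Subset slots)
      (Good : Outcome n → Set) where
      private
        M = compile P₀ fits result
        State = ProgramPosition P₀ ⊎ Unit
        program = Machine.program M
      open Execution I M

      at : State → Memory → List (Fin n) → ℕ → Configuration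
      at q (xs & rs) us p = configuration q xs rs us p

      Halts : Configuration → Set
      Halts c = ∃[ d ] (return (inj₁ c) ⇓ d) × Surely Good d

      halts-step : ∀ {c c′} → step c ≡ return (inj₁ c′) → Halts c′ → Halts c
      halts-step eq (d , r , good) = d , next (subst (_⇓ d) (sym eq) r) , good

      -- Halting is propagated backwards from the continuation to the entry. The equation ties the
      -- local code to the one global program under the embedding e.
      run-test : ∀ t (e : TestPosition t → State) x y → (∀ q → program (e q) ≡ codeTest t e x y q) →
        ∀ σ us p → Halts (at (if ⟦ t ⟧ᵗ σ then x else y) σ us p) → Halts (at (enterTest t e x y) σ us p)
      run-test (atMost a b) e x y eq (xs & rs) us p h = halts-step stepped h
        where
        stepped : step (configuration (e tt) xs rs us p) ≡ return (inj₁ (configuration (if ⟦ atMost a b ⟧ᵗ (xs & rs) then x else y) xs rs us p))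
        stepped rewrite eq tt = refl
      run-test (indep P) e x y eq (xs & rs) us p h = halts-step stepped h
        where
        stepped : step (configuration (e tt) xs rs us p) ≡ return (inj₁ (configuration (if ⟦ indep P ⟧ᵗ (xs & rs) then x else y) xs rs us p))
        stepped rewrite eq tt = refl
      run-test (same a b) e x y eq (xs & rs) us p h = halts-step stepped h
        where
        stepped : step (configuration (e tt) xs rs us p) ≡ return (inj₁ (configuration (if ⟦ same a b ⟧ᵗ (xs & rs) then x else y) xs rs us p))
        stepped rewrite eq tt = refl
      run-test always e x y eq σ us p h = h
      run-test (t and u) e x y eq σ us p h = run-test t (e ∘ inj₁) _ y (eq ∘ inj₁) σ us p inner
        where
        inner : Halts (at (if ⟦ t ⟧ᵗ σ then enterTest u (e ∘ inj₂) x y else y) σ us p)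
        inner with ⟦ t ⟧ᵗ σ
        ... | true  = run-test u (e ∘ inj₂) x y (eq ∘ inj₂) σ us p h
        ... | false = h
      run-test (negate t) e x y eq σ us p h = run-test t e y x eq σ us p inner
        where
        inner : Halts (at (if ⟦ t ⟧ᵗ σ then y else x) σ us p)
        inner with ⟦ t ⟧ᵗ σ
        ... | true  = h
        ... | false = h

      run-command : ∀ c (e : Position c → State) x → (∀ q → program (e q) ≡ code c e x q) →
        ∀ σ us p → Halts (at x (⟦ c ⟧ σ) us p) → Halts (at (enter c e x) σ us p)
      run-command (copy a b) e x eq (xs & rs) us p h = halts-step stepped h
        where
        stepped : step (configuration (e tt) xs rs us p) ≡ return (inj₁ (at x (⟦ copy a b ⟧ (xs & rs)) us p))
        stepped rewrite eq tt = refl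
      run-command (value P j) e x eq (xs & rs) us p h = halts-step stepped h
        where
        stepped : step (configuration (e tt) xs rs us p) ≡ return (inj₁ (at x (⟦ value P j ⟧ (xs & rs)) us p))
        stepped rewrite eq tt = refl
      run-command (constant c j) e x eq (xs & rs) us p h = halts-step stepped h
        where
        stepped : step (configuration (e tt) xs rs us p) ≡ return (inj₁ (at x (⟦ constant c j ⟧ (xs & rs)) us p))
        stepped rewrite eq tt = refl
      run-command (arithmetic o a b j) e x eq (xs & rs) us p h = halts-step stepped h
        where
        stepped : step (configuration (e tt) xs rs us p) ≡ return (inj₁ (at x (⟦ arithmetic o a b j ⟧ (xs & rs)) us p))
        stepped rewrite eq tt = refl
      run-command skip e x eq σ us p h = h
      run-command (c then d) e x eq σ us p h =
        run-command c (e ∘ inj₁) _ (eq ∘ inj₁) σ us p (run-command d (e ∘ inj₂) x (eq ∘ inj₂) (⟦ c ⟧ σ) us p h)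
      run-command (ifte t c d) e x eq σ us p h = run-test t (e ∘ inj₁) _ _ (eq ∘ inj₁) σ us p inner
        where
        inner : Halts (at (if ⟦ t ⟧ᵗ σ then enter c (e ∘ inj₂ ∘ inj₁) x else enter d (e ∘ inj₂ ∘ inj₂) x) σ us p)
        inner with ⟦ t ⟧ᵗ σ
        ... | true  = run-command c (e ∘ inj₂ ∘ inj₁) x (eq ∘ inj₂ ∘ inj₁) σ us p h
        ... | false = run-command d (e ∘ inj₂ ∘ inj₂) x (eq ∘ inj₂ ∘ inj₂) σ us p h

      private
        halts-choose : ∀ {m} .{{_ : NonZero m}} {g : Fin m → Configuration} → (∀ i → Halts (g i)) →
          ∃[ d ] (uniform m (λ i → return (inj₁ (g i))) ⇓ d) × Surely Good d
        halts-choose {m} h = uniform m (λ i → proj₁ (h i))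
          , choose (λ i → proj₁ (proj₂ (h i))) , uniform (λ i → proj₂ (proj₂ (h i)))

      run-program : ∀ P (e : ProgramPosition P → State) x → (∀ q → program (e q) ≡ codeProgram P e x q) →
        ∀ K → (∀ σ us p → K σ p → Halts (at x σ us p)) → ∀ σ us p → wp P K σ p → Halts (at (enterProgram P e x) σ us p)
      run-program (run c) e x eq K done σ us p post = run-command c e x eq σ us p (done _ us p post)
      run-program (P then Q) e x eq K done = run-program P (e ∘ inj₁) _ (eq ∘ inj₁) (wp Q K)
        (run-program Q (e ∘ inj₂) x (eq ∘ inj₂) K done)
      run-program (pass a c) e x eq K done (xs & rs) us p post =
        let (d , r , good) = halts-choose {{_}} (λ i → loop (toList (ordering n i)) (xs & rs) (post i))
        in d , next (subst (_⇓ d) (sym stepped) r) , good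
        where
        reading = e (inj₂ (inj₁ tt))
        stepped : step (configuration (e (inj₁ tt)) xs rs us p) ≡
          uniform (n !) {{_}} (λ i → return (inj₁ (at reading (xs & rs) (toList (ordering n i)) (suc p))))
        stepped rewrite eq (inj₁ tt) = refl
        loop : ∀ vs σ → K (foldl (arrive a c) σ vs) (suc p) → Halts (at reading σ vs (suc p))
        loop [] (xs & rs) post = halts-step ended (done _ [] (suc p) post)
          where
          ended : step (configuration reading xs rs [] (suc p)) ≡ return (inj₁ (at x (xs & rs) [] (suc p)))
          ended rewrite eq (inj₂ (inj₁ tt)) = refl
        loop (v ∷ vs) (xs & rs) post = halts-step arrived
          (run-command c (e ∘ inj₂ ∘ inj₂) reading (eq ∘ inj₂ ∘ inj₂) (xs [ a ]≔ just v & rs) vs (suc p) (loop vs _ post))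
          where
          arrived : step (configuration reading xs rs (v ∷ vs) (suc p)) ≡
            return (inj₁ (at (enter c (e ∘ inj₂ ∘ inj₂) reading) (xs [ a ]≔ just v & rs) vs (suc p)))
          arrived rewrite eq (inj₂ (inj₁ tt)) = refl

      correct : wp P₀ (λ σ p → Good (outcome (contents (cellsOf σ) result) p)) (replicate slots nothing & replicate registers 0#) 0 →
        ∃[ d ] OutputDistribution d × Surely Good d
      correct = run-program P₀ inj₁ (inj₂ tt) (λ _ → refl) _
        (λ { (xs & rs) us p good → _ , next halted , return good }) _ [] 0

-- The algorithm

module Blocks (slots registers : ℕ) where
  open Language slots registers

  -- Unrolled into a balanced tree with a copy of the body for each subset: a position costs s
  -- further bits, and no loop counter is stored.
  forSubsets : ∀ s → (Subset s → Command) → Command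
  forSubsets zero    c = c []
  forSubsets (suc s) c = forSubsets s (λ P → c (true ∷ P)) then forSubsets s (λ P → c (false ∷ P))

  forEach : ∀ k → (Fin k → Command) → Command
  forEach zero    c = skip
  forEach (suc k) c = c zero then forEach k (c ∘ suc)

  firstOf : ∀ k → (Fin k → Test) → (Fin k → Command) → Command
  firstOf zero    t c = skip
  firstOf (suc k) t c = ifte (t zero) (c zero) (firstOf k (t ∘ suc) (c ∘ suc))

  allOf : ∀ k → (Fin k → Test) → Test
  allOf zero    t = always
  allOf (suc k) t = t zero and allOf k (t ∘ suc)

  fits-forSubsets : ∀ {b} s {c : Subset s → Command} → (∀ P → Fits b (Position (c P))) → Fits (s ℕ.+ b) (Position (forSubsets s c))
  fits-forSubsets zero    fc = fc []
  fits-forSubsets (suc s) fc = fits-⊎ (fits-forSubsets s (λ P → fc (true ∷ P))) (fits-forSubsets s (λ P → fc (false ∷ P)))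

  fits-forEach : ∀ {b} k {c : Fin k → Command} → (∀ i → Fits b (Position (c i))) → Fits (k ℕ.+ b) (Position (forEach k c))
  fits-forEach     zero    fc = fits-Empty
  fits-forEach {b} (suc k) fc = fits-⊎ (fits-≤ (ℕ.m≤n+m b k) (fc zero)) (fits-forEach k (fc ∘ suc))

  fits-allOf : ∀ {b} k {t : Fin k → Test} → (∀ i → Fits b (TestPosition (t i))) → Fits (k ℕ.+ b) (TestPosition (allOf k t))
  fits-allOf     zero    ft = fits-Empty
  fits-allOf {b} (suc k) ft = fits-⊎ (fits-≤ (ℕ.m≤n+m b k) (ft zero)) (fits-allOf k (ft ∘ suc))

  fits-firstOf : ∀ {b} k {t : Fin k → Test} {c : Fin k → Command} → (∀ i → Fits b (TestPosition (t i))) →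
    (∀ i → Fits b (Position (c i))) → Fits (k ℕ.* 2 ℕ.+ b) (Position (firstOf k t c))
  fits-firstOf     zero    ft fc = fits-Empty
  fits-firstOf {b} (suc k) ft fc = fits-branch (fits-≤ (ℕ.m≤n+m b (k ℕ.* 2)) (ft zero))
    (fits-≤ (ℕ.m≤n+m b (k ℕ.* 2)) (fc zero)) (fits-firstOf k (ft ∘ suc) (fc ∘ suc))

-- Numbers the members of P in increasing order, so that at most K scattered cells can be packed
-- into an area of K cells.
ith : ∀ {s} → Subset s → ℕ → Maybe (Fin s)
ith []          i       = nothing
ith (false ∷ P) i       = Maybe.map suc (ith P i)
ith (true  ∷ P) zero    = just zero
ith (true  ∷ P) (suc i) = Maybe.map suc (ith P i)

private
  map-suc⁻ : ∀ {s} (x : Maybe (Fin s)) {j} → Maybe.map suc x ≡ just j → ∃[ j′ ] x ≡ just j′ × j ≡ suc j′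
  map-suc⁻ (just j′) refl = j′ , refl , refl

ith-∈ : ∀ {s} (P : Subset s) i {j} → ith P i ≡ just j → j ∈ P
ith-∈ (false ∷ P) i       eq   with map-suc⁻ (ith P i) eq
... | (j′ , eq′ , refl) = there (ith-∈ P i eq′)
ith-∈ (true  ∷ P) zero    refl = here
ith-∈ (true  ∷ P) (suc i) eq   with map-suc⁻ (ith P i) eq
... | (j′ , eq′ , refl) = there (ith-∈ P i eq′)

ith-injective : ∀ {s} (P : Subset s) i i′ {j} → ith P i ≡ just j → ith P i′ ≡ just j → i ≡ i′
ith-injective (false ∷ P) i i′ eq eq′ with map-suc⁻ (ith P i) eq | map-suc⁻ (ith P i′) eq′
... | (_ , e , refl) | (_ , e′ , refl) = ith-injective P i i′ e e′
ith-injective (true ∷ P) zero    zero     eq eq′ = refl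
ith-injective (true ∷ P) zero    (suc i′) refl eq′ with map-suc⁻ (ith P i′) eq′
... | (_ , _ , ())
ith-injective (true ∷ P) (suc i) zero     eq refl with map-suc⁻ (ith P i) eq
... | (_ , _ , ())
ith-injective (true ∷ P) (suc i) (suc i′) eq eq′ with map-suc⁻ (ith P i) eq | map-suc⁻ (ith P i′) eq′
... | (_ , e , refl) | (_ , e′ , refl) = cong suc (ith-injective P i i′ e e′)

ith-surjective : ∀ {s} {P : Subset s} {j} → j ∈ P → ∃[ i ] i ℕ.< ∣ P ∣ × ith P i ≡ just j
ith-surjective here = 0 , ℕ.s≤s ℕ.z≤n , refl
ith-surjective {P = true ∷ P} (there j∈) = let (i , i< , eq) = ith-surjective j∈ in
  suc i , ℕ.s≤s i< , cong (Maybe.map suc) eq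
ith-surjective {P = false ∷ P} (there j∈) = let (i , i< , eq) = ith-surjective j∈ in
  i , i< , cong (Maybe.map suc) eq

-- The probability of the outcome P, multiplied by T to the power s. Over this common denominator
-- all factors are natural numbers, the only constants that a machine can load.
likelihood : ∀ {s} → ℕ → Vec ℕ s → Subset s → ℕ
likelihood T []       []          = 1
likelihood T (a ∷ as) (true  ∷ P) = a ℕ.* likelihood T as P
likelihood T (a ∷ as) (false ∷ P) = (T ℕ.∸ a) ℕ.* likelihood T as P

-- m determines the accuracy, K is the rank.  The slots are: the arriving
-- element, a slot that always stays empty, and three areas of K cells: the
-- solution C, the base B built during a pass, and an area X for copying.
-- Registers 0 to 5 are temporary, the others are the weights of the cells of B.
module Solver (m K : ℕ) where
  CB slots registers T : ℕ
  CB        = K ℕ.+ K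
  slots     = 2 ℕ.+ (CB ℕ.+ K)
  registers = 6 ℕ.+ K
  T         = m ℕ.* m

  open Language slots registers public
  open Blocks slots registers public

  arriving empty : Fin slots
  arriving = zero
  empty    = suc zero

  cb : Fin CB → Fin slots
  cb i = suc (suc (i ↑ˡ K))

  inC inB inX : Fin K → Fin slots
  inC i = cb (i ↑ˡ K)
  inB i = cb (K ↑ʳ i)
  inX i = suc (suc (CB ↑ʳ i))

  r₀ r₁ r₂ r₃ r₄ r₅ : Fin registers
  r₀ = zero
  r₁ = suc zero
  r₂ = suc (suc zero)
  r₃ = suc (suc (suc zero))
  r₄ = suc (suc (suc (suc zero)))
  r₅ = suc (suc (suc (suc (suc zero))))

  weightOf : Fin K → Fin registers
  weightOf i = suc (suc (suc (suc (suc (suc i)))))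

  accumulate : Vec ℕ slots → Subset slots → Command
  accumulate as P =
    value P r₁ then
    constant (likelihood T as P) r₂ then
    arithmetic mul r₁ r₂ r₁ then
    arithmetic add r₀ r₁ r₀

  -- The expected value of a random set of stored elements, into which the
  -- content of slot i is put with probability lookup as i / T.
  expectedValue : Vec ℕ slots → Command
  expectedValue as =
    constant 0 r₀ then
    forSubsets slots (accumulate as) then
    constant (T ℕ.^ slots) r₁ then
    arithmetic div r₀ r₁ r₀

  -- Registers change only by loading, oracle values and arithmetic, so a value is moved by adding
  -- 0. This overwrites r₁.
  move : (source target : Fin registers) → Command
  move i j = constant 0 r₁ then arithmetic add i r₁ j

  areas : ℕ → Vec ℕ (CB ℕ.+ K)
  areas t = (replicate K t ++ replicate K 1) ++ replicate K 0

  current withArriving : ℕ → Vec ℕ slots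
  current t      = 0 ∷ 0 ∷ areas t
  withArriving t = 1 ∷ 0 ∷ areas t

  candidate : ℕ → Subset CB → Vec ℕ slots
  candidate t P = 0 ∷ 0 ∷ (map (if_then suc t else 0) P ++ replicate K 0)

  exchanged : Fin K → Subset slots
  exchanged i = true ∷ false ∷ ((⊥ {K} ++ (⊤ [ i ]≔ false)) ++ ⊥ {K})

  eligible : Fin K → Test
  eligible i = indep (exchanged i) and (atMost (weightOf i) r₅ and
    allOf K (λ j → negate (indep (exchanged j) and negate (atMost (weightOf i) (weightOf j)))))

  place : Fin K → Command
  place i = copy arriving (inB i) then move r₄ (weightOf i)

  process : ℕ → Command
  process t =
    expectedValue (current t) then
    move r₀ r₃ then
    expectedValue (withArriving t) then
    arithmetic sub r₀ r₃ r₄ then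
    constant m r₁ then
    arithmetic mul r₄ r₁ r₅ then
    constant (suc m) r₁ then
    arithmetic div r₅ r₁ r₅ then
    firstOf K eligible place

  reset : Command
  reset = forEach K (λ i → copy empty (inB i)) then forEach K (λ i → constant 0 (weightOf i))

  -- The guard is decided while the program is being built; only pairs of distinct cells in P cost
  -- an instruction.
  different : Subset CB → Fin CB → Fin CB → Test
  different P i j = if lookup P i ∧ lookup P j ∧ not ⌊ i Fin.≟ j ⌋ then negate (same (cb i) (cb j)) else always

  -- C and B may share elements. A candidate with the same element in two cells would sample it
  -- twice, and the computed value could exceed that of the set.
  allDifferent : Subset CB → Test
  allDifferent P = allOf CB (λ i → allOf CB (different P i))

  source : Subset CB → Fin K → Fin slots
  source P i = maybe′ cb empty (ith P (toℕ i))

  -- A success is written to X, as C is still needed for the remaining candidates. A later success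
  -- may overwrite an earlier one, since each of them reaches the target in r₃.
  attempt try : ℕ → Subset CB → Command
  attempt t P =
    expectedValue (candidate t P) then
    ifte (indep (false ∷ false ∷ (P ++ ⊥ {K})) and (allDifferent P and atMost r₃ r₀))
      (forEach K (λ i → copy (source P i) (inX i)))
      skip
  try t P = if ⌊ ∣ P ∣ ℕ.≤? K ⌋ then attempt t P else skip

  combine : ℕ → Command
  combine t =
    expectedValue (current t) then
    move r₀ r₃ then
    forSubsets CB (try t) then
    forEach K (λ i → copy (inX i) (inC i))

  rounds : ℕ → Program
  rounds zero    = run skip
  rounds (suc t) = rounds t then run reset then pass arriving (process t) then run (combine t)

  solution : Subset slots
  solution = false ∷ false ∷ ((⊤ {K} ++ ⊥ {K}) ++ ⊥ {K})

-- Values computed by the algorithm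

contents-false : ∀ {n s} u (xs : Cells n s) P → contents (u ∷ xs) (false ∷ P) ≡ contents xs P
contents-false (just _) xs P = refl
contents-false nothing  xs P = refl

contents-⊥ : ∀ {n s} (xs : Cells n s) → contents xs ⊥ ≡ ⊥
contents-⊥ []       = refl
contents-⊥ (u ∷ xs) = trans (contents-false u xs ⊥) (contents-⊥ xs)

contents-++ : ∀ {n s t} (xs : Cells n s) (ys : Cells n t) P Q → contents (xs ++ ys) (P ++ Q) ≡ contents xs P ∪ contents ys Q
contents-++ []             ys []          Q = sym (∪-identityˡ _)
contents-++ (just x ∷ xs)  ys (true ∷ P)  Q = trans (cong (⁅ x ⁆ ∪_) (contents-++ xs ys P Q)) (sym (∪-assoc ⁅ x ⁆ _ _))
contents-++ (nothing ∷ xs) ys (true ∷ P)  Q = contents-++ xs ys P Q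
contents-++ (just x ∷ xs)  ys (false ∷ P) Q = contents-++ xs ys P Q
contents-++ (nothing ∷ xs) ys (false ∷ P) Q = contents-++ xs ys P Q

module CellExpectation (ℛ : CompleteOrderedField) where
  open CompleteOrderedField ℛ
  open OrderedFieldProperties ℛ
  open Expectation ℛ

  𝔼-contents : ∀ {n s} q (xs : Cells n s) P (g : Subset n → ℝ) → Distinct xs P →
    𝔼 (q ▸ P) (λ R → g (contents xs R)) ≡ 𝔼 (q ▸ contents xs P) g
  𝔼-contents {n} q []    []          g d = sym (𝔼-▸⊥ n q g)
  𝔼-contents q (u ∷ xs) (false ∷ P) g d = trans (𝔼-0 (q ▸ P) (λ R → g (contents (u ∷ xs) R)))
    (trans (𝔼-cong (q ▸ P) (λ R → cong g (contents-false u xs R)))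
      (trans (𝔼-contents q xs P g (Distinct-tail d)) (cong (λ Z → 𝔼 (q ▸ Z) g) (sym (contents-false u xs P)))))
  𝔼-contents q (nothing ∷ xs) (true ∷ P) g d =
    trans (solve 2 (λ q a → q :* a :+ (:1 :- q) :* a := a) refl q _) (𝔼-contents q xs P g (Distinct-tail d))
  𝔼-contents q (just x ∷ xs) (true ∷ P) g d = sym (trans
    (cong (λ Z → 𝔼 (q ▸ Z) g) (∪-comm ⁅ x ⁆ (contents xs P)))
    (trans (𝔼-▸-insert q g (Distinct-head d)) (cong₂ (λ a b → q * a + (1# - q) * b)
      (trans (𝔼-cong (q ▸ contents xs P) (λ R → cong g (∪-comm R ⁅ x ⁆)))
        (sym (𝔼-contents q xs P (λ S → g (⁅ x ⁆ ∪ S)) (Distinct-tail d))))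
      (sym (𝔼-contents q xs P g (Distinct-tail d))))))

  totalOver : ∀ s → (Subset s → ℝ) → ℝ
  totalOver zero    h = h []
  totalOver (suc s) h = totalOver s (λ P → h (true ∷ P)) + totalOver s (λ P → h (false ∷ P))

  totalOver-cong : ∀ s {h k} → (∀ P → h P ≡ k P) → totalOver s h ≡ totalOver s k
  totalOver-cong zero    eq = eq []
  totalOver-cong (suc s) eq = cong₂ _+_ (totalOver-cong s (λ P → eq (true ∷ P))) (totalOver-cong s (λ P → eq (false ∷ P)))

  totalOver-* : ∀ s c h → totalOver s (λ P → c * h P) ≡ c * totalOver s h
  totalOver-* zero    c h = refl
  totalOver-* (suc s) c h = trans (cong₂ _+_ (totalOver-* s c _) (totalOver-* s c _)) (sym (distribˡ c _ _))

  fromℕ-∸ : ∀ {a T} → a ℕ.≤ T → fromℕ (T ℕ.∸ a) ≡ fromℕ T - fromℕ a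
  fromℕ-∸ {a} {T} a≤T = trans (solve 2 (λ x y → x := (x :+ y) :- y) refl _ (fromℕ a))
    (cong (_- fromℕ a) (trans (sym (fromℕ-+ (T ℕ.∸ a) a)) (cong fromℕ (ℕ.m∸n+n≡m a≤T))))

  module Fractions (T : ℕ) (0<T : 0# < fromℕ T) where
    frac : ℕ → ℝ
    frac a = fromℕ a * fromℕ T ⁻¹

    frac-0 : frac 0 ≡ 0#
    frac-0 = zeroˡ _

    frac-suc : ∀ a → frac (suc a) ≡ frac a + frac 1
    frac-suc a = solve 2 (λ a t → (:1 :+ a) :* t := a :* t :+ (:1 :+ :0) :* t) refl (fromℕ a) _

    frac-T : frac T ≡ 1#
    frac-T = ⁻¹-inverseʳ _ (0<⇒≢0 0<T)

    T*frac : ∀ a → fromℕ T * frac a ≡ fromℕ a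
    T*frac a = trans (solve 3 (λ T a t → T :* (a :* t) := (T :* t) :* a) refl (fromℕ T) (fromℕ a) _)
      (trans (cong (_* fromℕ a) frac-T) (*-identityˡ _))

    0≤frac : ∀ a → 0# ≤ frac a
    0≤frac a = *-cancelˡ-≤ 0<T (subst₂ _≤_ (sym (zeroʳ _)) (sym (T*frac a)) (ExpLog.0≤fromℕ ℛ a))

    frac-mono : ∀ {a b} → a ℕ.≤ b → frac a ≤ frac b
    frac-mono {a} {b} p = *-cancelˡ-≤ 0<T (subst₂ _≤_ (sym (T*frac a)) (sym (T*frac b)) (fromℕ-mono-≤ p))

    frac-probability : ∀ {a} → a ℕ.≤ T → IsProbability (frac a)
    frac-probability {a} p = 0≤frac a , subst (frac a ≤_) frac-T (frac-mono p)

    totalOver-likelihood : ∀ {s} (as : Vec ℕ s) (g : Subset s → ℝ) → (∀ i → lookup as i ℕ.≤ T) →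
      totalOver s (λ P → g P * fromℕ (likelihood T as P)) ≡ fromℕ (T ℕ.^ s) * 𝔼 (map frac as) g
    totalOver-likelihood [] g bound = *-comm _ _
    totalOver-likelihood {suc s} (a ∷ as) g bound = begin
      totalOver s (λ P → g (true ∷ P) * fromℕ (a ℕ.* likelihood T as P)) +
      totalOver s (λ P → g (false ∷ P) * fromℕ ((T ℕ.∸ a) ℕ.* likelihood T as P))
        ≡⟨ cong₂ _+_ (factor a (λ P → g (true ∷ P))) (factor (T ℕ.∸ a) (λ P → g (false ∷ P))) ⟩
      fromℕ a * (fromℕ (T ℕ.^ s) * E₁) + fromℕ (T ℕ.∸ a) * (fromℕ (T ℕ.^ s) * E₀)
        ≡⟨ cong₂ (λ x y → x * (fromℕ (T ℕ.^ s) * E₁) + y * (fromℕ (T ℕ.^ s) * E₀)) (sym (T*frac a))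
             (trans (fromℕ-∸ (bound zero)) (cong (λ x → fromℕ T - x) (sym (T*frac a)))) ⟩
      (fromℕ T * frac a) * (fromℕ (T ℕ.^ s) * E₁) + (fromℕ T - fromℕ T * frac a) * (fromℕ (T ℕ.^ s) * E₀)
        ≡⟨ solve 5 (λ T q p a b → (T :* q) :* (p :* a) :+ (T :- T :* q) :* (p :* b) := (T :* p) :* (q :* a :+ (:1 :- q) :* b))
             refl (fromℕ T) (frac a) (fromℕ (T ℕ.^ s)) E₁ E₀ ⟩
      (fromℕ T * fromℕ (T ℕ.^ s)) * 𝔼 (map frac (a ∷ as)) g
        ≡⟨ cong (_* 𝔼 (map frac (a ∷ as)) g) (sym (fromℕ-* T (T ℕ.^ s))) ⟩
      fromℕ (T ℕ.^ suc s) * 𝔼 (map frac (a ∷ as)) g ∎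
      where
      open ≡-Reasoning
      E₁ = 𝔼 (map frac as) (λ R → g (true ∷ R))
      E₀ = 𝔼 (map frac as) (λ R → g (false ∷ R))
      factor : ∀ a (g : Subset s → ℝ) → totalOver s (λ P → g P * fromℕ (a ℕ.* likelihood T as P)) ≡ fromℕ a * (fromℕ (T ℕ.^ s) * 𝔼 (map frac as) g)
      factor a g = trans (totalOver-cong s (λ P → trans (cong (g P *_) (fromℕ-* a (likelihood T as P)))
          (solve 3 (λ x y z → x :* (y :* z) := y :* (x :* z)) refl (g P) (fromℕ a) _)))
        (trans (totalOver-* s (fromℕ a) _) (cong (fromℕ a *_) (totalOver-likelihood as g (bound ∘ suc))))

module Evaluation (ℛ : CompleteOrderedField) (m K : ℕ) {n} (I : Streaming.Instance ℛ n K) where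
  open CompleteOrderedField ℛ
  open ExpLog ℛ using (0≤fromℕ; ⁻¹-nonneg)
  open OrderedFieldProperties ℛ
  open Expectation ℛ
  open CellExpectation ℛ
  open Streaming ℛ
  open Instance I using (f; monotone; nonneg; submodular; Independent) renaming (independent? to Independent?)
  open Solver m K
  open Semantics ℛ I

  -- The lattice inequality is applied to A ∪ S and B: their union is B ∪ S, and their intersection
  -- contains A.
  f-submodular : SubmodularFunction f
  f-submodular = record
    { nonneg      = nonneg
    ; mono        = monotone
    ; diminishing = λ {A} {B} S A⊆B → ≤-trans
        (≤-by (0≤y-x (monotone {A} (λ x∈A → x∈p∩q⁺ (p⊆p∪q S x∈A , A⊆B x∈A))))
          (solve 3 (λ a b c → c :- b := (a :+ c) :- (a :+ b)) refl (f (B ∪ S)) (f A) (f ((A ∪ S) ∩ B))))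
        (subst (λ Z → f Z + f ((A ∪ S) ∩ B) ≤ f (A ∪ S) + f B) (union {A} {B} S A⊆B) (submodular (A ∪ S) B))
    }
    where
    union : ∀ {A B} (S : Subset n) → A ⊆ B → (A ∪ S) ∪ B ≡ B ∪ S
    union {A} {B} S A⊆B = ⊆-antisym
      (λ x∈ → [ (λ x∈AS → [ (λ x∈A → p⊆p∪q S (A⊆B x∈A)) , q⊆p∪q B S ]′ (x∈p∪q⁻ A S x∈AS)) , p⊆p∪q S ]′ (x∈p∪q⁻ (A ∪ S) B x∈))
      (λ x∈ → [ q⊆p∪q (A ∪ S) B , (λ x∈S → p⊆p∪q B (q⊆p∪q A S x∈S)) ]′ (x∈p∪q⁻ B S x∈))

  -- r₁ and r₂ are scratch and end with unspecified values. The cells and all registers from r₃ on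
  -- survive, so a first expected value and the weights outlast the next evaluation.
  forSubsets-accumulates : ∀ s {xs} {ts : Vec ℝ (3 ℕ.+ K)} {c : Subset s → Command} (h : Subset s → ℝ) →
    (∀ P t₀ t₁ t₂ → ∃[ t₁′ ] ∃[ t₂′ ] ⟦ c P ⟧ (xs & t₀ ∷ t₁ ∷ t₂ ∷ ts) ≡ (xs & (t₀ + h P) ∷ t₁′ ∷ t₂′ ∷ ts)) →
    ∀ t₀ t₁ t₂ → ∃[ t₁′ ] ∃[ t₂′ ] ⟦ forSubsets s c ⟧ (xs & t₀ ∷ t₁ ∷ t₂ ∷ ts) ≡ (xs & (t₀ + totalOver s h) ∷ t₁′ ∷ t₂′ ∷ ts)
  forSubsets-accumulates zero    h step t₀ t₁ t₂ = step [] t₀ t₁ t₂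
  forSubsets-accumulates (suc s) {xs} {ts} {c} h step t₀ t₁ t₂ =
    let (t₁′ , t₂′ , eq₁) = forSubsets-accumulates s (λ P → h (true ∷ P)) (λ P → step (true ∷ P)) t₀ t₁ t₂
        (t₁″ , t₂″ , eq₂) = forSubsets-accumulates s (λ P → h (false ∷ P)) (λ P → step (false ∷ P)) _ t₁′ t₂′
    in t₁″ , t₂″ , trans (cong ⟦ forSubsets s (λ P → c (false ∷ P)) ⟧ eq₁) (trans eq₂
        (cong (λ t → xs & t ∷ t₁″ ∷ t₂″ ∷ ts) (+-assoc t₀ _ _)))

  module _ (0<T : 0# < fromℕ T) where
    open Fractions T 0<T

    expectedValue-correct : ∀ as → (∀ i → lookup as i ℕ.≤ T) → ∀ xs t₀ t₁ t₂ ts →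
      ∃[ t₁′ ] ∃[ t₂′ ] ⟦ expectedValue as ⟧ (xs & t₀ ∷ t₁ ∷ t₂ ∷ ts) ≡
        (xs & 𝔼 (map frac as) (λ P → f (contents xs P)) ∷ t₁′ ∷ t₂′ ∷ ts)
    expectedValue-correct as bound xs t₀ t₁ t₂ ts =
      let (t₁′ , t₂′ , eq) = forSubsets-accumulates slots {xs} {ts} {accumulate as} (λ P → f (contents xs P) * fromℕ (likelihood T as P))
            (λ P t₀ t₁ t₂ → _ , _ , refl) 0# t₁ t₂
      in fromℕ (T ℕ.^ slots) , t₂′ , trans (cong ⟦ constant (T ℕ.^ slots) r₁ then arithmetic div r₀ r₁ r₀ ⟧ eq)
        (cong (λ t → xs & t ∷ fromℕ (T ℕ.^ slots) ∷ t₂′ ∷ ts) quotient)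
      where
      E = 𝔼 (map frac as) (λ P → f (contents xs P))
      p = fromℕ (T ℕ.^ slots)
      p≢0 : ∀ s → 0# < fromℕ (T ℕ.^ s)
      p≢0 zero    = 0<fromℕ-suc 0
      p≢0 (suc s) = subst (0# <_) (sym (fromℕ-* T (T ℕ.^ s)))
        (*-nonneg (proj₁ 0<T) (proj₁ (p≢0 s)) , λ eq → proj₂ (p≢0 s)
          (antisym (proj₁ (p≢0 s)) (*-cancelˡ-≤ 0<T (≤-reflexive (trans (sym eq) (sym (zeroʳ _)))))))
      quotient : (0# + totalOver slots (λ P → f (contents xs P) * fromℕ (likelihood T as P))) * p ⁻¹ ≡ E
      quotient = trans (cong (_* p ⁻¹) (trans (+-identityˡ _) (totalOver-likelihood as _ bound)))
        (trans (solve 3 (λ p e i → (p :* e) :* i := (p :* i) :* e) refl p E _)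
          (trans (cong (_* E) (⁻¹-inverseʳ p (0<⇒≢0 (p≢0 slots)))) (*-identityˡ E)))

    cells : Maybe (Fin n) → Cells n K → Cells n K → Cells n K → Cells n slots
    cells u C B X = u ∷ nothing ∷ ((C ++ B) ++ X)

    𝔼-areas : ∀ (φ : Subset n → ℝ) (x : Vec ℕ CB) (CBs : Cells n CB) X →
      𝔼 (map frac (x ++ replicate K 0)) (λ P → φ (contents (CBs ++ X) P)) ≡ 𝔼 (map frac x) (λ P → φ (contents CBs P))
    𝔼-areas φ x CBs X = trans (cong (λ z → 𝔼 z _) (trans (map-++ frac x _) (cong (map frac x ++_) zeros)))
      (trans (𝔼-++ (map frac x) (0# ▸ ⊤) _) (𝔼-cong (map frac x) λ P →
        trans (𝔼-0▸ (⊤ {K}) (λ Q → φ (contents (CBs ++ X) (P ++ Q)))) (cong φ (trans (contents-++ CBs X P ⊥) (trans (cong (contents CBs P ∪_) (contents-⊥ X)) (∪-identityʳ _))))))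
      where
      zeros : ∀ {k} → map frac (replicate k 0) ≡ 0# ▸ ⊤
      zeros {zero}  = refl
      zeros {suc k} = cong₂ _∷_ frac-0 zeros

    𝔼-slots : ∀ (φ : Subset n → ℝ) u a (y : Vec ℕ (CB ℕ.+ K)) (ys : Cells n (CB ℕ.+ K)) →
      𝔼 (map frac (a ∷ 0 ∷ y)) (λ P → φ (contents (u ∷ nothing ∷ ys) P)) ≡
      frac a * 𝔼 (map frac y) (λ P → φ (contents (u ∷ ys) (true ∷ P))) + (1# - frac a) * 𝔼 (map frac y) (λ P → φ (contents ys P))
    𝔼-slots φ u a y ys = cong₂ (λ A B → frac a * A + (1# - frac a) * B)
      (trans (second (λ P → φ (contents (u ∷ nothing ∷ ys) (true ∷ P)))) (𝔼-cong (map frac y) (λ P → cong φ (inside u P))))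
      (trans (second (λ P → φ (contents (u ∷ nothing ∷ ys) (false ∷ P)))) (𝔼-cong (map frac y) (λ P → cong φ (contents-false u (nothing ∷ ys) (false ∷ P)))))
      where
      second : ∀ g → 𝔼 (frac 0 ∷ map frac y) g ≡ 𝔼 (map frac y) (λ P → g (false ∷ P))
      second g = trans (cong (λ q → 𝔼 (q ∷ map frac y) g) frac-0) (𝔼-0 (map frac y) g)
      inside : ∀ u P → contents (u ∷ nothing ∷ ys) (true ∷ false ∷ P) ≡ contents (u ∷ ys) (true ∷ P)
      inside (just _) P = refl
      inside nothing  P = refl

    𝔼-unused : ∀ (φ : Subset n → ℝ) u (y : Vec ℕ (CB ℕ.+ K)) (ys : Cells n (CB ℕ.+ K)) →
      𝔼 (map frac (0 ∷ 0 ∷ y)) (λ P → φ (contents (u ∷ nothing ∷ ys) P)) ≡ 𝔼 (map frac y) (λ P → φ (contents ys P))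
    𝔼-unused φ u y ys = trans (𝔼-slots φ u 0 y ys)
      (trans (cong (λ q → q * a + (1# - q) * b) frac-0)
        (solve 2 (λ a b → :0 :* a :+ (:1 :- :0) :* b := b) refl a b))
      where
      a = 𝔼 (map frac y) (λ P → φ (contents (u ∷ ys) (true ∷ P)))
      b = 𝔼 (map frac y) (λ P → φ (contents ys P))

    base : ∀ t {C B : Cells n K} X (φ : Subset n → ℝ) → Distinct C ⊤ → Distinct B ⊤ →
      𝔼 (map frac (areas t)) (λ P → φ (contents ((C ++ B) ++ X) P)) ≡
      𝔼 (frac t ▸ contents C ⊤) (λ R → 𝔼 (frac 1 ▸ contents B ⊤) (λ S → φ (R ∪ S)))
    base t {C} {B} X φ dC dB = trans (𝔼-areas φ (replicate K t ++ replicate K 1) (C ++ B) X)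
      (trans (cong (λ z → 𝔼 z (λ P → φ (contents (C ++ B) P))) (trans (map-++ frac (replicate K t) _) (cong₂ _++_ (full {K} t) (full {K} 1))))
        (trans (𝔼-++ (frac t ▸ ⊤ {K}) (frac 1 ▸ ⊤ {K}) _)
          (trans (𝔼-cong (frac t ▸ ⊤ {K}) (λ P → trans (𝔼-cong (frac 1 ▸ ⊤ {K}) (λ Q → cong φ (contents-++ C B P Q)))
              (𝔼-contents (frac 1) B ⊤ (λ S → φ (contents C P ∪ S)) dB)))
            (𝔼-contents (frac t) C ⊤ (λ R → 𝔼 (frac 1 ▸ contents B ⊤) (λ S → φ (R ∪ S))) dC))))
      where
      full : ∀ {k} a → map frac (replicate k a) ≡ frac a ▸ ⊤
      full {zero}  a = refl
      full {suc k} a = cong (frac a ∷_) (full a)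

    -- The function g of the pass analysis.
    smoothed-f : ℕ → Subset n → Subset n → ℝ
    smoothed-f t Cₛ Y = 𝔼 (frac t ▸ Cₛ) (λ R → f (Y ∪ R))

    𝔼-current : ∀ t {C B : Cells n K} u X → Distinct C ⊤ → Distinct B ⊤ →
      𝔼 (map frac (current t)) (λ P → f (contents (cells u C B X) P)) ≡
      𝔼 (frac t ▸ contents C ⊤) (λ R → 𝔼 (frac 1 ▸ contents B ⊤) (λ S → f (R ∪ S)))
    𝔼-current t {C} {B} u X dC dB = trans (𝔼-unused f u (areas t) ((C ++ B) ++ X)) (base t {C} {B} X f dC dB)

    -- The function H of the pass analysis.
    sampled : ℕ → Subset n → Subset n → ℝ
    sampled t Cₛ Z = 𝔼 (frac 1 ▸ Z) (smoothed-f t Cₛ)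

    pair≡sampled : ∀ t Cₛ Z → 𝔼 (frac t ▸ Cₛ) (λ R → 𝔼 (frac 1 ▸ Z) (λ S → f (R ∪ S))) ≡ sampled t Cₛ Z
    pair≡sampled t Cₛ Z = trans (𝔼-swap (frac t ▸ Cₛ) (frac 1 ▸ Z) (λ R S → f (R ∪ S)))
      (𝔼-cong (frac 1 ▸ Z) (λ S → 𝔼-cong (frac t ▸ Cₛ) (λ R → cong f (∪-comm R S))))

    -- As v is in no cell of B, giving the arriving cell the rate 1/T amounts to adding v to B. A
    -- copy of v in C is absorbed by the smoothed function.
    𝔼-withArriving : ∀ t {C B : Cells n K} v X → Distinct C ⊤ → Distinct B ⊤ → v ∉ contents B ⊤ →
      𝔼 (map frac (withArriving t)) (λ P → f (contents (cells (just v) C B X) P)) ≡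
      sampled t (contents C ⊤) (contents B ⊤ ∪ ⁅ v ⁆)
    𝔼-withArriving t {C} {B} v X dC dB v∉B = trans (𝔼-slots f (just v) 1 (areas t) ((C ++ B) ++ X))
      (trans (cong₂ (λ a b → frac 1 * a + (1# - frac 1) * b)
          (trans (base t {C} {B} X (λ S → f (⁅ v ⁆ ∪ S)) dC dB)
            (trans (𝔼-swap (frac t ▸ Cₛ) (frac 1 ▸ Bₛ) (λ R S → f (⁅ v ⁆ ∪ (R ∪ S))))
              (𝔼-cong (frac 1 ▸ Bₛ) (λ S → 𝔼-cong (frac t ▸ Cₛ) (λ R → cong f (rearrange R S))))))
          (trans (base t {C} {B} X f dC dB) (pair≡sampled t Cₛ Bₛ)))
        (sym (𝔼-▸-insert (frac 1) (smoothed-f t Cₛ) v∉B)))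
      where
      Cₛ = contents C ⊤
      Bₛ = contents B ⊤
      rearrange : ∀ R S → ⁅ v ⁆ ∪ (R ∪ S) ≡ (S ∪ ⁅ v ⁆) ∪ R
      rearrange R S = trans (cong (⁅ v ⁆ ∪_) (∪-comm R S)) (trans (sym (∪-assoc ⁅ v ⁆ S R)) (cong (_∪ R) (∪-comm ⁅ v ⁆ S)))

    𝔼-candidate : ∀ t {C B : Cells n K} u X P → Distinct (C ++ B) P →
      𝔼 (map frac (candidate t P)) (λ Q → f (contents (cells u C B X) Q)) ≡ 𝔼 (frac (suc t) ▸ contents (C ++ B) P) f
    𝔼-candidate t {C} {B} u X P d = trans (𝔼-unused f u (map (if_then suc t else 0) P ++ replicate K 0) ((C ++ B) ++ X))
      (trans (𝔼-areas f (map (if_then suc t else 0) P) (C ++ B) X)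
        (trans (cong (λ z → 𝔼 z (λ Q → f (contents (C ++ B) Q))) (trans (sym (map-∘ frac _ P)) (map-cong fraction P)))
          (𝔼-contents (frac (suc t)) (C ++ B) P f d)))
      where
      fraction : ∀ b → frac (if b then suc t else 0) ≡ (if b then frac (suc t) else 0#)
      fraction true  = refl
      fraction false = frac-0

-- Correctness of a pass

-- Starts the invariant of a pass: every element is still to come.
ordering-complete : ∀ n i u → u List.∈ toList (ordering n i)
ordering-complete (suc n) i u with u Fin.≟ proj₁ (remQuot {suc n} (n !) i)
... | yes refl = Any.here refl
... | no  u≢x  = Any.there (subst (u List.∈_) (sym (toList-map (punchIn x) (ordering n j)))
  (subst (List._∈ List.map (punchIn x) (toList (ordering n j))) (Fin.punchIn-punchOut (u≢x ∘ sym))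
    (∈-map⁺ (punchIn x) (ordering-complete n j (punchOut (u≢x ∘ sym))))))
  where
  x = proj₁ (remQuot {suc n} (n !) i)
  j = proj₂ (remQuot {suc n} (n !) i)

-- Ensures that an arriving element has not been accepted earlier in the same pass.
ordering-unique : ∀ n i → Unique (toList (ordering n i))
ordering-unique zero    i = AllPairs.[]
ordering-unique (suc n) i = subst Unique (cong (x ∷_) (sym (toList-map (punchIn x) (ordering n j))))
  (All.map⁺ (All.universal (λ y eq → Fin.punchInᵢ≢i x y (sym eq)) _)
    AllPairs.∷ map⁺ (Fin.punchIn-injective x _ _) (ordering-unique n j))
  where
  x = proj₁ (remQuot {suc n} (n !) i)
  j = proj₂ (remQuot {suc n} (n !) i)

reflects-map : ∀ {P Q : Set} {b} → (P → Q) → (Q → P) → Reflects P b → Reflects Q b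
reflects-map to from (ofʸ p)  = ofʸ (to p)
reflects-map to from (ofⁿ ¬p) = ofⁿ (¬p ∘ from)

isYes-reflects : ∀ {P : Set} (d : Dec P) → Reflects P ⌊ d ⌋
isYes-reflects (yes p) = ofʸ p
isYes-reflects (no ¬p) = ofⁿ ¬p

module BlockSemantics (slots registers : ℕ) (ℛ : CompleteOrderedField) {n k} (I : Streaming.Instance ℛ n k) where
  open Language slots registers
  open Blocks slots registers
  open Semantics ℛ I

  firstOf-correct : ∀ k t c σ →
      (∃[ i ] ⟦ t i ⟧ᵗ σ ≡ true × ⟦ firstOf k t c ⟧ σ ≡ ⟦ c i ⟧ σ)
    ⊎ ((∀ i → ⟦ t i ⟧ᵗ σ ≡ false) × ⟦ firstOf k t c ⟧ σ ≡ σ)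
  firstOf-correct zero    t c σ = inj₂ ((λ ()) , refl)
  firstOf-correct (suc k) t c σ with ⟦ t zero ⟧ᵗ σ in eq
  ... | true  = inj₁ (zero , eq , refl)
  ... | false with firstOf-correct k (t ∘ suc) (c ∘ suc) σ
  ...   | inj₁ (i , eq′ , eq″) = inj₁ (suc i , eq′ , eq″)
  ...   | inj₂ (none , eq′)    = inj₂ ((λ { zero → eq ; (suc i) → none i }) , eq′)

  allOf-reflects : ∀ k {t : Fin k → Test} {P : Fin k → Set} {σ} → (∀ i → Reflects (P i) (⟦ t i ⟧ᵗ σ)) →
    Reflects (∀ i → P i) (⟦ allOf k t ⟧ᵗ σ)
  allOf-reflects zero    r = ofʸ λ ()
  allOf-reflects (suc k) r = reflects-map (λ { (p , ps) zero → p ; (p , ps) (suc i) → ps i }) (λ ps → ps zero , ps ∘ suc)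
    (r zero ×-reflects allOf-reflects k (r ∘ suc))

  -- `put` presents the memory as a function of one vector, so that a single lemma serves the areas
  -- C, B and X as well as the weights.
  forEach-fills : ∀ {A : Set} k (put : Vec A k → Memory) (c : Fin k → Command) (val : Fin k → A) →
    (∀ i Y → ⟦ c i ⟧ (put Y) ≡ put (Y [ i ]≔ val i)) → ∀ Y → ⟦ forEach k c ⟧ (put Y) ≡ put (tabulate val)
  forEach-fills zero    put c val eq []      = refl
  forEach-fills (suc k) put c val eq (y ∷ Y) = trans (cong ⟦ forEach k (c ∘ suc) ⟧ (eq zero (y ∷ Y)))
    (forEach-fills k (λ Z → put (val zero ∷ Z)) (c ∘ suc) (val ∘ suc) (λ i Z → eq (suc i) (val zero ∷ Z)) Y)

  -- Exhaustive search: earlier candidates alter the memory, so the successful P must work from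
  -- every memory satisfying `Inv`, and later candidates must not undo `Good`.
  forSubsets-reaches : ∀ s {c : Subset s → Command} (Inv Good : Memory → Set) →
    (∀ P σ → Inv σ → Inv (⟦ c P ⟧ σ)) → (∀ P σ → Inv σ → Good σ → Good (⟦ c P ⟧ σ)) →
    (∀ σ → Inv σ → Inv (⟦ forSubsets s c ⟧ σ)) × (∀ σ → Inv σ → Good σ → Good (⟦ forSubsets s c ⟧ σ))
    × (∀ P → (∀ σ → Inv σ → Good (⟦ c P ⟧ σ)) → ∀ σ → Inv σ → Good (⟦ forSubsets s c ⟧ σ))
  forSubsets-reaches zero    Inv Good inv good = inv [] , good [] , λ { [] reach → reach }
  forSubsets-reaches (suc s) Inv Good inv good =
    let (inv₁ , good₁ , reach₁) = forSubsets-reaches s Inv Good (λ P → inv (true ∷ P)) (λ P → good (true ∷ P))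
        (inv₂ , good₂ , reach₂) = forSubsets-reaches s Inv Good (λ P → inv (false ∷ P)) (λ P → good (false ∷ P))
    in (λ σ i → inv₂ _ (inv₁ σ i))
     , (λ σ i g → good₂ _ (inv₁ σ i) (good₁ σ i g))
     , λ { (true  ∷ P) reach σ i → good₂ _ (inv₁ σ i) (reach₁ P reach σ i)
         ; (false ∷ P) reach σ i → reach₂ P reach _ (inv₁ σ i) }

module Passes (ℛ : CompleteOrderedField) (m K : ℕ) (1≤T : 1 ℕ.≤ m ℕ.* m) {n} (I : Streaming.Instance ℛ n K) where
  open CompleteOrderedField ℛ
  open ExpLog ℛ using (0≤fromℕ; +-monoˡ-≤)
  open OrderedFieldProperties ℛ
  open Expectation ℛ
  open Streaming ℛ
  open Instance I using (f; matroid; rank; Independent; hereditary; monotone) renaming (independent? to Independent?)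
  open Solver m K
  open Semantics ℛ I
  open BlockSemantics slots registers ℛ I
  open Evaluation ℛ m K I

  0<T : 0# < fromℕ T
  0<T = 0<-≤-trans 0<1 (subst (_≤ fromℕ T) fromℕ-1 (fromℕ-mono-≤ 1≤T))

  open CellExpectation.Fractions ℛ T 0<T public

  cells′ : Maybe (Fin n) → Cells n K → Cells n K → Cells n K → Cells n slots
  cells′ = cells 0<T

  data Layout (C B X : Cells n K) (w : Vec ℝ K) : Memory → Set where
    layout : ∀ u t₀ t₁ t₂ t₃ t₄ t₅ → Layout C B X w (cells′ u C B X & t₀ ∷ t₁ ∷ t₂ ∷ t₃ ∷ t₄ ∷ t₅ ∷ w)

  set-inB : ∀ u C B X i v → cells′ u C B X [ inB i ]≔ v ≡ cells′ u C (B [ i ]≔ v) X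
  set-inB u C B X i v = cong (λ ys → u ∷ nothing ∷ ys)
    (trans ([]≔-++-↑ˡ (C ++ B) X (K ↑ʳ i)) (cong (_++ X) ([]≔-++-↑ʳ C B i)))

  set-inC : ∀ u C B X i v → cells′ u C B X [ inC i ]≔ v ≡ cells′ u (C [ i ]≔ v) B X
  set-inC u C B X i v = cong (λ ys → u ∷ nothing ∷ ys)
    (trans ([]≔-++-↑ˡ (C ++ B) X (i ↑ˡ K)) (cong (_++ X) ([]≔-++-↑ˡ C B i)))

  set-inX : ∀ u C B X i v → cells′ u C B X [ inX i ]≔ v ≡ cells′ u C B (X [ i ]≔ v)
  set-inX u C B X i v = cong (λ ys → u ∷ nothing ∷ ys) ([]≔-++-↑ʳ (C ++ B) X i)

  tabulate-const : ∀ {A : Set} k {a : A} → tabulate {n = k} (λ _ → a) ≡ replicate k a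
  tabulate-const zero    = refl
  tabulate-const (suc k) = cong (_ ∷_) (tabulate-const k)

  reset-correct : ∀ {C B X w σ} → Layout C B X w σ → Layout C (replicate K nothing) X (replicate K 0#) (⟦ reset ⟧ σ)
  reset-correct {C} {B} {X} {w} (layout u t₀ t₁ t₂ t₃ t₄ t₅) = subst₂ (λ B′ w′ → Layout C B′ X w′ (⟦ reset ⟧ (cells′ u C B X & rest w)))
    (tabulate-const K) (tabulate-const K) (subst (Layout C (tabulate (λ _ → nothing)) X (tabulate (λ _ → 0#))) (sym (trans
      (cong ⟦ forEach K (λ i → constant 0 (weightOf i)) ⟧ (forEach-fills K (λ B → cells′ u C B X & rest w) _ (λ _ → nothing)
        (λ i B → cong (_& rest w) (set-inB u C B X i nothing)) B))
      (forEach-fills K (λ w → cells′ u C (tabulate (λ _ → nothing)) X & rest w) _ (λ _ → 0#) (λ i w → refl) w)))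
    (layout u t₀ t₁ t₂ t₃ t₄ t₅))
    where
    rest : Vec ℝ K → Vec ℝ registers
    rest w = t₀ ∷ t₁ ∷ t₂ ∷ t₃ ∷ t₄ ∷ t₅ ∷ w

  replicate-≤ : ∀ k {a} → a ℕ.≤ T → ∀ i → lookup (replicate k a) i ℕ.≤ T
  replicate-≤ k {a} a≤T i = subst (ℕ._≤ T) (sym (lookup-replicate i a)) a≤T

  ++-≤ : ∀ {k l} (as : Vec ℕ k) {bs : Vec ℕ l} → (∀ i → lookup as i ℕ.≤ T) → (∀ i → lookup bs i ℕ.≤ T) → ∀ i → lookup (as ++ bs) i ℕ.≤ T
  ++-≤ []       p q i       = q i
  ++-≤ (a ∷ as) p q zero    = p zero
  ++-≤ (a ∷ as) p q (suc i) = ++-≤ as (p ∘ suc) q i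

  areas-≤ : ∀ {t} → t ℕ.≤ T → ∀ i → lookup (areas t) i ℕ.≤ T
  areas-≤ {t} t≤T = ++-≤ (replicate K t ++ replicate K 1) (++-≤ (replicate K t) (replicate-≤ K t≤T) (replicate-≤ K 1≤T)) (replicate-≤ K ℕ.z≤n)

  current-≤ : ∀ {t} → t ℕ.≤ T → ∀ i → lookup (current t) i ℕ.≤ T
  current-≤ t≤T zero          = ℕ.z≤n
  current-≤ t≤T (suc zero)    = ℕ.z≤n
  current-≤ t≤T (suc (suc i)) = areas-≤ t≤T i

  withArriving-≤ : ∀ {t} → t ℕ.≤ T → ∀ i → lookup (withArriving t) i ℕ.≤ T
  withArriving-≤ t≤T zero          = 1≤T
  withArriving-≤ t≤T (suc zero)    = ℕ.z≤n
  withArriving-≤ t≤T (suc (suc i)) = areas-≤ t≤T i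

  μ : ℝ
  μ = fromℕ m

  open DecayRate ℛ μ (0≤fromℕ m) public

  δμμ≡1 : frac 1 * μ * μ ≡ 1#
  δμμ≡1 = trans (*-assoc (frac 1) μ μ) (trans (*-comm (frac 1) (μ * μ))
    (trans (cong (_* frac 1) (sym (fromℕ-* m m))) (trans (T*frac 1) fromℕ-1)))

  φ : ℕ → Subset n → ℝ
  φ t Cₛ = 𝔼 (frac t ▸ Cₛ) f

  pair : ℕ → Subset n → Subset n → ℝ
  pair t Cₛ Bₛ = 𝔼 (frac t ▸ Cₛ) (λ R → 𝔼 (frac 1 ▸ Bₛ) (λ S → f (R ∪ S)))

  module _ {t} (t≤T : t ℕ.≤ T) {C : Cells n K} (C-distinct : Distinct C ⊤) where
    open PassAnalysis ℛ matroid (proj₂ rank)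
      (smoothed f-submodular {x = frac t ▸ contents C ⊤} (λ R → R) (▸-probabilities (frac-probability t≤T) (contents C ⊤)))
      (frac-probability 1≤T) (0≤fromℕ m) public

    contents-exchanged : ∀ {B X v} i → contents (cells′ (just v) C B X) (exchanged i) ≡ contents B (⊤ [ i ]≔ false) ∪ ⁅ v ⁆
    contents-exchanged {B} {X} {v} i = begin
      ⁅ v ⁆ ∪ contents ((C ++ B) ++ X) ((⊥ {K} ++ Q) ++ ⊥ {K})
        ≡⟨ cong (⁅ v ⁆ ∪_) (contents-++ (C ++ B) X (⊥ {K} ++ Q) (⊥ {K})) ⟩
      ⁅ v ⁆ ∪ (contents (C ++ B) (⊥ {K} ++ Q) ∪ contents X ⊥)
        ≡⟨ cong₂ (λ Y Z → ⁅ v ⁆ ∪ (Y ∪ Z)) (contents-++ C B (⊥ {K}) Q) (contents-⊥ X) ⟩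
      ⁅ v ⁆ ∪ ((contents C ⊥ ∪ contents B Q) ∪ ⊥)
        ≡⟨ cong (⁅ v ⁆ ∪_) (trans (∪-identityʳ _) (trans (cong (_∪ contents B Q) (contents-⊥ C)) (∪-identityˡ _))) ⟩
      ⁅ v ⁆ ∪ contents B Q
        ≡⟨ ∪-comm ⁅ v ⁆ (contents B Q) ⟩
      contents B Q ∪ ⁅ v ⁆ ∎
      where
      open ≡-Reasoning
      Q = ⊤ {K} [ i ]≔ false

    EligibleAt : ℝ → Cells n K → Vec ℝ K → Fin n → Fin K → Set
    EligibleAt d B w v i = Exchangeable B v i × lookup w i ≤ d × (∀ j → Exchangeable B v j → lookup w i ≤ lookup w j)

    eligible-reflects : ∀ {B X w v} i t₀ t₁ t₂ t₃ t₄ t₅ → Reflects (EligibleAt t₅ B w v i)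
      (⟦ eligible i ⟧ᵗ (cells′ (just v) C B X & t₀ ∷ t₁ ∷ t₂ ∷ t₃ ∷ t₄ ∷ t₅ ∷ w))
    eligible-reflects {B} {X} {w} {v} i t₀ t₁ t₂ t₃ t₄ t₅ =
      exchangeable i ×-reflects isYes-reflects (lookup w i ≤? t₅) ×-reflects
        reflects-map (λ none j ex → decide j ex (none j)) (λ least j (ex , ¬le) → ¬le (least j ex))
          (allOf-reflects K (λ j → ¬-reflects (exchangeable j ×-reflects ¬-reflects (isYes-reflects (lookup w i ≤? lookup w j)))))
      where
      exchangeable : ∀ j → Reflects (Exchangeable B v j) ⌊ Independent? (contents (cells′ (just v) C B X) (exchanged j)) ⌋
      exchangeable j = reflects-map (subst Independent (contents-exchanged j)) (subst Independent (sym (contents-exchanged j))) (isYes-reflects (Independent? _))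
      decide : ∀ j → Exchangeable B v j → ¬ (Exchangeable B v j × ¬ lookup w i ≤ lookup w j) → lookup w i ≤ lookup w j
      decide j ex none with lookup w i ≤? lookup w j
      ... | yes le = le
      ... | no ¬le = contradiction (ex , ¬le) none

    data Chosen (B X : Cells n K) (w : Vec ℝ K) (v : Fin n) (t₄ t₅ : ℝ) (σ : Memory) : Set where
      placed : ∀ i → EligibleAt t₅ B w v i → Layout C (B [ i ]≔ just v) X (w [ i ]≔ t₄) σ → Chosen B X w v t₄ t₅ σ
      kept   : (∀ i → ¬ EligibleAt t₅ B w v i) → Layout C B X w σ → Chosen B X w v t₄ t₅ σ

    choose-correct : ∀ B X w v t₀ t₁ t₂ t₃ t₄ t₅ → Chosen B X w v t₄ t₅
      (⟦ firstOf K eligible place ⟧ (cells′ (just v) C B X & t₀ ∷ t₁ ∷ t₂ ∷ t₃ ∷ t₄ ∷ t₅ ∷ w))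
    choose-correct B X w v t₀ t₁ t₂ t₃ t₄ t₅ = [ found , none-found ]′ (firstOf-correct K eligible place σ)
      where
      σ = cells′ (just v) C B X & t₀ ∷ t₁ ∷ t₂ ∷ t₃ ∷ t₄ ∷ t₅ ∷ w
      found : (∃[ i ] ⟦ eligible i ⟧ᵗ σ ≡ true × ⟦ firstOf K eligible place ⟧ σ ≡ ⟦ place i ⟧ σ) →
        Chosen B X w v t₄ t₅ (⟦ firstOf K eligible place ⟧ σ)
      found (i , eq , done) = placed i (invert (subst (Reflects (EligibleAt t₅ B w v i)) eq (eligible-reflects i t₀ t₁ t₂ t₃ t₄ t₅)))
        (subst (Layout C (B [ i ]≔ just v) X (w [ i ]≔ t₄)) (sym (trans done
            (cong₂ (λ xs a → xs & t₀ ∷ 0# ∷ t₂ ∷ t₃ ∷ t₄ ∷ t₅ ∷ (w [ i ]≔ a)) (set-inB (just v) C B X i (just v)) (+-identityʳ t₄))))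
          (layout (just v) t₀ 0# t₂ t₃ t₄ t₅))
      none-found : ((∀ i → ⟦ eligible i ⟧ᵗ σ ≡ false) × ⟦ firstOf K eligible place ⟧ σ ≡ σ) →
        Chosen B X w v t₄ t₅ (⟦ firstOf K eligible place ⟧ σ)
      none-found (none , done) = kept
        (λ i → invert (subst (Reflects (EligibleAt t₅ B w v i)) (none i) (eligible-reflects i t₀ t₁ t₂ t₃ t₄ t₅)))
        (subst (Layout C B X w) (sym done) (layout (just v) t₀ t₁ t₂ t₃ t₄ t₅))

    chosen⇒arrival : ∀ {B X w v t₄ σ} → t₄ ≡ weight B v → Chosen B X w v t₄ (discount t₄) σ →
      ∃[ B′ ] ∃[ w′ ] Layout C B′ X w′ σ × Arrival B w v B′ w′
    chosen⇒arrival refl (placed i eligible l) = _ , _ , l , accept i eligible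
    chosen⇒arrival refl (kept none l)         = _ , _ , l , reject none

    process-correct : ∀ {B X w v σ} → Distinct B ⊤ → v ∉ contents B ⊤ → Layout C B X w σ →
      ∃[ B′ ] ∃[ w′ ] Layout C B′ X w′ (arrive arriving (process t) σ v) × Arrival B w v B′ w′
    process-correct {B} {X} {w} {v} B-distinct v∉B (layout u t₀ t₁ t₂ t₃ t₄ t₅) =
      let (_ , t₂′ , eq₁) = expectedValue-correct 0<T (current t) (current-≤ t≤T) xs t₀ t₁ t₂ (t₃ ∷ t₄ ∷ t₅ ∷ w)
          (_ , t₂″ , eq₂) = expectedValue-correct 0<T (withArriving t) (withArriving-≤ t≤T) xs e₀ 0# t₂′ ((e₀ + 0#) ∷ t₄ ∷ t₅ ∷ w)
      in chosen⇒arrival difference (subst (Chosen B X w v (e₁ - (e₀ + 0#)) (discount (e₁ - (e₀ + 0#))))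
           (sym (trans (cong (λ σ → ⟦ rest ⟧ (⟦ expectedValue (withArriving t) ⟧ (⟦ move r₀ r₃ ⟧ σ))) eq₁) (cong ⟦ rest ⟧ eq₂)))
           (choose-correct B X w v e₁ (fromℕ (suc m)) t₂″ (e₀ + 0#) (e₁ - (e₀ + 0#)) (discount (e₁ - (e₀ + 0#)))))
      where
      xs = cells′ (just v) C B X
      e₀ = 𝔼 (map frac (current t)) (λ P → f (contents xs P))
      e₁ = 𝔼 (map frac (withArriving t)) (λ P → f (contents xs P))
      rest : Command
      rest = arithmetic sub r₀ r₃ r₄ then
        constant m r₁ then
        arithmetic mul r₄ r₁ r₅ then
        constant (suc m) r₁ then
        arithmetic div r₅ r₁ r₅ then
        firstOf K eligible place
      difference : e₁ - (e₀ + 0#) ≡ weight B v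
      difference = cong₂ _-_ (𝔼-withArriving 0<T t {C} {B} v X C-distinct B-distinct v∉B)
        (trans (+-identityʳ e₀) (trans (𝔼-current 0<T t {C} {B} (just v) X C-distinct B-distinct) (pair≡sampled 0<T t (contents C ⊤) (contents B ⊤))))

    stream-correct : ∀ us {B X w σ} → Unique us → Layout C B X w σ → Invariant us B w →
      ∃[ B′ ] ∃[ w′ ] Layout C B′ X w′ (foldl (arrive arriving (process t)) σ us) × Invariant [] B′ w′
    stream-correct []       unique l inv = _ , _ , l , inv
    stream-correct (v ∷ us) (v∉us AllPairs.∷ unique) l inv =
      let open Invariant inv
          (_ , _ , l′ , a) = process-correct distinct (λ v∈B → A-passed (B⊆A v∈B) (Any.here refl)) l
      in stream-correct us unique l′ (arrival-preserves (λ v∈us → All.lookup v∉us v∈us refl) a inv)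

    f≤smoothed : ∀ O → f O ≤ smoothed-f 0<T t (contents C ⊤) O
    f≤smoothed O = subst (_≤ smoothed-f 0<T t (contents C ⊤) O) (𝔼-const (frac t ▸ contents C ⊤) (f O))
      (𝔼-mono (frac t ▸ contents C ⊤) (▸-probabilities (frac-probability t≤T) (contents C ⊤)) (λ R → monotone (p⊆p∪q R)))

    smoothed-⊥ : smoothed-f 0<T t (contents C ⊤) ⊥ ≡ φ t (contents C ⊤)
    smoothed-⊥ = 𝔼-cong (frac t ▸ contents C ⊤) (λ R → cong f (∪-identityˡ R))

    -- `pass-gain` speaks of the smoothed function. Its value at O is at least f O by monotonicity,
    -- and its value at the empty set is φ.
    pass-improves : ∀ {B w O} → Invariant [] B w → Independent O →
      f O - φ t (contents C ⊤) ≤ N * (pair t (contents C ⊤) (contents B ⊤) - φ t (contents C ⊤))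
    pass-improves {B} {w} {O} inv O-independent = ≤-trans (+-monoˡ-≤ (- φ t (contents C ⊤)) (f≤smoothed O))
      (subst₂ (λ x y → smoothed-f 0<T t (contents C ⊤) O - x ≤ N * (y - x)) smoothed-⊥
        (sym (pair≡sampled 0<T t (contents C ⊤) (contents B ⊤))) (pass-gain δμμ≡1 inv O-independent))

    pass-correct : ∀ {B X w σ} i → Layout C B X w σ → ∃[ B′ ] ∃[ w′ ]
      Layout C B′ X w′ (foldl (arrive arriving (process t)) (⟦ reset ⟧ σ) (toList (ordering n i)))
      × Distinct B′ ⊤ × Independent (contents B′ ⊤)
      × (∀ O → Independent O → f O - φ t (contents C ⊤) ≤ N * (pair t (contents C ⊤) (contents B′ ⊤) - φ t (contents C ⊤)))
    pass-correct i l =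
      let (B′ , w′ , l′ , inv) = stream-correct (toList (ordering n i)) (ordering-unique n i) (reset-correct l)
            (initial-invariant (ordering-complete n i))
      in B′ , w′ , l′ , Invariant.distinct inv , Invariant.independent inv , λ O → pass-improves inv

-- Correctness of merging, and iteration

-- An element of both C and B occupies two cells. The recursion strikes an element from E as soon as
-- a cell is chosen for it, so later copies are passed over.
select-cells : ∀ {n s} (xs : Cells n s) {E} → E ⊆ contents xs ⊤ →
  ∃[ P ] contents xs P ≡ E × Distinct xs P × (∀ {i} → i ∈ P → lookup xs i ≢ nothing)
select-cells [] E⊆ = [] , ⊆-antisym ⊥⊆ E⊆ , (λ ()) , λ ()
select-cells (nothing ∷ xs) E⊆ = let (P , eq , distinct , filled) = select-cells xs E⊆ in
  false ∷ P , eq , (λ { (there i∈) (there j∈) e e′ → cong suc (distinct i∈ j∈ e e′) }) , λ { (there i∈) → filled i∈ }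
select-cells (just x ∷ xs) {E} E⊆ with x ∈? E
... | no x∉E = let (P , eq , distinct , filled) = select-cells xs E⊆xs in
  false ∷ P , eq , (λ { (there i∈) (there j∈) e e′ → cong suc (distinct i∈ j∈ e e′) }) , λ { (there i∈) → filled i∈ }
  where
  E⊆xs : E ⊆ contents xs ⊤
  E⊆xs {k} k∈E = [ (λ k∈x → contradiction (subst (_∈ E) (x∈⁅y⁆⇒x≡y x k∈x) k∈E) x∉E) , (λ k∈ → k∈) ]′ (x∈p∪q⁻ ⁅ x ⁆ _ (E⊆ k∈E))
... | yes x∈E with select-cells xs {E [ x ]≔ false} removed
  where
  removed : E [ x ]≔ false ⊆ contents xs ⊤
  removed k∈ = let (k∈E , k≢x) = ∈-[]≔false⁻ x k∈ in
    [ (λ k∈x → contradiction (x∈⁅y⁆⇒x≡y x k∈x) k≢x) , (λ k∈xs → k∈xs) ]′ (x∈p∪q⁻ ⁅ x ⁆ _ (E⊆ k∈E))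
...   | (P , eq , distinct , filled) = true ∷ P , ⊆-antisym to from , distinct′ , λ { here () ; (there i∈) → filled i∈ }
  where
  to : ⁅ x ⁆ ∪ contents xs P ⊆ E
  to {k} k∈ = [ (λ k∈x → subst (_∈ E) (sym (x∈⁅y⁆⇒x≡y x k∈x)) x∈E)
              , (λ k∈P → proj₁ (∈-[]≔false⁻ x (subst (k ∈_) eq k∈P))) ]′ (x∈p∪q⁻ ⁅ x ⁆ (contents xs P) k∈)
  from : E ⊆ ⁅ x ⁆ ∪ contents xs P
  from {k} k∈E with k Fin.≟ x
  ... | yes refl = p⊆p∪q (contents xs P) (x∈⁅x⁆ x)
  ... | no  k≢x  = x∈p∪q⁺ (inj₂ (subst (k ∈_) (sym eq) (∈-[]≔false⁺ x k∈E k≢x)))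
  x∉P : x ∉ contents xs P
  x∉P x∈ = proj₂ (∈-[]≔false⁻ {P = E} x (subst (x ∈_) eq x∈)) refl
  distinct′ : Distinct (just x ∷ xs) (true ∷ P)
  distinct′ here       here       e    e′   = refl
  distinct′ here       (there j∈) refl e′   = contradiction (∈-contents⁺ xs P j∈ e′) x∉P
  distinct′ (there i∈) here       e    refl = contradiction (∈-contents⁺ xs P i∈ e) x∉P
  distinct′ (there i∈) (there j∈) e    e′   = cong suc (distinct i∈ j∈ e e′)

replicate-++ : ∀ {A : Set} m n (a : A) → replicate m a ++ replicate n a ≡ replicate (m ℕ.+ n) a
replicate-++ zero    n a = refl
replicate-++ (suc m) n a = cong (a ∷_) (replicate-++ m n a)

picked : ∀ {n s} k → Cells n s → Subset s → Cells n k
picked k xs P = tabulate (λ i → maybe′ (lookup xs) nothing (ith P (toℕ i)))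

picked-just : ∀ {n s k} (xs : Cells n s) P {i u} → lookup (picked k xs P) i ≡ just u →
  ∃[ j ] ith P (toℕ i) ≡ just j × lookup xs j ≡ just u
picked-just xs P {i} eq with ith P (toℕ i) | trans (sym (lookup∘tabulate (λ i → maybe′ (lookup xs) nothing (ith P (toℕ i))) i)) eq
... | just j | eq′ = j , refl , eq′

picked-distinct : ∀ {n s} k (xs : Cells n s) P → Distinct xs P → Distinct (picked k xs P) ⊤
picked-distinct k xs P distinct {i} {i′} _ _ eq eq′ =
  let (j , ith≡ , e) = picked-just xs P {i} eq ; (j′ , ith≡′ , e′) = picked-just xs P {i′} eq′ in
  Fin.toℕ-injective (ith-injective P (toℕ i) (toℕ i′) ith≡
    (trans ith≡′ (cong just (distinct (ith-∈ P _ ith≡′) (ith-∈ P _ ith≡) e′ e))))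

contents-picked : ∀ {n s} k (xs : Cells n s) P → ∣ P ∣ ℕ.≤ k → contents (picked k xs P) ⊤ ≡ contents xs P
contents-picked k xs P P≤k = ⊆-antisym
  (λ u∈ → let (i , _ , eq) = ∈-contents⁻ (picked k xs P) ⊤ u∈ ; (j , ith≡ , e) = picked-just xs P {i} eq in
    ∈-contents⁺ xs P (ith-∈ P _ ith≡) e)
  (λ u∈ → let (j , j∈ , e) = ∈-contents⁻ xs P u∈ ; (i , i<P , ith≡) = ith-surjective j∈ ; i<k = ℕ.<-≤-trans i<P P≤k in
    ∈-contents⁺ (picked k xs P) ⊤ {fromℕ< i<k} ∈⊤ (trans (lookup∘tabulate _ (fromℕ< i<k))
      (trans (cong (maybe′ (lookup xs) nothing) (trans (cong (ith P) (Fin.toℕ-fromℕ< i<k)) ith≡)) e)))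

module Rounds (ℛ : CompleteOrderedField) (m K : ℕ) (1≤T : 1 ℕ.≤ m ℕ.* m) {n} (I : Streaming.Instance ℛ n K) where
  open CompleteOrderedField ℛ
  open ExpLog ℛ using (0≤fromℕ; +-nonneg; +-monoˡ-≤; ⁻¹-nonneg)
  open OrderedFieldProperties ℛ
  open Expectation ℛ
  open Streaming ℛ
  open Instance I using (f; matroid; rank; Independent; hereditary; ∅-independent; nonneg; monotone) renaming (independent? to Independent?)
  open Solver m K
  open Semantics ℛ I
  open BlockSemantics slots registers ℛ I
  open Evaluation ℛ m K I
  open Passes ℛ m K 1≤T I

  module _ {t} (t<T : t ℕ.< T) {C B : Cells n K} (C-distinct : Distinct C ⊤) (B-distinct : Distinct B ⊤)
    (C-independent : Independent (contents C ⊤)) (B-independent : Independent (contents B ⊤)) {w : Vec ℝ K} where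

    private
      target : ℝ
      target = pair t (contents C ⊤) (contents B ⊤)

    data Trying (X : Cells n K) : Memory → Set where
      trying : ∀ u t₀ t₁ t₂ t₄ t₅ → Trying X (cells′ u C B X & t₀ ∷ t₁ ∷ t₂ ∷ target ∷ t₄ ∷ t₅ ∷ w)

    Successful : Cells n K → Set
    Successful X = Distinct X ⊤ × Independent (contents X ⊤) × target ≤ φ (suc t) (contents X ⊤)

    Different : Subset CB → Set
    Different P = ∀ i j → i ∈ P → j ∈ P → i ≢ j → lookup (C ++ B) i ≢ lookup (C ++ B) j

    Admissible : Subset CB → Set
    Admissible P = ∣ P ∣ ℕ.≤ K × Independent (contents (C ++ B) P) × Different P × target ≤ φ (suc t) (contents (C ++ B) P)

    different⇒distinct : ∀ {P} → Different P → Distinct (C ++ B) P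
    different⇒distinct diff {i} {j} i∈ j∈ eq eq′ with i Fin.≟ j
    ... | yes i≡j = i≡j
    ... | no  i≢j = contradiction (trans eq (sym eq′)) (diff i j i∈ j∈ i≢j)

    candidate-≤ : ∀ P i → lookup (candidate t P) i ℕ.≤ T
    candidate-≤ P zero          = ℕ.z≤n
    candidate-≤ P (suc zero)    = ℕ.z≤n
    candidate-≤ P (suc (suc i)) = ++-≤ (map (if_then suc t else 0) P) (mapped P) (replicate-≤ K ℕ.z≤n) i
      where
      mapped : ∀ {s} (P : Subset s) i → lookup (map (if_then suc t else 0) P) i ℕ.≤ T
      mapped (true  ∷ P) zero    = t<T
      mapped (false ∷ P) zero    = ℕ.z≤n
      mapped (_ ∷ P)     (suc i) = mapped P i

    lookup-cb : ∀ u X i → lookup (cells′ u C B X) (cb i) ≡ lookup (C ++ B) i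
    lookup-cb u X i = lookup-++ˡ (C ++ B) X i

    different-reflects : ∀ P {u X rs} i j →
      Reflects (i ∈ P → j ∈ P → i ≢ j → lookup (C ++ B) i ≢ lookup (C ++ B) j) (⟦ different P i j ⟧ᵗ (cells′ u C B X & rs))
    different-reflects P {u} {X} {rs} i j = go (lookup P i) (lookup P j) refl refl (i Fin.≟ j)
      where
      go : ∀ a b → lookup P i ≡ a → lookup P j ≡ b → (d : Dec (i ≡ j)) →
        Reflects (i ∈ P → j ∈ P → i ≢ j → lookup (C ++ B) i ≢ lookup (C ++ B) j)
          (⟦ if a ∧ b ∧ not ⌊ d ⌋ then negate (same (cb i) (cb j)) else always ⟧ᵗ (cells′ u C B X & rs))
      go false b     eq eq′ d         = ofʸ λ i∈ → contradiction (trans (sym ([]=⇒lookup i∈)) eq) λ ()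
      go true  false eq eq′ d         = ofʸ λ _ j∈ → contradiction (trans (sym ([]=⇒lookup j∈)) eq′) λ ()
      go true  true  eq eq′ (yes i≡j) = ofʸ λ _ _ i≢j → contradiction i≡j i≢j
      go true  true  eq eq′ (no i≢j)  = reflects-map
        (λ ne _ _ _ e → ne (trans (lookup-cb u X i) (trans e (sym (lookup-cb u X j)))))
        (λ ne e → ne (lookup⇒[]= i P eq) (lookup⇒[]= j P eq′) i≢j (trans (sym (lookup-cb u X i)) (trans e (lookup-cb u X j))))
        (¬-reflects (isYes-reflects _))

    contents-CB : ∀ u X P → contents (cells′ u C B X) (false ∷ false ∷ (P ++ ⊥ {K})) ≡ contents (C ++ B) P
    contents-CB u X P = trans (contents-false u _ (false ∷ (P ++ ⊥ {K})))
      (trans (contents-++ (C ++ B) X P ⊥) (trans (cong (contents (C ++ B) P ∪_) (contents-⊥ X)) (∪-identityʳ _)))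

    pick-correct : ∀ P u X rs → ⟦ forEach K (λ i → copy (source P i) (inX i)) ⟧ (cells′ u C B X & rs)
      ≡ (cells′ u C B (picked K (C ++ B) P) & rs)
    pick-correct P u X rs = forEach-fills K (λ X → cells′ u C B X & rs) _ _
      (λ i X → cong (_& rs) (trans (cong (cells′ u C B X [ inX i ]≔_) (lookup-source i X)) (set-inX u C B X i _))) X
      where
      lookup-source : ∀ i X → lookup (cells′ u C B X) (source P i) ≡ maybe′ (lookup (C ++ B)) nothing (ith P (toℕ i))
      lookup-source i X with ith P (toℕ i)
      ... | just j  = lookup-cb u X j
      ... | nothing = refl

    TryResult : Subset CB → Cells n K → Memory → Set
    TryResult P X σ = ∃[ X′ ] Trying X′ σ × ((X′ ≡ X × ¬ Admissible P) ⊎ Successful X′)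

    try-correct : ∀ P {X σ} → Trying X σ → TryResult P X (⟦ try t P ⟧ σ)
    try-correct P {X} (trying u t₀ t₁ t₂ t₄ t₅) = go ⌊ ∣ P ∣ ℕ.≤? K ⌋ (isYes-reflects (∣ P ∣ ℕ.≤? K))
      where
      xs = cells′ u C B X
      E = 𝔼 (map frac (candidate t P)) (λ Q → f (contents xs Q))
      test : Test
      test = indep (false ∷ false ∷ (P ++ ⊥ {K})) and (allDifferent P and atMost r₃ r₀)
      found = forEach K (λ i → copy (source P i) (inX i))
      decide : ∀ {t₁ t₂} b → ∣ P ∣ ℕ.≤ K → Reflects (Independent (contents (C ++ B) P) × Different P × target ≤ E) b →
        TryResult P X (if b then ⟦ found ⟧ (xs & E ∷ t₁ ∷ t₂ ∷ target ∷ t₄ ∷ t₅ ∷ w) else (xs & E ∷ t₁ ∷ t₂ ∷ target ∷ t₄ ∷ t₅ ∷ w))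
      decide {t₁} {t₂} true P≤K (ofʸ (ind , diff , le)) = picked K (C ++ B) P
        , subst (Trying _) (sym (pick-correct P u X _)) (trying u E t₁ t₂ t₄ t₅)
        , inj₂ ( picked-distinct K (C ++ B) P (different⇒distinct diff)
               , subst Independent (sym same-contents) ind
               , subst (target ≤_) (trans (𝔼-candidate 0<T t {C} {B} u X P (different⇒distinct diff)) (cong (φ (suc t)) (sym same-contents))) le )
        where
        same-contents : contents (picked K (C ++ B) P) ⊤ ≡ contents (C ++ B) P
        same-contents = contents-picked K (C ++ B) P P≤K
      decide {t₁} {t₂} false P≤K (ofⁿ ¬p) = X , trying u E t₁ t₂ t₄ t₅ , inj₁ (refl , λ (_ , ind , diff , le) →
        ¬p (ind , diff , subst (target ≤_) (sym (𝔼-candidate 0<T t {C} {B} u X P (different⇒distinct diff))) le))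
      go : ∀ b → Reflects (∣ P ∣ ℕ.≤ K) b →
        TryResult P X (⟦ if b then attempt t P else skip ⟧
          (xs & t₀ ∷ t₁ ∷ t₂ ∷ target ∷ t₄ ∷ t₅ ∷ w))
      go false (ofⁿ P≰K) = X , trying u t₀ t₁ t₂ t₄ t₅ , inj₁ (refl , λ (P≤K , _) → P≰K P≤K)
      go true  (ofʸ P≤K) =
        let (t₁′ , t₂′ , eq) = expectedValue-correct 0<T (candidate t P) (candidate-≤ P) xs t₀ t₁ t₂ (target ∷ t₄ ∷ t₅ ∷ w)
            σ′ = xs & E ∷ t₁′ ∷ t₂′ ∷ target ∷ t₄ ∷ t₅ ∷ w
        in subst (TryResult P X) (cong ⟦ ifte test found skip ⟧ (sym eq)) (decide (⟦ test ⟧ᵗ σ′) P≤K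
          (reflects-map (subst Independent (contents-CB u X P)) (subst Independent (sym (contents-CB u X P))) (isYes-reflects (Independent? _))
            ×-reflects allOf-reflects CB (λ i → allOf-reflects CB (different-reflects P {u} {X} i))
            ×-reflects isYes-reflects (target ≤? E)))

    -- The search cannot fail: the merged set lies in C ∪ B, and choosing one cell for each of its
    -- elements gives at most K cells because it is independent.
    admissible-exists : ∃ Admissible
    admissible-exists =
      let (E , E-independent , E⊆ , better) = Merging.merge ℛ matroid f-submodular (0≤frac t) (0≤frac 1)
            (subst (_≤ 1#) (frac-suc t) (proj₂ (frac-probability t<T))) C-independent B-independent
          (P , P≡E , distinct , filled) = select-cells (C ++ B) {E} (subst (E ⊆_) (sym all) E⊆)
      in P , ℕ.≤-trans (∣P∣≤∣contents∣ (C ++ B) P distinct filled) (subst (λ Z → ∣ Z ∣ ℕ.≤ K) (sym P≡E) (proj₂ rank E E-independent))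
         , subst Independent (sym P≡E) E-independent
         , (λ i j i∈ j∈ i≢j eq → differ distinct filled i∈ j∈ i≢j (lookup (C ++ B) i) refl eq)
         , subst₂ (λ q Z → target ≤ 𝔼 (q ▸ Z) f) (sym (frac-suc t)) (sym P≡E) better
      where
      all : contents (C ++ B) ⊤ ≡ contents C ⊤ ∪ contents B ⊤
      all = trans (cong (contents (C ++ B)) (sym (replicate-++ K K true))) (contents-++ C B ⊤ ⊤)
      differ : ∀ {P i j} → Distinct (C ++ B) P → (∀ {i} → i ∈ P → lookup (C ++ B) i ≢ nothing) → i ∈ P → j ∈ P → i ≢ j →
        ∀ x → lookup (C ++ B) i ≡ x → lookup (C ++ B) i ≢ lookup (C ++ B) j
      differ distinct filled i∈ j∈ i≢j nothing  eq e = filled i∈ eq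
      differ distinct filled i∈ j∈ i≢j (just x) eq e = i≢j (distinct i∈ j∈ eq (trans (sym e) eq))

    combine-correct : ∀ {X σ} → Layout C B X w σ → ∃[ C′ ] Layout C′ B C′ w (⟦ combine t ⟧ σ) × Successful C′
    combine-correct {X} (layout u t₀ t₁ t₂ t₃ t₄ t₅) =
      let (_ , t₂′ , eq) = expectedValue-correct 0<T (current t) (current-≤ (ℕ.<⇒≤ t<T)) xs t₀ t₁ t₂ (t₃ ∷ t₄ ∷ t₅ ∷ w)
          (P , admissible) = admissible-exists
          (_ , _ , reach) = forSubsets-reaches CB {try t} (λ σ → ∃[ X ] Trying X σ) (λ σ → ∃[ X ] Trying X σ × Successful X)
            (λ P σ (X , l) → let (X′ , l′ , _) = try-correct P l in X′ , l′)
            (λ P σ _ (X , l , success) → let (X′ , l′ , o) = try-correct P l in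
              X′ , l′ , [ (λ (X′≡X , _) → subst Successful (sym X′≡X) success) , (λ s → s) ]′ o)
          (X′ , l , success) = reach P
            (λ σ (X , l) → let (X′ , l′ , o) = try-correct P l in
              X′ , l′ , [ (λ (_ , ¬adm) → contradiction admissible ¬adm) , (λ s → s) ]′ o)
            (xs & e₀ ∷ 0# ∷ t₂′ ∷ target ∷ t₄ ∷ t₅ ∷ w) (X , trying u e₀ 0# t₂′ t₄ t₅)
      in X′ , subst (Layout X′ B X′ w) (cong (⟦ finish ⟧ ∘ ⟦ forSubsets CB (try t) ⟧) (sym (trans (cong ⟦ move r₀ r₃ ⟧ eq)
                (cong (λ x → xs & e₀ ∷ 0# ∷ t₂′ ∷ x ∷ t₄ ∷ t₅ ∷ w) (trans (+-identityʳ e₀) (𝔼-current 0<T t {C} {B} u X C-distinct B-distinct))))))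
              (copied l)
         , success
      where
      xs = cells′ u C B X
      e₀ = 𝔼 (map frac (current t)) (λ P → f (contents xs P))
      finish = forEach K (λ i → copy (inX i) (inC i))
      copied : ∀ {X σ} → Trying X σ → Layout X B X w (⟦ finish ⟧ σ)
      copied {X} (trying u t₀ t₁ t₂ t₄ t₅) = subst (Layout X B X w) (sym (trans
        (forEach-fills K (λ C → cells′ u C B X & rest) _ (lookup X)
          (λ i C → cong (_& rest) (trans (cong (cells′ u C B X [ inC i ]≔_) (lookup-++ʳ (C ++ B) X i)) (set-inC u C B X i _))) C)
        (cong (λ C → cells′ u C B X & rest) (tabulate∘lookup X)))) (layout u t₀ t₁ t₂ target t₄ t₅)
        where rest = t₀ ∷ t₁ ∷ t₂ ∷ target ∷ t₄ ∷ t₅ ∷ w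

  -- Iteration over the passes

  wp-mono : ∀ P {L L′ : Memory → ℕ → Set} → (∀ σ p → L σ p → L′ σ p) → ∀ σ p → wp P L σ p → wp P L′ σ p
  wp-mono (run c)    le σ p h = le _ _ h
  wp-mono (pass a c) le σ p h = λ i → le _ _ (h i)
  wp-mono (P then Q) le σ p h = wp-mono P (wp-mono Q le) σ p h

  Progress : ℕ → Memory → ℕ → Set
  Progress t σ p = ∃[ C ] ∃[ B ] ∃[ X ] ∃[ w ] Layout C B X w σ × p ≡ t × Distinct C ⊤ × Independent (contents C ⊤)
    × (∀ O → Independent O → f O - φ t (contents C ⊤) ≤ (1# - z) ^ t * f O)

  -- Here o is the value to be reached, q the value before the pass, h the value after it and p the
  -- value after merging. The gain gives o - h ≤ (1 - z) (o - q).
  gap-shrinks : ∀ {r o q h p} → o - q ≤ r * o → o - q ≤ N * (h - q) → h ≤ p → o - p ≤ (1# - z) * r * o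
  gap-shrinks {r} {o} {q} {h} {p} gap gain h≤p = ≤-by
    (+-nonneg (*-nonneg (0≤y-x z≤1) (0≤y-x gap)) (+-nonneg (*-nonneg 0≤z (0≤y-x gain)) (0≤y-x h≤p)))
    (trans (solve 7 (λ z N r o q h p →
        ((:1 :- z) :* (r :* o :- (o :- q)) :+ (z :* (N :* (h :- q) :- (o :- q)) :+ (p :- h)))
        := ((:1 :- z) :* r :* o :- (o :- p)) :+ (N :* z :- :1) :* (h :- q)) refl z N r o q h p)
      (trans (cong (λ c → ((1# - z) * r * o - (o - p)) + (c - 1#) * (h - q)) N*z≡1)
        (solve 2 (λ a b → a :+ (:1 :- :1) :* b := a) refl _ (h - q))))

  round-correct : ∀ {t} → t ℕ.< T → ∀ σ p → Progress t σ p →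
    wp (run reset then pass arriving (process t) then run (combine t)) (Progress (suc t)) σ p
  round-correct {t} t<T σ p (C , B , X , w , l , refl , C-distinct , C-independent , gap) i =
    let (B′ , w′ , l′ , B-distinct , B-independent , gain) = pass-correct (ℕ.<⇒≤ t<T) {C} C-distinct i l
        (C′ , l″ , C′-distinct , C′-independent , better) = combine-correct t<T {C} {B′} C-distinct B-distinct C-independent B-independent l′
    in C′ , B′ , C′ , w′ , l″ , refl , C′-distinct , C′-independent
       , λ O O-independent → gap-shrinks (gap O O-independent) (gain O O-independent) better

  initial-memory : Memory
  initial-memory = replicate slots nothing & replicate registers 0#

  rounds-correct : ∀ t → t ℕ.≤ T → wp (rounds t) (Progress t) initial-memory 0
  rounds-correct zero t≤T = none , none , none , replicate K 0#
    , subst (λ xs → Layout none none none (replicate K 0#) (nothing ∷ nothing ∷ xs & replicate registers 0#))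
        (trans (cong (_++ none) (replicate-++ K K nothing)) (replicate-++ CB K nothing)) (layout nothing 0# 0# 0# 0# 0# 0#)
    , refl , (λ {i} _ _ eq _ → contradiction (trans (sym (lookup-replicate i nothing)) eq) λ ())
    , subst Independent (sym (contents-nothing K ⊤)) ∅-independent
    -- At rate 0 the sample is empty, so the initial value is f ⊥, and being non-negative it leaves
    -- a gap of at most f O.
    , λ O _ → ≤-by (nonneg (contents none ⊤)) (trans (solve 2 (λ a b → a := :1 :* b :- (b :- a)) refl (f (contents none ⊤)) (f O))
        (cong (λ x → 1# * f O - (f O - x)) (trans (cong f (contents-nothing K ⊤))
          (trans (sym (𝔼-0▸ (contents none ⊤) f)) (cong (λ q → 𝔼 (q ▸ contents none ⊤) f) (sym frac-0))))))
    where
    none : Cells n K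
    none = replicate K nothing
  rounds-correct (suc t) t<T = wp-mono (rounds t) (round-correct t<T) initial-memory 0 (rounds-correct t (ℕ.<⇒≤ t<T))

  solution-correct : wp (rounds T) (λ σ p → p ≡ T × Independent (contents (cellsOf σ) solution)
    × (∀ O → Independent O → f O - f (contents (cellsOf σ) solution) ≤ (1# - z) ^ T * f O)) initial-memory 0
  solution-correct = wp-mono (rounds T) finished initial-memory 0 (rounds-correct T ℕ.≤-refl)
    where
    finished : ∀ σ p → Progress T σ p → p ≡ T × Independent (contents (cellsOf σ) solution)
      × (∀ O → Independent O → f O - f (contents (cellsOf σ) solution) ≤ (1# - z) ^ T * f O)
    finished _ p (C , B , X , w , layout u t₀ t₁ t₂ t₃ t₄ t₅ , p≡T , _ , C-independent , gap) =
      p≡T , subst Independent (sym C≡) C-independent , λ O O-independent →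
        -- After T passes the sampling rate is 1, and the random set is C itself.
        subst (λ x → f O - x ≤ (1# - z) ^ T * f O)
          (trans (cong (λ q → 𝔼 (q ▸ contents C ⊤) f) frac-T) (trans (𝔼-1▸ (contents C ⊤) f) (cong f (sym C≡)))) (gap O O-independent)
      where
      C≡ : contents (cells′ u C B X) solution ≡ contents C ⊤
      C≡ = trans (contents-false u _ (false ∷ ((⊤ {K} ++ ⊥ {K}) ++ ⊥ {K})))
        (trans (contents-++ (C ++ B) X (⊤ {K} ++ ⊥ {K}) ⊥) (trans (cong₂ _∪_ (contents-++ C B ⊤ ⊥) (contents-⊥ X))
          (trans (∪-identityʳ _) (trans (cong (contents C ⊤ ∪_) (contents-⊥ B)) (∪-identityʳ _)))))

-- Space

module SolverSize (m K : ℕ) where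
  open Solver m K

  valueBits processBits tryBits searchBits roundBits : ℕ
  valueBits   = 2 ℕ.+ (slots ℕ.+ 3)
  processBits = 8 ℕ.+ (valueBits ℕ.+ (K ℕ.* 2 ℕ.+ (2 ℕ.+ (K ℕ.+ 1))))
  tryBits     = suc (valueBits ℕ.+ (2 ℕ.+ ((2 ℕ.+ (CB ℕ.+ (CB ℕ.+ 0))) ℕ.+ (K ℕ.+ 0))))
  searchBits  = CB ℕ.+ tryBits ℕ.+ (K ℕ.+ 0)
  roundBits   = 2 ℕ.+ (suc (K ℕ.+ 0) ℕ.+ ((2 ℕ.+ processBits) ℕ.+ (3 ℕ.+ searchBits)))

  fits-expectedValue : ∀ as → Fits valueBits (Position (expectedValue as))
  fits-expectedValue as = fits-⊎ fits-Unit (fits-⊎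
    (fits-forSubsets slots {accumulate as} (λ P → fits-⊎ fits-Unit (fits-⊎ fits-Unit (fits-⊎ fits-Unit fits-Unit))))
    (fits-⊎ fits-Unit fits-Unit))

  fits-move : ∀ {b} → Fits (suc b) (Position (move r₀ r₀))
  fits-move = fits-⊎ fits-Unit fits-Unit

  fits-eligible : ∀ i → Fits (2 ℕ.+ (K ℕ.+ 1)) (TestPosition (eligible i))
  fits-eligible i = fits-⊎ fits-Unit (fits-⊎ fits-Unit
    (fits-allOf K {λ j → negate (indep (exchanged j) and negate (atMost (weightOf i) (weightOf j)))} (λ j → fits-⊎ fits-Unit fits-Unit)))

  fits-process : ∀ t → Fits processBits (Position (process t))
  fits-process t = fits-⊎ (fits-≤ (ℕ.≤-trans (ℕ.m≤m+n _ _) (ℕ.m≤n+m _ 7)) (fits-expectedValue (current t)))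
    (fits-⊎ fits-move
    (fits-⊎ (fits-≤ (ℕ.≤-trans (ℕ.m≤m+n _ _) (ℕ.m≤n+m _ 5)) (fits-expectedValue (withArriving t)))
    (fits-⊎ fits-Unit (fits-⊎ fits-Unit (fits-⊎ fits-Unit (fits-⊎ fits-Unit (fits-⊎ fits-Unit
    (fits-≤ (ℕ.m≤n+m _ valueBits) (fits-firstOf K {eligible} {place} fits-eligible (λ i → fits-⊎ fits-Unit fits-move))))))))))

  fits-allDifferent : ∀ P → Fits (CB ℕ.+ (CB ℕ.+ 0)) (TestPosition (allDifferent P))
  fits-allDifferent P = fits-allOf CB {λ i → allOf CB (different P i)} (λ i → fits-allOf CB {different P i}
    (λ j → pair (lookup P i ∧ lookup P j ∧ not ⌊ i Fin.≟ j ⌋)))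
    where
    pair : ∀ b {i j} → Fits 0 (TestPosition (if b then negate (same (cb i) (cb j)) else always))
    pair true  = fits-Unit
    pair false = fits-Empty

  fits-try : ∀ t P → Fits tryBits (Position (try t P))
  fits-try t P = guarded ⌊ ∣ P ∣ ℕ.≤? K ⌋
    where
    search = fits-branch
      (fits-≤ (ℕ.m≤m+n _ (K ℕ.+ 0)) (fits-⊎ fits-Unit (fits-⊎ (fits-allDifferent P) fits-Unit)))
      (fits-≤ (ℕ.m≤n+m _ (2 ℕ.+ (CB ℕ.+ (CB ℕ.+ 0)))) (fits-forEach K {λ i → copy (source P i) (inX i)} (λ i → fits-Unit)))
      fits-Empty
    guarded : ∀ b → Fits tryBits (Position (if b then attempt t P else skip))
    guarded true  = fits-⊎ (fits-≤ (ℕ.m≤m+n _ _) (fits-expectedValue (candidate t P))) (fits-≤ (ℕ.m≤n+m _ valueBits) search)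
    guarded false = fits-Empty

  fits-round : ∀ t → Fits roundBits (ProgramPosition (run reset then pass arriving (process t) then run (combine t)))
  fits-round t = fits-⊎ (fits-≤ (ℕ.≤-trans (ℕ.m≤m+n _ _) (ℕ.n≤1+n _)) fits-reset)
    (fits-⊎ (fits-≤ (ℕ.≤-trans (ℕ.m≤m+n _ _) (ℕ.m≤n+m _ (suc (K ℕ.+ 0)))) (fits-pass {a = arriving} {process t} (fits-process t)))
      (fits-≤ (ℕ.≤-trans (ℕ.m≤n+m _ (2 ℕ.+ processBits)) (ℕ.m≤n+m _ (suc (K ℕ.+ 0)))) fits-combine))
    where
    fits-reset : Fits (suc (K ℕ.+ 0)) (Position reset)
    fits-reset = fits-⊎ (fits-forEach K {λ i → copy empty (inB i)} (λ i → fits-Unit)) (fits-forEach K {λ i → constant 0 (weightOf i)} (λ i → fits-Unit))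
    fits-combine : Fits (3 ℕ.+ searchBits) (Position (combine t))
    fits-combine = fits-⊎ (fits-≤ (ℕ.≤-trans (ℕ.≤-trans (ℕ.≤-trans (ℕ.m≤m+n _ _) (ℕ.n≤1+n _)) (ℕ.m≤n+m tryBits CB)) (ℕ.≤-trans (ℕ.m≤m+n _ _) (ℕ.m≤n+m searchBits 2)))
        (fits-expectedValue (current t)))
      (fits-⊎ fits-move (fits-⊎
        (fits-≤ (ℕ.m≤m+n _ (K ℕ.+ 0)) (fits-forSubsets CB {try t} (fits-try t)))
        (fits-≤ (ℕ.m≤n+m _ (CB ℕ.+ tryBits)) (fits-forEach K {λ i → copy (inX i) (inC i)} (λ i → fits-Unit)))))

  -- The passes are unrolled too, at one bit each. Their number depends on ε alone, hence is a
  -- constant in the space bound.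
  fits-rounds : ∀ t → Fits (t ℕ.+ roundBits) (ProgramPosition (rounds t))
  fits-rounds zero    = fits-Empty
  fits-rounds (suc t) = fits-⊎ (fits-rounds t) (fits-≤ (ℕ.m≤n+m roundBits t) (fits-round t))

  roundBits≡ : roundBits ≡ 38 ℕ.+ 18 ℕ.* K
  roundBits≡ = solve 1 (λ K →
      let CB = K :+ K
          slots = con 2 :+ (CB :+ K)
          valueBits = con 2 :+ (slots :+ con 3)
          processBits = con 8 :+ (valueBits :+ (K :* con 2 :+ (con 2 :+ (K :+ con 1))))
          tryBits = con 1 :+ (valueBits :+ (con 2 :+ ((con 2 :+ (CB :+ (CB :+ con 0))) :+ (K :+ con 0))))
          searchBits = CB :+ tryBits :+ (K :+ con 0)
      in con 2 :+ (con 1 :+ (K :+ con 0) :+ ((con 2 :+ processBits) :+ (con 3 :+ searchBits))) := con 38 :+ con 18 :* K) refl K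
    where open +-*-Solver

  machine : Machine
  machine = compile (rounds T) (fits-rounds T) solution

slots≤ : ∀ m k → Solver.slots m (suc k) ℕ.≤ 5 ℕ.* suc k
slots≤ m k = ℕ.≤-trans (ℕ.m≤m+n _ (k ℕ.+ k)) (ℕ.≤-reflexive
  (solve 1 (λ k → con 2 :+ ((con 1 :+ k :+ (con 1 :+ k)) :+ (con 1 :+ k)) :+ (k :+ k) := con 5 :* (con 1 :+ k)) refl k))
  where open +-*-Solver

1≤⌈log₂⌉ : ∀ {n} → 2 ℕ.≤ n → 1 ℕ.≤ ⌈log₂ n ⌉
1≤⌈log₂⌉ 2≤n = ⌈log₂⌉-mono-≤ 2≤n

-- For positive rank K the additive constants are absorbed: 5 K cells, 7 K registers and (57 + T) K
-- bits, where 5 + 7 + 57 = 69.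
space≤ : ∀ m k n → 2 ℕ.≤ n → Machine.space (SolverSize.machine m (suc k)) n ℕ.≤ (69 ℕ.+ m ℕ.* m) ℕ.* (suc k ℕ.* ⌈log₂ n ⌉ ℕ.^ 1)
space≤ m k n 2≤n = begin
  slots ℕ.* L ℕ.+ registers ℕ.+ suc (T ℕ.+ roundBits)
    ≤⟨ ℕ.+-mono-≤ (ℕ.+-mono-≤ (ℕ.*-monoˡ-≤ L (slots≤ m k)) registers≤) bits≤ ⟩
  5 ℕ.* K ℕ.* L ℕ.+ 7 ℕ.* K ℕ.+ (57 ℕ.+ T) ℕ.* K
    ≤⟨ ℕ.+-mono-≤ (ℕ.+-monoʳ-≤ (5 ℕ.* K ℕ.* L) (grow (7 ℕ.* K))) (grow ((57 ℕ.+ T) ℕ.* K)) ⟩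
  5 ℕ.* K ℕ.* L ℕ.+ 7 ℕ.* K ℕ.* L ℕ.+ (57 ℕ.+ T) ℕ.* K ℕ.* L
    ≡⟨ solve 3 (λ K L T → con 5 :* K :* L :+ con 7 :* K :* L :+ (con 57 :+ T) :* K :* L := (con 69 :+ T) :* (K :* (L :* con 1))) refl K L T ⟩
  (69 ℕ.+ T) ℕ.* (K ℕ.* L ℕ.^ 1) ∎
  where
  open ℕ.≤-Reasoning
  open +-*-Solver
  open Solver m (suc k) using (slots; registers; T)
  open SolverSize m (suc k) using (roundBits; roundBits≡)
  K = suc k
  L = ⌈log₂ n ⌉
  grow : ∀ a → a ℕ.≤ a ℕ.* L
  grow a = ℕ.≤-trans (ℕ.≤-reflexive (sym (ℕ.*-identityʳ a))) (ℕ.*-monoʳ-≤ a (1≤⌈log₂⌉ 2≤n))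
  registers≤ : registers ℕ.≤ 7 ℕ.* K
  registers≤ = ℕ.≤-trans (ℕ.m≤m+n _ (6 ℕ.* k)) (ℕ.≤-reflexive
    (solve 1 (λ k → con 6 :+ (con 1 :+ k) :+ con 6 :* k := con 7 :* (con 1 :+ k)) refl k))
  bits≤ : suc (T ℕ.+ roundBits) ℕ.≤ (57 ℕ.+ T) ℕ.* K
  bits≤ = ℕ.≤-trans (ℕ.≤-reflexive (cong (λ b → suc (T ℕ.+ b)) roundBits≡)) (ℕ.≤-trans (ℕ.m≤m+n _ ((39 ℕ.+ T) ℕ.* k)) (ℕ.≤-reflexive
    (solve 2 (λ k T → con 1 :+ (T :+ (con 38 :+ con 18 :* (con 1 :+ k))) :+ (con 39 :+ T) :* k := (con 57 :+ T) :* (con 1 :+ k)) refl k T)))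

-- The guarantee

Surely-map : ∀ {A} {P Q : A → Set} {d} → (∀ {a} → P a → Q a) → Surely P d → Surely Q d
Surely-map imp (return p)  = return (imp p)
Surely-map imp (uniform s) = uniform (λ i → Surely-map imp (s i))

-- Outputs the empty set in no space at all. It serves rank 0, where the space bound is 0, and large
-- ε, where the required ratio is at most 0.
trivialMachine : Machine
trivialMachine = record
  { slots = 0 ; registers = 0 ; bits = 0 ; State = Unit ; encode = fits-Unit ; start = tt ; program = λ _ → output [] }

module Guarantees (ℛ : CompleteOrderedField) where
  open CompleteOrderedField ℛ
  open ExpLog ℛ
  open Streaming ℛ
  open OrderedFieldProperties ℛ
  open ExpLogBounds ℛ
  open Majorization ℛ using (nonempty⇒0<∣∣)

  sum-≥ : ∀ {m c} (v : Fin m → ℝ) → (∀ i → c ≤ v i) → fromℕ m * c ≤ sum v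
  sum-≥ {zero}      v le = ≤-reflexive (zeroˡ _)
  sum-≥ {suc m} {c} v le = subst (_≤ sum v) (solve 2 (λ m c → c :+ m :* c := (:1 :+ m) :* c) refl (fromℕ m) c)
    (+-mono-≤ (le zero) (sum-≥ (v ∘ suc) (le ∘ suc)))

  Surely⇒expectation≥ : ∀ {A} {h : A → ℝ} {c} {d : Dist A} → Surely (λ a → c ≤ h a) d → c ≤ expectation h d
  Surely⇒expectation≥ (return p) = p
  Surely⇒expectation≥ {h = h} {c} {uniform m g} (uniform s) =
    subst (_≤ expectation h (uniform m g))
      (trans (solve 3 (λ m c i → m :* c :* i := (m :* i) :* c) refl (fromℕ m) c _)
        (trans (cong (_* c) (⁻¹-inverseʳ (fromℕ m) (fromℕ≢0 m))) (*-identityˡ c)))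
      (*-monoʳ-≤ (⁻¹-nonneg (0≤fromℕ m) (fromℕ≢0 m)) (sum-≥ (λ i → expectation h (g i)) (λ i → Surely⇒expectation≥ (s i))))

  trivial-guarantee : ∀ {n k p r} (I : Instance n k) → let open Instance I in (∀ {O} → IsOptimal O → r * f O ≤ f ⊥) →
    ∃[ d ] Execution.OutputDistribution I trivialMachine d
         × Surely (λ o → Outcome.passes o ℕ.≤ p) d
         × Surely (λ o → Independent (Outcome.solution o)) d
         × (∀ OPT → IsOptimal OPT → r * f OPT ≤ expectation (λ o → f (Outcome.solution o)) d)
  trivial-guarantee I enough = return (outcome ⊥ 0) , Execution.next Execution.halted , return ℕ.z≤n
    , return (Instance.∅-independent I) , λ OPT → enough

  rank-0 : ∀ {n} (I : Instance n 0) → let open Instance I in ∀ {O} → Independent O → f O ≤ f ⊥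
  rank-0 {n} I {O} iO = Instance.monotone I {O} {⊥} λ x∈O → contradiction (proj₂ (Instance.rank I) O iO) (ℕ.<⇒≱ (nonempty⇒0<∣∣ x∈O))

  bernoulli : ∀ {z} → 0# ≤ z → z ≤ 1# → ∀ n → 1# - fromℕ n * z ≤ (1# - z) ^ n
  bernoulli {z} 0≤z z≤1 zero    = ≤-reflexive (solve 1 (λ z → :1 :- :0 :* z := :1) refl z)
  bernoulli {z} 0≤z z≤1 (suc n) = ≤-by
    (+-nonneg (*-nonneg (0≤y-x z≤1) (0≤y-x (bernoulli 0≤z z≤1 n))) (*-nonneg (0≤fromℕ n) (*-nonneg 0≤z 0≤z)))
    (solve 3 (λ z n r → (:1 :- z) :* (r :- (:1 :- n :* z)) :+ n :* (z :* z)
       := (:1 :- z) :* r :- (:1 :- (:1 :+ n) :* z)) refl z (fromℕ n) ((1# - z) ^ n))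

  ^≤1 : ∀ {x} n → 0# ≤ x → x ≤ 1# → x ^ n ≤ 1#
  ^≤1 zero    0≤x x≤1 = ≤-refl
  ^≤1 (suc n) 0≤x x≤1 = ≤-trans (*-monoˡ-≤ 0≤x (^≤1 n 0≤x x≤1)) (≤-trans (≤-reflexive (*-identityʳ _)) x≤1)

  -- The number of rounds m² is smaller than N = (1 + m)² by 2 m + 1, which costs
  -- at most (2 m + 1) / N ≤ ε.
  decay : ∀ {ε} m → 1 ℕ.≤ m → fromℕ 2 ≤ ε * fromℕ m → 0# ≤ ε → let μ = fromℕ m in
    (1# - ((1# + μ) * (1# + μ)) ⁻¹) ^ (m ℕ.* m) ≤ e ⁻¹ + ε
  decay {ε} m@(suc m′) 1≤m 2≤εm 0≤ε = ≤-by
    (+-nonneg (0≤y-x zN≤e⁻¹) (+-nonneg (*-nonneg 0≤r (0≤y-x (bernoulli 0≤z z≤1 (suc (m ℕ.+ m)))))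
      (+-nonneg (*-nonneg (0≤y-x r≤1) (*-nonneg (0≤fromℕ (suc (m ℕ.+ m))) 0≤z)) (0≤y-x loss))))
    (solve 5 (λ E r s c ε → (E :- r :* s) :+ (r :* (s :- (:1 :- c)) :+ ((:1 :- r) :* c :+ (ε :- c))) := (E :+ ε) :- r) refl
      (e ⁻¹) r ((1# - z) ^ suc (m ℕ.+ m)) (fromℕ (suc (m ℕ.+ m)) * z) ε)
    where
    μ = fromℕ m
    0≤μ : 0# ≤ μ
    0≤μ = 0≤fromℕ m
    open DecayRate ℛ μ 0≤μ
    r = (1# - z) ^ (m ℕ.* m)
    z<1 : z < 1#
    z<1 = z≤1 , λ z≡1 → 0<⇒≢0 0<1 (antisym (≤-trans (1≤fromℕ-suc m′) (≤-by (+-nonneg 0≤μ (*-nonneg 0≤μ 0≤μ))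
      (trans (solve 1 (λ μ → μ :+ μ :* μ := ((:1 :+ μ) :* (:1 :+ μ) :- :1) :- μ) refl μ)
        (trans (cong (λ x → (x - 1#) - μ) (trans (sym (*-identityʳ N)) (trans (cong (N *_) (sym z≡1)) N*z≡1)))
          (solve 1 (λ μ → (:1 :- :1) :- μ := :0 :- μ) refl μ))))) 0≤1)
    0≤r : 0# ≤ r
    0≤r = ^-nonneg (m ℕ.* m) (0≤y-x z≤1)
    r≤1 : r ≤ 1#
    r≤1 = ^≤1 (m ℕ.* m) (0≤y-x z≤1) (≤-by 0≤z (solve 1 (λ z → z := :1 :- (:1 :- z)) refl z))
    fromℕ-N : fromℕ (m ℕ.* m ℕ.+ suc (m ℕ.+ m)) ≡ N
    fromℕ-N = trans (fromℕ-+ (m ℕ.* m) (suc (m ℕ.+ m))) (trans (cong₂ (λ a b → a + (1# + b)) (fromℕ-* m m) (fromℕ-+ m m))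
      (solve 1 (λ μ → μ :* μ :+ (:1 :+ (μ :+ μ)) := (:1 :+ μ) :* (:1 :+ μ)) refl μ))
    zN≤e⁻¹ : r * (1# - z) ^ suc (m ℕ.+ m) ≤ e ⁻¹
    zN≤e⁻¹ = subst (_≤ e ⁻¹) (^-+ (1# - z) (m ℕ.* m) (suc (m ℕ.+ m)))
      ([1-1/m]^m≤e⁻¹ 0≤z z<1 (m ℕ.* m ℕ.+ suc (m ℕ.+ m)) (trans (cong (_* z) fromℕ-N) N*z≡1))
    loss : fromℕ (suc (m ℕ.+ m)) * z ≤ ε
    loss = *-cancelˡ-≤ 0<N (subst (_≤ N * ε)
      (trans (sym (*-identityʳ _)) (trans (cong (fromℕ (suc (m ℕ.+ m)) *_) (sym N*z≡1)) (solve 3 (λ c N z → c :* (N :* z) := N :* (c :* z)) refl (fromℕ (suc (m ℕ.+ m))) N z)))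
      (subst (_≤ N * ε) (cong (1# +_) (sym (fromℕ-+ m m)))
        (≤-by (+-nonneg (+-nonneg (*-nonneg 0≤μ (0≤y-x 2≤εm)) (*-nonneg (0≤fromℕ 2) (0≤y-x 2≤εm))) (+-nonneg 0≤ε (0≤fromℕ 3)))
          (solve 2 (λ μ ε → (μ :* (ε :* μ :- con (pos 2)) :+ con (pos 2) :* (ε :* μ :- con (pos 2))) :+ (ε :+ con (pos 3))
             := (:1 :+ μ) :* (:1 :+ μ) :* ε :- (:1 :+ (μ :+ μ))) refl μ ε))))

  algorithm : ℕ → Algorithm
  algorithm m n zero    = trivialMachine
  algorithm m n (suc k) = SolverSize.machine m (suc k)

  algorithm-semiStreaming : ∀ m → SemiStreaming (algorithm m)
  algorithm-semiStreaming m = 69 ℕ.+ m ℕ.* m , 1 , λ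
    { n zero    2≤n → ℕ.z≤n
    ; n (suc k) 2≤n → space≤ m k n 2≤n }

  module _ {ε} (0<ε : 0# < ε) where
    private
      ε⁻¹ = ε ⁻¹

    rate≤1 : 1# - e ⁻¹ - ε ≤ 1#
    rate≤1 = ≤-by (+-nonneg 0≤e⁻¹ (proj₁ 0<ε)) (solve 2 (λ E ε → E :+ ε := :1 :- ((:1 :- E) :- ε)) refl (e ⁻¹) ε)

    rank-0-guarantee : ∀ {n} (I : Instance n 0) → let open Instance I in ∀ {O} → IsOptimal O → (1# - e ⁻¹ - ε) * f O ≤ f ⊥
    rank-0-guarantee I {O} (iO , _) = ≤-trans (*-monoʳ-≤ (Instance.nonneg I O) rate≤1)
      (≤-trans (≤-reflexive (*-identityˡ _)) (rank-0 I iO))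

    trivial-algorithm-guarantee : fromℕ 3 ≤ fromℕ 4 * ε → HasGuarantee (λ _ _ → trivialMachine) 0 (1# - e ⁻¹ - ε)
    trivial-algorithm-guarantee 3≤4ε I = trivial-guarantee I λ {O} _ →
      ≤-trans (x≤0∧0≤y⇒xy≤0 rate≤0 (Instance.nonneg I O)) (Instance.nonneg I ⊥)
      where
      rate≤0 : 1# - e ⁻¹ - ε ≤ 0#
      -- The factor 12 clears the denominators in 1/e ≥ 1/3 and ε ≥ 3/4, and 12 - 4 - 9 is negative.
      rate≤0 = *-cancelˡ-≤ (0<fromℕ-suc 11) (≤-by
        (+-nonneg (+-nonneg (*-nonneg (0≤fromℕ 4) (0≤y-x 1≤3e⁻¹)) (*-nonneg (0≤fromℕ 3) (0≤y-x 3≤4ε))) 0≤1)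
        (solve 2 (λ E ε → con (pos 4) :* (con (pos 3) :* E :- :1) :+ con (pos 3) :* (con (pos 4) :* ε :- con (pos 3)) :+ :1
            := con (pos 12) :* :0 :- con (pos 12) :* ((:1 :- E) :- ε)) refl (e ⁻¹) ε))

    module _ (4ε≤3 : fromℕ 4 * ε ≤ fromℕ 3) (m : ℕ) (2ε⁻¹≤m : fromℕ 2 * ε⁻¹ ≤ fromℕ m) (m≤2ε⁻¹+1 : fromℕ m ≤ fromℕ 2 * ε⁻¹ + 1#) where
      ε≤1 : ε ≤ 1#
      ε≤1 = *-cancelˡ-≤ (0<fromℕ-suc 3) (≤-by (+-nonneg (0≤y-x 4ε≤3) 0≤1)
        (solve 1 (λ ε → (con (pos 3) :- con (pos 4) :* ε) :+ :1 := con (pos 4) :* :1 :- con (pos 4) :* ε) refl ε))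

      1≤ε⁻¹ : 1# ≤ ε⁻¹
      1≤ε⁻¹ = subst (1# ≤_) (*-identityˡ _) (≤⇒1≤*⁻¹ 0<ε ε≤1)

      2≤εm : fromℕ 2 ≤ ε * fromℕ m
      2≤εm = subst (_≤ ε * fromℕ m) (trans (solve 2 (λ ε i → ε :* (con (pos 2) :* i) := (ε :* i) :* con (pos 2)) refl ε ε⁻¹)
          (trans (cong (_* fromℕ 2) (⁻¹-inverseʳ ε (0<⇒≢0 0<ε))) (*-identityˡ _)))
        (*-monoˡ-≤ (proj₁ 0<ε) 2ε⁻¹≤m)

      1≤m : 1 ℕ.≤ m
      1≤m = positive m 2≤εm
        where
        positive : ∀ m → fromℕ 2 ≤ ε * fromℕ m → 1 ℕ.≤ m
        positive (suc m) _ = ℕ.s≤s ℕ.z≤n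
        positive zero    p = contradiction (antisym (≤-trans p (≤-reflexive (zeroʳ ε))) (0≤fromℕ 2)) (fromℕ≢0 2)

      -- At most 5 k cells are used, whatever ε is; the constant is 36 because the pass bound shares
      -- it.
      slots-bound : ∀ n k → fromℕ (Machine.slots (algorithm m n k)) ≤ fromℕ 36 * (fromℕ k * ε⁻¹)
      slots-bound n zero    = *-nonneg (0≤fromℕ 36) (*-nonneg ≤-refl (≤-trans 0≤1 1≤ε⁻¹))
      slots-bound n (suc k) = ≤-trans (fromℕ-mono-≤ (ℕ.≤-trans (slots≤ m k) (ℕ.*-monoˡ-≤ (suc k) (ℕ.m≤m+n 5 31))))
        (≤-trans (≤-reflexive (fromℕ-* 36 (suc k))) (*-monoˡ-≤ (0≤fromℕ 36)
          (≤-trans (≤-reflexive (sym (*-identityʳ _))) (*-monoˡ-≤ (0≤fromℕ (suc k)) 1≤ε⁻¹))))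

      passes-bound : (1≤ε⁻¹′ : 1# ≤ ε⁻¹) → fromℕ (m ℕ.* m) ≤ fromℕ 36 * (ε⁻¹ ^ 2 * log ε⁻¹ 1≤ε⁻¹′)
      passes-bound 1≤ε⁻¹′ = subst (_≤ fromℕ 36 * (ε⁻¹ ^ 2 * log ε⁻¹ 1≤ε⁻¹′)) (sym (fromℕ-* m m))
        -- The difference splits into 9/ε² - m² = (3/ε - m) (3/ε + m) and 1/ε² times 36 log(1/ε) - 9
        -- = 9 (4 (log(1/ε) - (1 - ε)) + (3 - 4 ε)).
        (≤-by (+-nonneg
            (+-nonneg (*-nonneg 0≤3i (0≤y-x m≤3i)) (*-nonneg (0≤fromℕ m) (0≤y-x m≤3i)))
            (*-nonneg (*-nonneg (0≤fromℕ 9) (*-nonneg 0≤i 0≤i))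
              (+-nonneg (*-nonneg (0≤fromℕ 4) (0≤y-x (1-x≤log[x⁻¹] 0<ε ε≤1 1≤ε⁻¹′))) (0≤y-x 4ε≤3))))
          (solve 4 (λ i m l ε →
              (con (pos 3) :* i :* (con (pos 3) :* i :- m) :+ m :* (con (pos 3) :* i :- m)) :+
              con (pos 9) :* (i :* i) :* (con (pos 4) :* (l :- (:1 :- ε)) :+ (con (pos 3) :- con (pos 4) :* ε))
              := con (pos 36) :* (i :* (i :* :1) :* l) :- m :* m) refl ε⁻¹ (fromℕ m) (log ε⁻¹ 1≤ε⁻¹′) ε))
        where
        0≤i : 0# ≤ ε⁻¹
        0≤i = ≤-trans 0≤1 1≤ε⁻¹
        0≤3i : 0# ≤ fromℕ 3 * ε⁻¹
        0≤3i = *-nonneg (0≤fromℕ 3) 0≤i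
        m≤3i : fromℕ m ≤ fromℕ 3 * ε⁻¹
        m≤3i = ≤-trans m≤2ε⁻¹+1 (≤-by (0≤y-x 1≤ε⁻¹)
          (solve 1 (λ i → i :- :1 := con (pos 3) :* i :- (con (pos 2) :* i :+ :1)) refl ε⁻¹))

      algorithm-guarantee : HasGuarantee (algorithm m) (m ℕ.* m) (1# - e ⁻¹ - ε)
      algorithm-guarantee {n} {zero}  I = trivial-guarantee I (rank-0-guarantee I)
      algorithm-guarantee {n} {suc k} I =
        let (d , halts , good) = correct solution-correct
        in d , halts , Surely-map (ℕ.≤-reflexive ∘ proj₁) good , Surely-map (λ g → proj₁ (proj₂ g)) good
           , λ OPT optimal → Surely⇒expectation≥ (Surely-map (λ (_ , _ , gap) → guarantee OPT (gap OPT (proj₁ optimal))) good)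
        where
        K = suc k
        open Instance I
        open Rounds ℛ m K (ℕ.*-mono-≤ 1≤m 1≤m) I using (solution-correct)
        open DecayRate ℛ (fromℕ m) (0≤fromℕ m) using (z)
        open Solver m K using (rounds; solution; T; module Semantics)
        open Semantics ℛ I using (module Correctness)
        open Correctness (rounds T) (SolverSize.fits-rounds m K T) solution
          (λ o → Outcome.passes o ≡ T × Independent (Outcome.solution o) × (∀ O → Independent O → f O - f (Outcome.solution o) ≤ (1# - z) ^ T * f O))
          using (correct)
        guarantee : ∀ O {S} → f O - f S ≤ (1# - z) ^ T * f O → (1# - e ⁻¹ - ε) * f O ≤ f S
        guarantee O {S} gap = ≤-by (+-nonneg (0≤y-x gap) (*-nonneg (0≤y-x (decay m 1≤m 2≤εm (proj₁ 0<ε))) (nonneg O)))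
          (solve 5 (λ o s r E ε → (r :* o :- (o :- s)) :+ ((E :+ ε) :- r) :* o := s :- ((:1 :- E) :- ε) :* o) refl
            (f O) (f S) ((1# - z) ^ T) (e ⁻¹) ε)

    Solved : Set₁
    Solved = Σ[ A ∈ Algorithm ] ∃[ p ]
        SemiStreaming A
      × (∀ n k → fromℕ (Machine.slots (A n k)) ≤ fromℕ 36 * (fromℕ k * ε⁻¹))
      × ((1≤ε⁻¹ : 1# ≤ ε⁻¹) → fromℕ p ≤ fromℕ 36 * (ε⁻¹ ^ 2 * log ε⁻¹ 1≤ε⁻¹))
      × HasGuarantee A p (1# - e ⁻¹ - ε)

    0≤ε⁻¹ : 0# ≤ ε⁻¹
    0≤ε⁻¹ = ⁻¹-nonneg (proj₁ 0<ε) (0<⇒≢0 0<ε)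

    large-ε : fromℕ 3 ≤ fromℕ 4 * ε → Solved
    large-ε 3≤4ε = (λ _ _ → trivialMachine) , 0 , (0 , 0 , λ _ _ _ → ℕ.z≤n)
      , (λ n k → *-nonneg (0≤fromℕ 36) (*-nonneg (0≤fromℕ k) 0≤ε⁻¹))
      , (λ 1≤ε⁻¹ → *-nonneg (0≤fromℕ 36) (*-nonneg (^-nonneg 2 0≤ε⁻¹) (log-nonneg ε⁻¹ 1≤ε⁻¹)))
      , trivial-algorithm-guarantee 3≤4ε

    small-ε : fromℕ 4 * ε ≤ fromℕ 3 → Solved
    small-ε 4ε≤3 = let (m , 2ε⁻¹≤m , m≤2ε⁻¹+1) = ceiling (fromℕ 2 * ε⁻¹) (*-nonneg (0≤fromℕ 2) 0≤ε⁻¹) in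
      algorithm m , m ℕ.* m , algorithm-semiStreaming m
      , slots-bound 4ε≤3 m 2ε⁻¹≤m m≤2ε⁻¹+1
      , passes-bound 4ε≤3 m 2ε⁻¹≤m m≤2ε⁻¹+1
      , algorithm-guarantee 4ε≤3 m 2ε⁻¹≤m m≤2ε⁻¹+1

theorem3 :
  (ℛ : CompleteOrderedField) →
  let open CompleteOrderedField ℛ
      open ExpLog ℛ
      open Streaming ℛ
  in
  ∃[ C ] ∀ (ε : ℝ) → 0# < ε →
    Σ[ A ∈ Algorithm ] ∃[ p ]
      SemiStreaming A
    × (∀ n k → fromℕ (Machine.slots (A n k)) ≤ fromℕ C * (fromℕ k * ε ⁻¹))
    × ((1≤ε⁻¹ : 1# ≤ ε ⁻¹) → fromℕ p ≤ fromℕ C * ((ε ⁻¹) ^ 2 * log (ε ⁻¹) 1≤ε⁻¹))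
    × HasGuarantee A p (1# - e ⁻¹ - ε)
theorem3 ℛ = 36 , λ ε 0<ε → [ large-ε 0<ε , small-ε 0<ε ]′ (total (fromℕ 3) (fromℕ 4 * ε))
  where
  open CompleteOrderedField ℛ
  open Guarantees ℛ
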